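{- Let $k\ge1$, $m\ge1$, let $1\le t_1,\dots,t_m\le k$ be distinct integers, $a_1,\dots,a_m$ positive integers, $P=R_{t_1}^{a_1}\cup\cdots\cup R_{t_m}^{a_m}$, and $\alpha_u=\#\{v:1\le v\le m,\ t_v\ge u\}$ for $u\in\mathbb Z_{>0}$. Let $\lambda\in\mathcal P^k$ be nonempty, let $\bar\lambda=(\lambda_1,\dots,\lambda_{l(\lambda)-1})$, $\bar l=l(\lambda)-1$, and suppose $\bar\lambda\subset R_{k+1-\bar l}$. Put $r=\lambda_{l(\lambda)}$ and assume $\max_i t_i<\bar\lambda_{\bar l}$ (with $\bar\lambda_0:=\infty$, so this assumption is vacuous when $l(\lambda)=1$). Then (1) $\displaystyle g^{(k)}_P\,g^{(k)}_\lambda=\sum_{s=0}^{r}(-1)^s\binom{\alpha_{r+1-s}}{s}g^{(k)}_{P\cup\bar\lambda\cup(r-s)}$; (2) $\displaystyle g^{(k)}_{P\cup\lambda}=g^{(k)}_P\sum_{s=0}^{r}\binom{\alpha_r+s-1}{s}g^{(k)}_{\bar\lambda\cup(r-s)}$. In particular, if $\max_i t_i<r$, then $g^{(k)}_{P\cup\lambda}=g^{(k)}_P\,g^{(k)}_\lambda$.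
   Context: Partitions are identified with Young diagrams in French notation (cells $(i,j)$ with $j\le\lambda_i$, row $i$ from the bottom); $l(\lambda)$ is the number of nonzero parts, $\lambda'$ the conjugate; $\lambda\cup\mu$ is the partition whose multiset of parts is the union of those of $\lambda$ and $\mu$; $(s)$ is a one-part partition and $\lambda\cup(0)=\lambda$. $\mathcal P^k$ is the set of partitions with $\lambda_1\le k$. For $1\le t\le k$, $R_t=(t^{k+1-t})$, and $R_t:=\emptyset$ for other integers $t$; $R_t^a$ is the union of $a$ copies of $R_t$. The hook length of $c=(i,j)\in\lambda$ is $\lambda_i+\lambda'_j-i-j+1$. A $(k+1)$-core has no cell of hook length $k+1$; $|\kappa|_{k+1}$ is its number of cells of hook length $<k+1$. The map $\mathfrak p(\kappa)_i=\#\{j:(i,j)\in\kappa,\ \text{hook length}\le k\}$ is a bijection from $(k+1)$-cores to $\mathcal P^k$ with inverse $\mathfrak c$. The residue of $(i,j)$ is $j-i\bmod(k+1)$. For $(k+1)$-cores $\tau\subset\kappa$, $\kappa/\tau$ is a weak $r$-strip if it is a horizontal strip, $|\kappa|_{k+1}=|\tau|_{k+1}+r$, and its cells have exactly $r$ distinct residues. A removable corner of $\mu$ is $(i,j)\in\mu$ with $(i+1,j),(i,j+1)\notin\mu$; $(i,j)$ is $\lambda$-blocked if $(i+1,j)\in\lambda$; $r_{\lambda\mu}$ is the number of distinct residues of non-$\lambda$-blocked removable corners of $\mu$. $h_r$ are the complete homogeneous symmetric functions ($h_0=1$), $\Lambda^{(k)}=\mathbb Z[h_1,\dots,h_k]$.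 $\binom ab=a(a-1)\cdots(a-b+1)/b!$ for $a\in\mathbb Z$, $b\ge0$, and $0$ for $b<0$. The $K$-$k$-Schur functions $\{g^{(k)}_\lambda\}_{\lambda\in\mathcal P^k}$ are the unique elements of $\Lambda^{(k)}$ with $g^{(k)}_\emptyset=1$ and, for $\lambda\in\mathcal P^k$, $0\le r\le k$, $$h_r\,g^{(k)}_\lambda=\sum_{s=0}^{r}(-1)^{r-s}\sum_{\mu\in\mathcal P^k:\ \mathfrak c(\mu)/\mathfrak c(\lambda)\text{ weak }s\text{ -strip}}\binom{r_{\mathfrak c(\mu)\mathfrak c(\lambda)}}{r-s}g^{(k)}_\mu .$$ -}

module Defs where

open import Data.Bool using (Bool; true; false; _∧_; not; if_then_else_; T)
open import Data.Bool.ListAction using (and)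
open import Data.Nat as ℕ using (ℕ; zero; suc; _+_; _*_; _∸_; _≤_; _<_; _!; _%_; _≡ᵇ_; _≤ᵇ_)
open import Data.Nat.Properties using (_!≢0)
open import Data.Integer as ℤ using (ℤ; +_)
open import Data.Integer.DivMod using (_/ℕ_)
open import Data.List using (List; []; _∷_; _++_; length; map; filter; concat; concatMap;
  applyUpTo; upTo; replicate; foldr; deduplicate; allFin)
open import Data.List.Relation.Unary.All using (All)
open import Data.Vec as Vec using (Vec; zipWith; tabulate)
open import Data.Vec.Properties using (≡-dec)
open import Data.Fin using (Fin; toℕ)
open import Data.Product using (_×_; _,_; proj₁; proj₂; ∃)
open import Data.Unit using (⊤)
open import Relation.Nullary.Decidable using (does; ⌊_⌋)
open import Relation.Binary.PropositionalEquality using (_≡_)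

allᵇ : ∀ {A : Set} → (A → Bool) → List A → Bool
allᵇ p xs = and (map p xs)

-- Partitions are lists of parts (λ₁ ≥ λ₂ ≥ … , 1-indexed rows, row 1 at
-- the bottom in French notation).

part : List ℕ → ℕ → ℕ
part xs       zero          = 0
part []       (suc i)       = 0
part (x ∷ xs) (suc zero)    = x
part (x ∷ xs) (suc (suc i)) = part xs (suc i)

Decr : List ℕ → Set
Decr []           = ⊤
Decr (x ∷ [])     = ⊤
Decr (x ∷ y ∷ xs) = y ≤ x × Decr (y ∷ xs)

decrᵇ : List ℕ → Bool
decrᵇ []           = true
decrᵇ (x ∷ [])     = true
decrᵇ (x ∷ y ∷ xs) = (y ≤ᵇ x) ∧ decrᵇ (y ∷ xs)

IsPartition : List ℕ → Set
IsPartition λ' = Decr λ' × All (λ x → 1 ≤ x) λ'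

isPartitionᵇ : List ℕ → Bool
isPartitionᵇ λ' = decrᵇ λ' ∧ allᵇ (λ x → 1 ≤ᵇ x) λ'

InPk : ℕ → List ℕ → Set
InPk k λ' = IsPartition λ' × All (λ x → x ≤ k) λ'

_⊆P_ : List ℕ → List ℕ → Set
μ ⊆P ν = ∀ i → part μ i ≤ part ν i

-- multiset union, realised as sorting into a weakly decreasing list;
-- zero parts are dropped (so λ ∪ (0) = λ)
insertD : ℕ → List ℕ → List ℕ
insertD zero    ys       = ys
insertD (suc x) []       = suc x ∷ []
insertD (suc x) (y ∷ ys) = if y ≤ᵇ suc x then suc x ∷ y ∷ ys else y ∷ insertD (suc x) ys

sortD : List ℕ → List ℕ
sortD = foldr insertD []

infixr 6 _∪P_
_∪P_ : List ℕ → List ℕ → List ℕ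
λ' ∪P μ = sortD (λ' ++ μ)

single : ℕ → List ℕ
single s = sortD (s ∷ [])

initP : List ℕ → List ℕ
initP []           = []
initP (x ∷ [])     = []
initP (x ∷ y ∷ xs) = x ∷ initP (y ∷ xs)

lastP : List ℕ → ℕ
lastP []           = 0
lastP (x ∷ [])     = x
lastP (x ∷ y ∷ xs) = lastP (y ∷ xs)

R : ℕ → ℕ → List ℕ
R k t = if (1 ≤ᵇ t) ∧ (t ≤ᵇ k) then replicate (k + 1 ∸ t) t else []

bigP : (k m : ℕ) → (Fin m → ℕ) → (Fin m → ℕ) → List ℕ
bigP k m t a = sortD (concat (map (λ v → concat (replicate (a v) (R k (t v)))) (allFin m)))

α : (m : ℕ) → (Fin m → ℕ) → ℕ → ℕ
α m t u = length (filter (λ v → u ℕ.≤? t v) (allFin m))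

conjPart : List ℕ → ℕ → ℕ
conjPart κ j = length (filter (λ x → j ℕ.≤? x) κ)

hook : List ℕ → ℕ → ℕ → ℕ
hook κ i j = (part κ i ∸ j) + (conjPart κ j ∸ i) + 1

cells : List ℕ → List (ℕ × ℕ)
cells κ = concat (applyUpTo (λ i → applyUpTo (λ j → (suc i , suc j)) (part κ (suc i))) (length κ))

isCoreᵇ : ℕ → List ℕ → Bool
isCoreᵇ k κ = allᵇ (λ c → not (hook κ (proj₁ c) (proj₂ c) ≡ᵇ suc k)) (cells κ)

sizeK : ℕ → List ℕ → ℕ
sizeK k κ = length (filter (λ c → hook κ (proj₁ c) (proj₂ c) ℕ.<? suc k) (cells κ))

-- the bijection 𝔭 from (k+1)-cores to 𝓟^k
pmap : ℕ → List ℕ → List ℕ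
pmap k κ = applyUpTo (λ i → length (filter (λ j → hook κ (suc i) (suc j) ℕ.≤? k) (upTo (part κ (suc i))))) (length κ)

-- residue of (i,j): j - i mod (k+1)   (computed as (j + k i) mod (k+1))
residue : ℕ → ℕ × ℕ → ℕ
residue k c = (proj₂ c + k * proj₁ c) % suc k

distinctCount : List ℕ → ℕ
distinctCount xs = length (deduplicate ℕ._≟_ xs)

isHStripᵇ : List ℕ → List ℕ → Bool
isHStripᵇ κ τ = allᵇ (λ i → (part τ i ≤ᵇ part κ i) ∧ (part κ (suc i) ≤ᵇ part τ i))
                    (applyUpTo suc (length κ + length τ))

skewCells : List ℕ → List ℕ → List (ℕ × ℕ)
skewCells κ τ = filter (λ c → part τ (proj₁ c) ℕ.<? proj₂ c) (cells κ)

weakStripᵇ : ℕ → List ℕ → List ℕ → ℕ → Bool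
weakStripᵇ k κ τ s = isHStripᵇ κ τ
                   ∧ (sizeK k κ ≡ᵇ sizeK k τ + s)
                   ∧ (distinctCount (map (residue k) (skewCells κ τ)) ≡ᵇ s)

-- finite list of candidate shapes containing every κ with κ/τ a weak
-- s-strip, s ≤ k: l(κ) ≤ l(τ)+1, τ_i ≤ κ_i, and κ_i ≤ τ_1 + k (row 1 of a
-- horizontal strip with ≥ k+1 new cells would carry all k+1 residues).
candList : List ℕ → ℕ → List (List ℕ)
candList []         U = [] ∷ []
candList (lo ∷ los) U = concatMap (λ x → map (x ∷_) (candList los U)) (map (λ y → lo + y) (upTo (suc U ∸ lo)))

candidates : ℕ → List ℕ → List (List ℕ)
candidates k τ = map (filter (λ x → 1 ℕ.≤? x)) (candList (τ ++ (0 ∷ [])) (part τ 1 + k))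

-- all (k+1)-cores κ with κ/τ a weak s-strip (each exactly once)
weakStrips : ℕ → List ℕ → ℕ → List (List ℕ)
weakStrips k τ s = filter (λ κ → T? (isPartitionᵇ κ ∧ isCoreᵇ k κ ∧ weakStripᵇ k κ τ s)) (candidates k τ)
  where
  open import Relation.Nullary using (Dec; yes; no)
  open import Data.Bool.Properties using (T?)

removableCorners : List ℕ → List (ℕ × ℕ)
removableCorners μ = filter (λ c → part μ (suc (proj₁ c)) ℕ.<? proj₂ c)
                            (applyUpTo (λ i → (suc i , part μ (suc i))) (length μ))

-- r_{λμ}: distinct residues of the non-λ-blocked removable corners of μ
-- ((i,j) is λ-blocked iff (i+1,j) ∈ λ iff j ≤ λ_{i+1})
rLM : ℕ → List ℕ → List ℕ → ℕ
rLM k λ' μ = distinctCount (map (residue k)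
               (filter (λ c → part λ' (suc (proj₁ c)) ℕ.<? proj₂ c) (removableCorners μ)))

falling : ℤ → ℕ → ℤ
falling a zero    = + 1
falling a (suc b) = falling a b ℤ.* (a ℤ.- + b)

binom : ℤ → ℕ → ℤ
binom a b = (falling a b /ℕ (b !)) {{b !≢0}}

sgn : ℕ → ℤ
sgn zero    = + 1
sgn (suc n) = ℤ.- sgn n

-- The ring Λ^(k) = ℤ[h_1,…,h_k], realised inside the formal power series
-- ring ℤ[[h_1,…,h_k]] (functions from exponent vectors to ℤ, with
-- extensional equality); polynomials are the finitely supported series.

Ser : ℕ → Set
Ser k = Vec ℕ k → ℤ

infix 4 _≈S_
_≈S_ : ∀ {k} → Ser k → Ser k → Set
p ≈S q = ∀ e → p e ≡ q e

below : ∀ {n} → Vec ℕ n → List (Vec ℕ n)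
below Vec.[]       = Vec.[] ∷ []
below (x Vec.∷ v)  = concatMap (λ a → map (a Vec.∷_) (below v)) (upTo (suc x))

sumℤ : List ℤ → ℤ
sumℤ = foldr ℤ._+_ (+ 0)

infixl 7 _*S_
infixl 6 _+S_
_+S_ : ∀ {k} → Ser k → Ser k → Ser k
(p +S q) e = p e ℤ.+ q e

_*S_ : ∀ {k} → Ser k → Ser k → Ser k
(p *S q) e = sumℤ (map (λ a → p a ℤ.* q (zipWith _∸_ e a)) (below e))

infixr 8 _•S_
_•S_ : ∀ {k} → ℤ → Ser k → Ser k
(c •S p) e = c ℤ.* p e

zeroS : ∀ {k} → Ser k
zeroS e = + 0

sumS : ∀ {k} → List (Ser k) → Ser k
sumS = foldr _+S_ zeroS

unitVec : (k r : ℕ) → Vec ℕ k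
unitVec k r = tabulate (λ i → if suc (toℕ i) ≡ᵇ r then 1 else 0)

-- h_r as an element of ℤ[[h_1,…,h_k]] (used for 0 ≤ r ≤ k; h_0 = 1)
hS : (k r : ℕ) → Ser k
hS k r e = if does (≡-dec ℕ._≟_ e (unitVec k r)) then + 1 else + 0

oneS : ∀ k → Ser k
oneS k = hS k 0

FinSupp : ∀ {k} → Ser k → Set
FinSupp p = ∃ λ N → ∀ e → N < Vec.sum e → p e ≡ + 0

-- The defining property of the K-k-Schur functions {g_λ}_{λ ∈ 𝓟^k}.
-- The Pieri rule is indexed by the (k+1)-core τ = 𝔠(λ) (so λ = 𝔭(τ)),
-- and the inner sum over μ is a sum over cores κ = 𝔠(μ) (μ = 𝔭(κ)).

PieriRule : (k : ℕ) → (List ℕ → Ser k) → Set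
PieriRule k g =
  ∀ τ → T (isPartitionᵇ τ ∧ isCoreᵇ k τ) → ∀ r → r ≤ k →
  (hS k r *S g (pmap k τ)) ≈S
    sumS (map (λ s → sumS (map (λ κ → (sgn (r ∸ s) ℤ.* binom (+ rLM k κ τ) (r ∸ s)) •S g (pmap k κ))
                                 (weakStrips k τ s)))
              (upTo (suc r)))

IsKkSchur : (k : ℕ) → (List ℕ → Ser k) → Set
IsKkSchur k g = (∀ λ' → InPk k λ' → FinSupp (g λ'))
              × (g [] ≈S oneS k)
              × PieriRule k g

-- Let n = k + 1. A core κ with first row x and remaining rows κ′ satisfies x = v + κ′_{n-v}, where v is the
-- first part of 𝔭(κ); this turns every question about cores into arithmetic on lists of row lengths. For
-- P = ⋃ R_q the core of λ̄ ∪ P is explicit: with S the sum of the q, the rows of λ̄ are lengthened by S and sit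
-- below blocks of n - q rows with lengths S, S - q, …. The weak strips over it are therefore indexed, just as
-- for P = ∅, by pairs (μ̄, x) of a horizontal strip μ̄/λ̄ and a new part x, and adding P only adds α_{x+1} to
-- the number of unblocked corner residues. Comparing the Pieri rules for h_r g_λ̄ and h_r g_{P∪λ̄}, formula (1)
-- follows by induction on l(λ̄) and r from the Vandermonde identity. Since the t_i are distinct,
-- α_{y+1} - α_r < r - y for y < r, so (1-z)^{α_{y+1} - α_r} has no term in z^{r-y}; this inverts (1) to (2), and
-- when α_r = 0 it leaves only the first term of (1).
module Submission where

-- The count α_{x+1} comes from residues. One row up adds k, that is -1, so crossing the k+1-q rows
-- of R_q adds q modulo k+1. Hence all cells that a new part x creates inside P share x consecutive
-- residues, and all copies of R_q end in corners of one residue, unblocked exactly when x < q.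
-- These corners never meet those of λ̄, whose relative residues exceed max t.
--
-- That no other weak strips exist rests on two opposite estimates for a strip given by μ̄ and x: it
-- has at least |μ̄/λ̄| + x distinct residues, while the size of 𝔭 grows by at most |μ̄/λ̄| + x. A
-- weak s-strip needs both to be s, and equality in the second leaves a single core.
--
-- In the comparison of Pieri rules every product g_P g_{μ̄ ∪ (x)} with x < r is known by induction;
-- x = r forces μ̄ = λ̄ and has coefficient 1, so it can be solved for. The input g_P g_λ̄ = g_{P ∪
-- λ̄} is itself (1) with the last part of λ̄ split off: that part exceeds max t, which kills all
-- terms but the first.

open import Defs
open import Data.Bool using (Bool; true; false; T; _∧_; if_then_else_; not)
open import Data.Bool.Properties using (T-∧; T?)
open import Data.Empty using (⊥)
open import Data.Fin using (Fin)
open import Data.Integer as ℤ using (ℤ; +_)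
import Data.Integer.Properties as ℤₚ
import Data.Integer.Tactic.RingSolver as ℤ-Ring
open import Data.List using (List; []; _∷_; _++_; map; concatMap; applyUpTo; upTo; filter; length; deduplicate; concat; replicate; initLast; _∷ʳ′_; allFin)
open import Data.List.Membership.Propositional using (_∈_)
open import Data.List.Membership.Propositional.Properties using (∈-deduplicate⁺; ∈-deduplicate⁻; ∈-∃++; ∈-++⁺ˡ; ∈-++⁺ʳ; ∈-++⁻; ∈-map⁺; ∈-map⁻; ∈-applyUpTo⁺; ∈-applyUpTo⁻; ∈-upTo⁻; ∈-upTo⁺; ∈-filter⁺; ∈-filter⁻; ∈-allFin)
open import Data.List.Membership.Propositional.Properties.WithK using (unique∧set⇒bag)
open import Data.List.Properties using (map-++; map-∘; map-cong; length-++; filter-++; filter-accept; filter-reject; map-applyUpTo; map-id; ∷-injectiveˡ; ∷-injectiveʳ; length-map; length-upTo; ++-assoc; ++-identityʳ; map-replicate; concatMap-++)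
open import Data.List.Relation.Binary.BagAndSetEquality using (∼bag⇒↭)
open import Data.List.Relation.Binary.Permutation.Propositional as ↭ using (_↭_; ↭-sym; ↭-reflexive)
import Data.List.Relation.Binary.Permutation.Propositional.Properties as ↭ₚ
open import Data.List.Relation.Binary.Permutation.Propositional.Properties using (∈-resp-↭; All-resp-↭; drop-∷; ↭-empty-inv)
open import Data.List.Relation.Unary.All as All using (All; []; _∷_)
import Data.List.Relation.Unary.All.Properties as Allₚ
open import Data.List.Relation.Unary.AllPairs using ([]; _∷_)
open import Data.List.Relation.Unary.Any using (here; there)
open import Data.List.Relation.Unary.Unique.DecPropositional.Properties using (deduplicate-!)
open import Data.List.Relation.Unary.Unique.Propositional using (Unique)
import Data.List.Relation.Unary.Unique.Propositional.Properties as Uniqueₚ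
open import Data.Nat as ℕ using (ℕ; zero; suc; _+_; _*_; _∸_; _≤_; _<_; _!; z≤n; s≤s; _≤ᵇ_; _≡ᵇ_; _⊓_; _⊔_; _%_)
open import Data.Nat.DivMod using (m*n/n≡m; [m+kn]%n≡m%n; %-distribˡ-+; m<n⇒m%n≡m)
open import Data.Nat.ListAction using (sum)
open import Data.Nat.ListAction.Properties using (sum-++)
open import Data.Nat.Properties
import Data.Nat.Tactic.RingSolver as ℕ-Ring
open import Data.Product using (_×_; _,_; proj₁; proj₂; ∃; ∃₂)
open import Data.Sum using (inj₁; inj₂; _⊎_)
open import Data.Unit using (tt; ⊤)
open import Data.Vec as Vec using (Vec; zipWith)
open import Function using (_∘_; id; mk⇔; Equivalence)
open import Level using (0ℓ)
open import Relation.Binary using (tri<; tri≈; tri>)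
open import Relation.Binary.PropositionalEquality using (_≡_; refl; sym; trans; cong; cong₂; subst; module ≡-Reasoning; _≢_)
open import Relation.Nullary using (yes; no; does; contradiction; ¬_)
open import Relation.Unary using (Pred; Decidable)
open import Algebra.Properties.AbelianGroup ℤₚ.+-0-abelianGroup using (∙-cancelˡ; ∙-cancelʳ)
open ≡-Reasoning

-- Finite sums of integers

+-swap : ∀ a b c d → (a ℤ.+ b) ℤ.+ (c ℤ.+ d) ≡ (a ℤ.+ c) ℤ.+ (b ℤ.+ d)
+-swap = ℤ-Ring.solve-∀

Σ≤ : ℕ → (ℕ → ℤ) → ℤ
Σ≤ zero    f = f 0
Σ≤ (suc n) f = f 0 ℤ.+ Σ≤ n (f ∘ suc)

Σ≤-cong : ∀ n {f g : ℕ → ℤ} → (∀ i → i ≤ n → f i ≡ g i) → Σ≤ n f ≡ Σ≤ n g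
Σ≤-cong zero    h = h 0 z≤n
Σ≤-cong (suc n) h = cong₂ ℤ._+_ (h 0 z≤n) (Σ≤-cong n λ i i≤n → h (suc i) (s≤s i≤n))

Σ≤-zero : ∀ n {f : ℕ → ℤ} → (∀ i → i ≤ n → f i ≡ + 0) → Σ≤ n f ≡ + 0
Σ≤-zero zero    h = h 0 z≤n
Σ≤-zero (suc n) h = cong₂ ℤ._+_ (h 0 z≤n) (Σ≤-zero n λ i i≤n → h (suc i) (s≤s i≤n))

Σ≤-+ : ∀ n (f g : ℕ → ℤ) → Σ≤ n (λ i → f i ℤ.+ g i) ≡ Σ≤ n f ℤ.+ Σ≤ n g
Σ≤-+ zero    f g = refl
Σ≤-+ (suc n) f g = trans (cong (ℤ._+_ (f 0 ℤ.+ g 0)) (Σ≤-+ n (f ∘ suc) (g ∘ suc)))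
  (+-swap (f 0) (g 0) (Σ≤ n (f ∘ suc)) (Σ≤ n (g ∘ suc)))

Σ≤-*ˡ : ∀ n c (f : ℕ → ℤ) → c ℤ.* Σ≤ n f ≡ Σ≤ n (λ i → c ℤ.* f i)
Σ≤-*ˡ zero    c f = refl
Σ≤-*ˡ (suc n) c f = trans (ℤₚ.*-distribˡ-+ c (f 0) _) (cong (ℤ._+_ (c ℤ.* f 0)) (Σ≤-*ˡ n c (f ∘ suc)))

Σ≤-last : ∀ n (f : ℕ → ℤ) → Σ≤ (suc n) f ≡ Σ≤ n f ℤ.+ f (suc n)
Σ≤-last zero    f = refl
Σ≤-last (suc n) f = trans (cong (ℤ._+_ (f 0)) (Σ≤-last n (f ∘ suc))) (sym (ℤₚ.+-assoc (f 0) _ _))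

Σ≤-first : ∀ n {f : ℕ → ℤ} → (∀ i → suc i ≤ n → f (suc i) ≡ + 0) → Σ≤ n f ≡ f 0
Σ≤-first zero    h = refl
Σ≤-first (suc n) {f} h =
  trans (cong (ℤ._+_ (f 0)) (Σ≤-zero n λ i i≤n → h i (s≤s i≤n))) (ℤₚ.+-identityʳ _)

Σ≤-reverse : ∀ n (f : ℕ → ℤ) → Σ≤ n f ≡ Σ≤ n (λ i → f (n ∸ i))
Σ≤-reverse zero    f = refl
Σ≤-reverse (suc n) f = begin
  Σ≤ (suc n) f                         ≡⟨ Σ≤-last n f ⟩
  Σ≤ n f ℤ.+ f (suc n)                 ≡⟨ ℤₚ.+-comm _ (f (suc n)) ⟩
  f (suc n) ℤ.+ Σ≤ n f                 ≡⟨ cong (ℤ._+_ (f (suc n))) (Σ≤-reverse n f) ⟩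
  f (suc n) ℤ.+ Σ≤ n (λ i → f (n ∸ i)) ∎

-- Both sides run over the triples with sum `n`, grouped once as (b + c) + d and once as b + (c +
-- d). Associativity of the series product and `expansion-conv` rest on this exchange.
Σ≤-triangle : ∀ n (f : ℕ → ℕ → ℕ → ℤ) →
  Σ≤ n (λ a → Σ≤ a (λ b → f b (a ∸ b) (n ∸ a))) ≡
  Σ≤ n (λ b → Σ≤ (n ∸ b) (λ c → f b c (n ∸ b ∸ c)))
Σ≤-triangle zero    f = refl
Σ≤-triangle (suc n) f = begin
  f 0 0 (suc n) ℤ.+ Σ≤ n (λ a → f 0 (suc a) (n ∸ a) ℤ.+ Σ≤ a (λ b → f (suc b) (a ∸ b) (n ∸ a)))
    ≡⟨ cong (ℤ._+_ (f 0 0 (suc n))) (Σ≤-+ n _ _) ⟩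
  f 0 0 (suc n) ℤ.+ (Σ≤ n (λ a → f 0 (suc a) (n ∸ a)) ℤ.+ Σ≤ n (λ a → Σ≤ a (λ b → f (suc b) (a ∸ b) (n ∸ a))))
    ≡⟨ sym (ℤₚ.+-assoc (f 0 0 (suc n)) _ _) ⟩
  Σ≤ (suc n) (λ c → f 0 c (suc n ∸ c)) ℤ.+ Σ≤ n (λ a → Σ≤ a (λ b → f (suc b) (a ∸ b) (n ∸ a)))
    ≡⟨ cong (ℤ._+_ (Σ≤ (suc n) (λ c → f 0 c (suc n ∸ c)))) (Σ≤-triangle n (f ∘ suc)) ⟩
  Σ≤ (suc n) (λ c → f 0 c (suc n ∸ c)) ℤ.+ Σ≤ n (λ b → Σ≤ (n ∸ b) (λ c → f (suc b) c (n ∸ b ∸ c))) ∎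

sumℤ-applyUpTo : ∀ n (g : ℕ → ℕ) (f : ℕ → ℤ) → sumℤ (map f (applyUpTo g (suc n))) ≡ Σ≤ n (f ∘ g)
sumℤ-applyUpTo zero    g f = ℤₚ.+-identityʳ _
sumℤ-applyUpTo (suc n) g f = cong (ℤ._+_ (f (g 0))) (sumℤ-applyUpTo n (g ∘ suc) f)

sumℤ-upTo : ∀ n (f : ℕ → ℤ) → sumℤ (map f (upTo (suc n))) ≡ Σ≤ n f
sumℤ-upTo n f = sumℤ-applyUpTo n id f

sumℤ-++ : ∀ xs ys → sumℤ (xs ++ ys) ≡ sumℤ xs ℤ.+ sumℤ ys
sumℤ-++ []       ys = sym (ℤₚ.+-identityˡ _)
sumℤ-++ (x ∷ xs) ys = trans (cong (ℤ._+_ (x)) (sumℤ-++ xs ys)) (sym (ℤₚ.+-assoc x _ _))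

sumℤ-concatMap : ∀ {A B : Set} (F : B → ℤ) (h : A → List B) xs →
  sumℤ (map F (concatMap h xs)) ≡ sumℤ (map (λ a → sumℤ (map F (h a))) xs)
sumℤ-concatMap F h []       = refl
sumℤ-concatMap F h (x ∷ xs) = begin
  sumℤ (map F (h x ++ concatMap h xs))               ≡⟨ cong sumℤ (map-++ F (h x) _) ⟩
  sumℤ (map F (h x) ++ map F (concatMap h xs))       ≡⟨ sumℤ-++ (map F (h x)) _ ⟩
  sumℤ (map F (h x)) ℤ.+ sumℤ (map F (concatMap h xs)) ≡⟨ cong (ℤ._+_ (sumℤ (map F (h x)))) (sumℤ-concatMap F h xs) ⟩
  sumℤ (map F (h x)) ℤ.+ sumℤ (map (λ a → sumℤ (map F (h a))) xs) ∎

sumℤ-*ˡ : ∀ {A : Set} c (f : A → ℤ) xs → c ℤ.* sumℤ (map f xs) ≡ sumℤ (map (λ x → c ℤ.* f x) xs)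
sumℤ-*ˡ c f []       = ℤₚ.*-zeroʳ c
sumℤ-*ˡ c f (x ∷ xs) = trans (ℤₚ.*-distribˡ-+ c (f x) _) (cong (ℤ._+_ (c ℤ.* f x)) (sumℤ-*ˡ c f xs))

sumℤ-+ : ∀ {A : Set} (f g : A → ℤ) xs →
  sumℤ (map (λ x → f x ℤ.+ g x) xs) ≡ sumℤ (map f xs) ℤ.+ sumℤ (map g xs)
sumℤ-+ f g []       = refl
sumℤ-+ f g (x ∷ xs) = trans (cong (ℤ._+_ (f x ℤ.+ g x)) (sumℤ-+ f g xs)) (+-swap (f x) (g x) _ _)

sumℤ-swap : ∀ {A B : Set} (f : A → B → ℤ) xs ys →
  sumℤ (map (λ x → sumℤ (map (f x) ys)) xs) ≡ sumℤ (map (λ y → sumℤ (map (λ x → f x y) xs)) ys)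
sumℤ-swap f []       []       = refl
sumℤ-swap f []       (y ∷ ys) = trans (sumℤ-swap f [] ys) (sym (ℤₚ.+-identityˡ _))
sumℤ-swap f (x ∷ xs) ys       =
  trans (cong (ℤ._+_ (sumℤ (map (f x) ys))) (sumℤ-swap f xs ys)) (sym (sumℤ-+ (f x) (λ y → sumℤ (map (λ x → f x y) xs)) ys))

sumℤ-Σ≤-swap : ∀ {A : Set} n (f : A → ℕ → ℤ) xs →
  sumℤ (map (λ x → Σ≤ n (f x)) xs) ≡ Σ≤ n (λ i → sumℤ (map (λ x → f x i) xs))
sumℤ-Σ≤-swap n f xs = begin
  sumℤ (map (λ x → Σ≤ n (f x)) xs)
    ≡⟨ cong sumℤ (map-cong (λ x → sym (sumℤ-upTo n (f x))) xs) ⟩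
  sumℤ (map (λ x → sumℤ (map (f x) (upTo (suc n)))) xs)
    ≡⟨ sumℤ-swap f xs (upTo (suc n)) ⟩
  sumℤ (map (λ i → sumℤ (map (λ x → f x i) xs)) (upTo (suc n)))
    ≡⟨ sumℤ-upTo n (λ i → sumℤ (map (λ x → f x i) xs)) ⟩
  Σ≤ n (λ i → sumℤ (map (λ x → f x i) xs)) ∎

sumS-eval : ∀ {A : Set} {k} (F : A → Ser k) xs e → sumS (map F xs) e ≡ sumℤ (map (λ x → F x e) xs)
sumS-eval F []       e = refl
sumS-eval F (x ∷ xs) e = cong (ℤ._+_ (F x e)) (sumS-eval F xs e)

-- Signed binomial sequences

δ : ℕ → ℤ
δ zero    = + 1
δ (suc i) = + 0

-- On generating functions this is multiplication by 1 - z, so it moves freely between the factors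
-- of a convolution.
Δ : (ℕ → ℤ) → ℕ → ℤ
Δ f zero    = f 0
Δ f (suc n) = f (suc n) ℤ.- f n

conv : (ℕ → ℤ) → (ℕ → ℤ) → ℕ → ℤ
conv f g n = Σ≤ n (λ i → f i ℤ.* g (n ∸ i))

conv-cong : ∀ {f f′ g g′ : ℕ → ℤ} → (∀ i → f i ≡ f′ i) → (∀ i → g i ≡ g′ i) →
  ∀ n → conv f g n ≡ conv f′ g′ n
conv-cong p q n = Σ≤-cong n λ i _ → cong₂ ℤ._*_ (p i) (q (n ∸ i))

conv-comm : ∀ f g n → conv f g n ≡ conv g f n
conv-comm f g n = trans (Σ≤-reverse n _) (Σ≤-cong n λ i i≤n →
  trans (ℤₚ.*-comm (f (n ∸ i)) _) (cong (λ j → g j ℤ.* f (n ∸ i)) (m∸[m∸n]≡n i≤n)))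

conv-δˡ : ∀ g n → conv δ g n ≡ g n
conv-δˡ g zero    = ℤₚ.*-identityˡ _
conv-δˡ g (suc n) = trans
  (cong₂ ℤ._+_ (ℤₚ.*-identityˡ (g (suc n))) (Σ≤-zero n λ i _ → ℤₚ.*-zeroˡ (g (n ∸ suc i)))) (ℤₚ.+-identityʳ _)

conv-Δˡ : ∀ f g n → conv (Δ f) g n ≡ Δ (conv f g) n
conv-Δˡ f g zero    = refl
conv-Δˡ f g (suc n) = begin
  a ℤ.+ Σ≤ n (λ i → (f (suc i) ℤ.- f i) ℤ.* g (n ∸ i))
    ≡⟨ cong (ℤ._+_ (a)) (trans (Σ≤-cong n λ i _ → split (f (suc i)) (f i) (g (n ∸ i))) (Σ≤-+ n _ _)) ⟩
  a ℤ.+ (Σ≤ n (λ i → f (suc i) ℤ.* g (n ∸ i)) ℤ.+ Σ≤ n (λ i → ℤ.- + 1 ℤ.* (f i ℤ.* g (n ∸ i))))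
    ≡⟨ cong (λ z → a ℤ.+ (Σ≤ n (λ i → f (suc i) ℤ.* g (n ∸ i)) ℤ.+ z)) (sym (Σ≤-*ˡ n (ℤ.- + 1) (λ i → f i ℤ.* g (n ∸ i)))) ⟩
  a ℤ.+ (Σ≤ n (λ i → f (suc i) ℤ.* g (n ∸ i)) ℤ.+ ℤ.- + 1 ℤ.* conv f g n)
    ≡⟨ regroup a _ (conv f g n) ⟩
  conv f g (suc n) ℤ.- conv f g n ∎
  where
  a = f 0 ℤ.* g (suc n)
  split : ∀ x y z → (x ℤ.- y) ℤ.* z ≡ x ℤ.* z ℤ.+ ℤ.- + 1 ℤ.* (y ℤ.* z)
  split = ℤ-Ring.solve-∀
  regroup : ∀ x y z → x ℤ.+ (y ℤ.+ ℤ.- + 1 ℤ.* z) ≡ (x ℤ.+ y) ℤ.- z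
  regroup = ℤ-Ring.solve-∀

Δ-cong : ∀ {f g : ℕ → ℤ} → (∀ i → f i ≡ g i) → ∀ n → Δ f n ≡ Δ g n
Δ-cong p zero    = p 0
Δ-cong p (suc n) = cong₂ ℤ._-_ (p (suc n)) (p n)

conv-Δ-shift : ∀ f g n → conv f (Δ g) n ≡ conv (Δ f) g n
conv-Δ-shift f g n = begin
  conv f (Δ g) n  ≡⟨ conv-comm f (Δ g) n ⟩
  conv (Δ g) f n  ≡⟨ conv-Δˡ g f n ⟩
  Δ (conv g f) n  ≡⟨ Δ-cong (conv-comm g f) n ⟩
  Δ (conv f g) n  ≡⟨ sym (conv-Δˡ f g n) ⟩
  conv (Δ f) g n  ∎

-- The coefficients of (1 - z)^a.
sbin : ℕ → ℕ → ℤ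
sbin zero    = δ
sbin (suc a) = Δ (sbin a)

sbin-zero : ∀ a → sbin a 0 ≡ + 1
sbin-zero zero    = refl
sbin-zero (suc a) = sbin-zero a

sbin-vanish : ∀ a i → a < i → sbin a i ≡ + 0
sbin-vanish zero    (suc i) p       = refl
sbin-vanish (suc a) (suc i) (s≤s p) =
  cong₂ ℤ._-_ (sbin-vanish a (suc i) (m≤n⇒m≤1+n p)) (sbin-vanish a i p)

sbin-Vandermonde : ∀ a b n → conv (sbin a) (sbin b) n ≡ sbin (a + b) n
sbin-Vandermonde zero    b n = conv-δˡ (sbin b) n
sbin-Vandermonde (suc a) b n =
  trans (conv-Δˡ (sbin a) (sbin b) n) (Δ-cong (sbin-Vandermonde a b) n)

-- Binomial coefficients by Pascal's rule and by falling factorials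

choose : ℕ → ℕ → ℕ
choose a       zero    = 1
choose zero    (suc i) = 0
choose (suc a) (suc i) = choose a i + choose a (suc i)

choose-vanish : ∀ a i → a < i → choose a i ≡ 0
choose-vanish zero    (suc i) p       = refl
choose-vanish (suc a) (suc i) (s≤s p) =
  cong₂ _+_ (choose-vanish a i p) (choose-vanish a (suc i) (m≤n⇒m≤1+n p))

-- This is (i+1) C(a,i+1) = (a-i) C(a,i) with the subtracted term moved across, so that it holds in
-- ℕ without comparing `a` and `i`. It matches the recursion of the falling factorial.
choose-absorb : ∀ a i → suc i * choose a (suc i) + i * choose a i ≡ a * choose a i
choose-absorb zero    zero    = refl
choose-absorb zero    (suc i) = cong₂ _+_ (*-zeroʳ (suc (suc i))) (*-zeroʳ (suc i))
choose-absorb (suc a) zero    = trans (lem (choose a 1)) (cong suc (choose-absorb a 0))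
  where
  lem : ∀ x → 1 * (1 + x) + 0 ≡ suc (1 * x + 0)
  lem = ℕ-Ring.solve-∀
choose-absorb (suc a) (suc i) = begin
  suc (suc i) * (y + z) + suc i * (x + y)
    ≡⟨ lem₁ i x y z ⟩
  (suc (suc i) * z + suc i * y) + (suc i * y + i * x) + (x + y)
    ≡⟨ cong₂ (λ p q → p + q + (x + y)) (choose-absorb a (suc i)) (choose-absorb a i) ⟩
  a * y + a * x + (x + y)
    ≡⟨ lem₂ a x y ⟩
  suc a * (x + y) ∎
  where
  x = choose a i
  y = choose a (suc i)
  z = choose a (suc (suc i))
  lem₁ : ∀ i x y z → suc (suc i) * (y + z) + suc i * (x + y) ≡
    (suc (suc i) * z + suc i * y) + (suc i * y + i * x) + (x + y)
  lem₁ = ℕ-Ring.solve-∀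
  lem₂ : ∀ a x y → a * y + a * x + (x + y) ≡ suc a * (x + y)
  lem₂ = ℕ-Ring.solve-∀

-- Makes the division by `i !` in `binom` exact.
falling-choose : ∀ a i → falling (+ a) i ≡ + (choose a i * i !)
falling-choose a zero    = refl
falling-choose a (suc i) = begin
  falling (+ a) i ℤ.* (+ a ℤ.- + i)   ≡⟨ cong (ℤ._* (+ a ℤ.- + i)) (falling-choose a i) ⟩
  + (x * f) ℤ.* (+ a ℤ.- + i)         ≡⟨ cong (ℤ._* (+ a ℤ.- + i)) (ℤₚ.pos-* x f) ⟩
  (+ x ℤ.* + f) ℤ.* (+ a ℤ.- + i)     ≡⟨ lem₁ (+ x) (+ f) (+ a) (+ i) ⟩
  (+ a ℤ.* + x ℤ.- + i ℤ.* + x) ℤ.* + f ≡⟨ cong (ℤ._* + f) step ⟩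
  + (suc i * y) ℤ.* + f               ≡⟨ sym (ℤₚ.pos-* (suc i * y) f) ⟩
  + (suc i * y * f)                   ≡⟨ cong +_ (lem₂ i y f) ⟩
  + (y * (suc i) !) ∎
  where
  x = choose a i
  y = choose a (suc i)
  f = i !
  lem₁ : ∀ x f a i → (x ℤ.* f) ℤ.* (a ℤ.- i) ≡ (a ℤ.* x ℤ.- i ℤ.* x) ℤ.* f
  lem₁ = ℤ-Ring.solve-∀
  lem₂ : ∀ i y f → suc i * y * f ≡ y * (suc i * f)
  lem₂ = ℕ-Ring.solve-∀
  lem₃ : ∀ u v → (u ℤ.+ v) ℤ.- v ≡ u
  lem₃ = ℤ-Ring.solve-∀
  step : + a ℤ.* + x ℤ.- + i ℤ.* + x ≡ + (suc i * y)
  step = begin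
    + a ℤ.* + x ℤ.- + i ℤ.* + x          ≡⟨ cong₂ ℤ._-_ (sym (ℤₚ.pos-* a x)) (sym (ℤₚ.pos-* i x)) ⟩
    + (a * x) ℤ.- + (i * x)              ≡⟨ cong (λ w → + w ℤ.- + (i * x)) (sym (choose-absorb a i)) ⟩
    + (suc i * y + i * x) ℤ.- + (i * x)  ≡⟨ cong (ℤ._- + (i * x)) (ℤₚ.pos-+ (suc i * y) (i * x)) ⟩
    (+ (suc i * y) ℤ.+ + (i * x)) ℤ.- + (i * x) ≡⟨ lem₃ (+ (suc i * y)) (+ (i * x)) ⟩
    + (suc i * y) ∎

binom-choose : ∀ a i → binom (+ a) i ≡ + choose a i
binom-choose a i rewrite falling-choose a i = cong +_ (m*n/n≡m (choose a i) (i !) {{i !≢0}})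

sgn-choose : ∀ a i → sgn i ℤ.* + choose a i ≡ sbin a i
sgn-choose zero    zero    = refl
sgn-choose zero    (suc i) = ℤₚ.*-zeroʳ (sgn (suc i))
sgn-choose (suc a) zero    = trans (sgn-choose a zero) refl
sgn-choose (suc a) (suc i) = begin
  ℤ.- sgn i ℤ.* + (choose a i + choose a (suc i))
    ≡⟨ cong (ℤ.- sgn i ℤ.*_) (ℤₚ.pos-+ (choose a i) _) ⟩
  ℤ.- sgn i ℤ.* (+ choose a i ℤ.+ + choose a (suc i))
    ≡⟨ lem (sgn i) _ _ ⟩
  ℤ.- sgn i ℤ.* + choose a (suc i) ℤ.- sgn i ℤ.* + choose a i
    ≡⟨ cong₂ ℤ._-_ (sgn-choose a (suc i)) (sgn-choose a i) ⟩
  sbin a (suc i) ℤ.- sbin a i ∎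
  where
  lem : ∀ s x y → ℤ.- s ℤ.* (x ℤ.+ y) ≡ ℤ.- s ℤ.* y ℤ.- s ℤ.* x
  lem = ℤ-Ring.solve-∀

sgn-binom : ∀ a i → sgn i ℤ.* binom (+ a) i ≡ sbin a i
sgn-binom a i = trans (cong (sgn i ℤ.*_) (binom-choose a i)) (sgn-choose a i)

-- The coefficients of (1 - z)^(-a).
multichoose : ℕ → ℕ → ℤ
multichoose zero    = δ
multichoose (suc a) = λ s → + choose (a + s) s

binom-multichoose : ∀ a s → binom ((+ a ℤ.+ + s) ℤ.- + 1) s ≡ multichoose a s
binom-multichoose zero    zero    = refl
binom-multichoose zero    (suc s) = trans (binom-choose s (suc s)) (cong +_ (choose-vanish s (suc s) ≤-refl))
binom-multichoose (suc a) s       = binom-choose (a + s) s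

-- Pascal's rule, read as (1 - z)(1 - z)^(-a-1) = (1 - z)^(-a).
Δ-multichoose : ∀ a i → Δ (multichoose (suc a)) i ≡ multichoose a i
Δ-multichoose zero    zero    = refl
Δ-multichoose (suc a) zero    = refl
Δ-multichoose a       (suc i) = begin
  + choose (a + suc i) (suc i) ℤ.- + choose (a + i) i
    ≡⟨ cong (λ w → + choose w (suc i) ℤ.- + choose (a + i) i) (+-suc a i) ⟩
  + (choose (a + i) i + choose (a + i) (suc i)) ℤ.- + choose (a + i) i
    ≡⟨ cong (ℤ._- + choose (a + i) i) (ℤₚ.pos-+ (choose (a + i) i) _) ⟩
  (+ choose (a + i) i ℤ.+ + choose (a + i) (suc i)) ℤ.- + choose (a + i) i
    ≡⟨ lem (+ choose (a + i) i) _ ⟩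
  + choose (a + i) (suc i)
    ≡⟨ last a ⟩
  multichoose a (suc i) ∎
  where
  lem : ∀ x y → (x ℤ.+ y) ℤ.- x ≡ y
  lem = ℤ-Ring.solve-∀
  last : ∀ a → + choose (a + i) (suc i) ≡ multichoose a (suc i)
  last zero    = cong +_ (choose-vanish i (suc i) ≤-refl)
  last (suc a) = cong (λ w → + choose w (suc i)) (sym (+-suc a i))

-- One factor 1 - z at a time passes from the second series to the first, where it raises the
-- negative exponent by 1.
multichoose-sbin : ∀ a j n → conv (multichoose a) (sbin (a + j)) n ≡ sbin j n
multichoose-sbin zero    j n = conv-δˡ (sbin j) n
multichoose-sbin (suc a) j n = begin
  conv (multichoose (suc a)) (Δ (sbin (a + j))) n ≡⟨ conv-Δ-shift (multichoose (suc a)) (sbin (a + j)) n ⟩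
  conv (Δ (multichoose (suc a))) (sbin (a + j)) n ≡⟨ conv-cong (Δ-multichoose a) (λ i → refl {x = sbin (a + j) i}) n ⟩
  conv (multichoose a) (sbin (a + j)) n           ≡⟨ multichoose-sbin a j n ⟩
  sbin j n ∎

-- The ring of formal power series

slice : ∀ {n} → Ser (suc n) → ℕ → Ser n
slice p a v = p (a Vec.∷ v)

-- Separating the first exponent turns the product into a Cauchy product in one variable over the
-- series in the others, so that the ring laws follow by induction on the number of variables.
*S-∷ : ∀ {n} (p q : Ser (suc n)) x v →
  (p *S q) (x Vec.∷ v) ≡ Σ≤ x (λ a → (slice p a *S slice q (x ∸ a)) v)
*S-∷ p q x v = begin
  sumℤ (map F (concatMap (λ a → map (a Vec.∷_) (below v)) (upTo (suc x))))
    ≡⟨ sumℤ-concatMap F (λ a → map (a Vec.∷_) (below v)) (upTo (suc x)) ⟩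
  sumℤ (map (λ a → sumℤ (map F (map (a Vec.∷_) (below v)))) (upTo (suc x)))
    ≡⟨ sumℤ-upTo x (λ a → sumℤ (map F (map (a Vec.∷_) (below v)))) ⟩
  Σ≤ x (λ a → sumℤ (map F (map (a Vec.∷_) (below v))))
    ≡⟨ Σ≤-cong x (λ a _ → cong sumℤ (sym (map-∘ {g = F} {f = a Vec.∷_} (below v)))) ⟩
  Σ≤ x (λ a → (slice p a *S slice q (x ∸ a)) v) ∎
  where
  F : Vec ℕ _ → ℤ
  F = λ a → p a ℤ.* q (zipWith _∸_ (x Vec.∷ v) a)

*S-cong : ∀ {n} {p p′ q q′ : Ser n} → p ≈S p′ → q ≈S q′ → (p *S q) ≈S (p′ *S q′)
*S-cong h h′ e = cong sumℤ (map-cong (λ a → cong₂ ℤ._*_ (h a) (h′ (zipWith _∸_ e a))) (below e))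

*S-comm : ∀ {n} (p q : Ser n) → (p *S q) ≈S (q *S p)
*S-comm p q Vec.[]        = cong (ℤ._+ + 0) (ℤₚ.*-comm (p Vec.[]) (q Vec.[]))
*S-comm p q (x Vec.∷ v) = begin
  (p *S q) (x Vec.∷ v)                                   ≡⟨ *S-∷ p q x v ⟩
  Σ≤ x (λ a → (slice p a *S slice q (x ∸ a)) v)           ≡⟨ Σ≤-reverse x _ ⟩
  Σ≤ x (λ a → (slice p (x ∸ a) *S slice q (x ∸ (x ∸ a))) v)
    ≡⟨ Σ≤-cong x (λ a a≤x → trans
         (cong (λ b → (slice p (x ∸ a) *S slice q b) v) (m∸[m∸n]≡n a≤x))
         (*S-comm (slice p (x ∸ a)) (slice q a) v)) ⟩
  Σ≤ x (λ a → (slice q a *S slice p (x ∸ a)) v)           ≡⟨ sym (*S-∷ q p x v) ⟩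
  (q *S p) (x Vec.∷ v)                                   ∎

*S-sumʳ : ∀ {n} {A : Set} (p : Ser n) (F : A → Ser n) xs →
  (p *S (λ w → sumℤ (map (λ x → F x w) xs))) ≈S (λ w → sumℤ (map (λ x → (p *S F x) w) xs))
*S-sumʳ p F xs e = trans
  (cong sumℤ (map-cong (λ a → sumℤ-*ˡ (p a) (λ x → F x (zipWith _∸_ e a)) xs) (below e)))
  (sumℤ-swap (λ a x → p a ℤ.* F x (zipWith _∸_ e a)) (below e) xs)

*S-Σ≤ʳ : ∀ {n} m (p : Ser n) (F : ℕ → Ser n) →
  (p *S (λ w → Σ≤ m (λ i → F i w))) ≈S (λ w → Σ≤ m (λ i → (p *S F i) w))
*S-Σ≤ʳ m p F e = begin
  (p *S (λ w → Σ≤ m (λ i → F i w))) e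
    ≡⟨ *S-cong {p = p} (λ _ → refl) (λ w → sym (sumℤ-upTo m (λ i → F i w))) e ⟩
  (p *S (λ w → sumℤ (map (λ i → F i w) (upTo (suc m))))) e
    ≡⟨ *S-sumʳ p F (upTo (suc m)) e ⟩
  sumℤ (map (λ i → (p *S F i) e) (upTo (suc m)))
    ≡⟨ sumℤ-upTo m (λ i → (p *S F i) e) ⟩
  Σ≤ m (λ i → (p *S F i) e) ∎

*S-Σ≤ˡ : ∀ {n} m (F : ℕ → Ser n) (p : Ser n) →
  ((λ w → Σ≤ m (λ i → F i w)) *S p) ≈S (λ w → Σ≤ m (λ i → (F i *S p) w))
*S-Σ≤ˡ m F p e = begin
  ((λ w → Σ≤ m (λ i → F i w)) *S p) e ≡⟨ *S-comm (λ w → Σ≤ m (λ i → F i w)) p e ⟩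
  (p *S (λ w → Σ≤ m (λ i → F i w))) e ≡⟨ *S-Σ≤ʳ m p F e ⟩
  Σ≤ m (λ i → (p *S F i) e)           ≡⟨ Σ≤-cong m (λ i _ → *S-comm p (F i) e) ⟩
  Σ≤ m (λ i → (F i *S p) e)           ∎

*S-scaleʳ : ∀ {n} (p : Ser n) c (q : Ser n) e → (p *S (λ w → c ℤ.* q w)) e ≡ c ℤ.* (p *S q) e
*S-scaleʳ p c q e = begin
  sumℤ (map (λ a → p a ℤ.* (c ℤ.* q (zipWith _∸_ e a))) (below e))
    ≡⟨ cong sumℤ (map-cong (λ a → lem (p a) c (q (zipWith _∸_ e a))) (below e)) ⟩
  sumℤ (map (λ a → c ℤ.* (p a ℤ.* q (zipWith _∸_ e a))) (below e))
    ≡⟨ sym (sumℤ-*ˡ c (λ a → p a ℤ.* q (zipWith _∸_ e a)) (below e)) ⟩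
  c ℤ.* (p *S q) e ∎
  where
  lem : ∀ x y z → x ℤ.* (y ℤ.* z) ≡ y ℤ.* (x ℤ.* z)
  lem = ℤ-Ring.solve-∀

*S-assoc : ∀ {n} (p q r : Ser n) → ((p *S q) *S r) ≈S (p *S (q *S r))
*S-assoc p q r Vec.[] = lem (p Vec.[]) (q Vec.[]) (r Vec.[])
  where
  lem : ∀ x y z → (x ℤ.* y ℤ.+ + 0) ℤ.* z ℤ.+ + 0 ≡ x ℤ.* (y ℤ.* z ℤ.+ + 0) ℤ.+ + 0
  lem = ℤ-Ring.solve-∀
*S-assoc p q r (x Vec.∷ v) = begin
  ((p *S q) *S r) (x Vec.∷ v)
    ≡⟨ *S-∷ (p *S q) r x v ⟩
  Σ≤ x (λ a → (slice (p *S q) a *S slice r (x ∸ a)) v)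
    ≡⟨ Σ≤-cong x (λ a _ → trans
         (*S-cong {q = slice r (x ∸ a)} (*S-∷ p q a) (λ _ → refl) v)
         (trans (*S-Σ≤ˡ a (λ b → slice p b *S slice q (a ∸ b)) (slice r (x ∸ a)) v)
                (Σ≤-cong a λ b _ → *S-assoc (slice p b) (slice q (a ∸ b)) (slice r (x ∸ a)) v))) ⟩
  Σ≤ x (λ a → Σ≤ a (λ b → (slice p b *S (slice q (a ∸ b) *S slice r (x ∸ a))) v))
    ≡⟨ Σ≤-triangle x (λ b c d → (slice p b *S (slice q c *S slice r d)) v) ⟩
  Σ≤ x (λ b → Σ≤ (x ∸ b) (λ c → (slice p b *S (slice q c *S slice r (x ∸ b ∸ c))) v))
    ≡⟨ Σ≤-cong x (λ b _ → sym (trans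
         (*S-cong {p = slice p b} (λ _ → refl) (*S-∷ q r (x ∸ b)) v)
         (*S-Σ≤ʳ (x ∸ b) (slice p b) (λ c → slice q c *S slice r (x ∸ b ∸ c)) v))) ⟩
  Σ≤ x (λ b → (slice p b *S slice (q *S r) (x ∸ b)) v)
    ≡⟨ sym (*S-∷ p (q *S r) x v) ⟩
  (p *S (q *S r)) (x Vec.∷ v) ∎

*S-zeroˡ : ∀ {n} (p : Ser n) e → (zeroS *S p) e ≡ + 0
*S-zeroˡ p e = trans (*S-comm zeroS p e)
  (trans (*S-scaleʳ p (+ 0) zeroS e) (ℤₚ.*-zeroˡ ((p *S zeroS) e)))

*S-identityˡ : ∀ {n} (p : Ser n) → (oneS n *S p) ≈S p
*S-identityˡ p Vec.[] = trans (ℤₚ.+-identityʳ _) (ℤₚ.*-identityˡ (p Vec.[]))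
-- By computation, the slices of 1 at positive exponents vanish and its slice at 0 is the 1 of the
-- remaining variables.
*S-identityˡ {suc n} p (x Vec.∷ v) = begin
  (oneS (suc n) *S p) (x Vec.∷ v)                           ≡⟨ *S-∷ (oneS (suc n)) p x v ⟩
  Σ≤ x (λ a → (slice (oneS (suc n)) a *S slice p (x ∸ a)) v) ≡⟨ Σ≤-first x (λ i _ → *S-zeroˡ (slice p (x ∸ suc i)) v) ⟩
  (oneS n *S slice p x) v                                   ≡⟨ *S-identityˡ (slice p x) v ⟩
  p (x Vec.∷ v)                                             ∎

*S-identityʳ : ∀ {n} (p : Ser n) → (p *S oneS n) ≈S p
*S-identityʳ {n} p e = trans (*S-comm p (oneS n) e) (*S-identityˡ p e)

*S-leftComm : ∀ {n} (p q r : Ser n) → (p *S (q *S r)) ≈S (q *S (p *S r))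
*S-leftComm p q r e = begin
  (p *S (q *S r)) e ≡⟨ sym (*S-assoc p q r e) ⟩
  ((p *S q) *S r) e ≡⟨ *S-cong {q = r} (*S-comm p q) (λ _ → refl) e ⟩
  ((q *S p) *S r) e ≡⟨ *S-assoc q p r e ⟩
  (q *S (p *S r)) e ∎

-- Lists without repetition

unique-⊆-length : ∀ {A : Set} {xs ys : List A} → Unique xs → (∀ {z} → z ∈ xs → z ∈ ys) → length xs ≤ length ys
unique-⊆-length {xs = []}     _        _   = z≤n
unique-⊆-length {xs = x ∷ xs} (x∉ ∷ u) sub with ∈-∃++ (sub (here refl))
... | as , bs , refl = subst (suc (length xs) ≤_) (sym len) (s≤s (unique-⊆-length u sub′))
  where
  len : length (as ++ x ∷ bs) ≡ suc (length (as ++ bs))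
  len = trans (length-++ as) (trans (+-suc _ _) (cong suc (sym (length-++ as))))
  sub′ : ∀ {z} → z ∈ xs → z ∈ as ++ bs
  sub′ z∈ with ∈-++⁻ as (sub (there z∈))
  ... | inj₁ p           = ∈-++⁺ˡ p
  ... | inj₂ (here refl) = contradiction refl (All.lookup x∉ z∈)
  ... | inj₂ (there p)   = ∈-++⁺ʳ as p

distinctCount-≤ : ∀ xs {ys} → (∀ {z} → z ∈ xs → z ∈ ys) → distinctCount xs ≤ length ys
distinctCount-≤ xs sub =
  unique-⊆-length (deduplicate-! ℕ._≟_ xs) (sub ∘ ∈-deduplicate⁻ ℕ._≟_ xs)

≤-distinctCount : ∀ {xs ys} → Unique ys → (∀ {z} → z ∈ ys → z ∈ xs) → length ys ≤ distinctCount xs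
≤-distinctCount u sub = unique-⊆-length u (∈-deduplicate⁺ ℕ._≟_ ∘ sub)

sumℤ-↭ : ∀ {A : Set} (f : A → ℤ) {xs ys} → xs ↭ ys → sumℤ (map f xs) ≡ sumℤ (map f ys)
sumℤ-↭ f ↭.refl                          = refl
sumℤ-↭ f (↭.prep x p)                    = cong (ℤ._+_ (f x)) (sumℤ-↭ f p)
sumℤ-↭ f (↭.swap {xs = xs} {ys} x y p)   = begin
  f x ℤ.+ (f y ℤ.+ sumℤ (map f xs)) ≡⟨ sym (ℤₚ.+-assoc (f x) _ _) ⟩
  f x ℤ.+ f y ℤ.+ sumℤ (map f xs)   ≡⟨ cong₂ ℤ._+_ (ℤₚ.+-comm (f x) (f y)) (sumℤ-↭ f p) ⟩
  f y ℤ.+ f x ℤ.+ sumℤ (map f ys)   ≡⟨ ℤₚ.+-assoc (f y) _ _ ⟩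
  f y ℤ.+ (f x ℤ.+ sumℤ (map f ys)) ∎
sumℤ-↭ f (↭.trans p q)                   = trans (sumℤ-↭ f p) (sumℤ-↭ f q)

sumℤ-unique : ∀ {A : Set} (f : A → ℤ) {xs ys} → Unique xs → Unique ys →
  (∀ {z} → z ∈ xs → z ∈ ys) → (∀ {z} → z ∈ ys → z ∈ xs) → sumℤ (map f xs) ≡ sumℤ (map f ys)
sumℤ-unique f u v p q = sumℤ-↭ f (∼bag⇒↭ (unique∧set⇒bag u v (mk⇔ p q)))

sumℤ-cong : ∀ {A : Set} {f g : A → ℤ} xs → (∀ {z} → z ∈ xs → f z ≡ g z) → sumℤ (map f xs) ≡ sumℤ (map g xs)
sumℤ-cong []       h = refl
sumℤ-cong (x ∷ xs) h = cong₂ ℤ._+_ (h (here refl)) (sumℤ-cong xs (h ∘ there))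

-- Solves an equation between two Pieri expansions for its one unknown term: as `y` occurs only
-- once, everything else cancels.
sumℤ-isolate : ∀ {A : Set} {f g : A → ℤ} {xs y} → Unique xs → y ∈ xs →
  (∀ {z} → z ∈ xs → z ≢ y → f z ≡ g z) → sumℤ (map f xs) ≡ sumℤ (map g xs) → f y ≡ g y
sumℤ-isolate {f = f} {g} {x ∷ xs} (x∉ ∷ u) (here refl) h eq =
  ∙-cancelʳ (sumℤ (map g xs)) _ _ (trans
    (cong (ℤ._+_ (f x)) (sym (sumℤ-cong xs λ z∈ → h (there z∈) λ { refl → All.lookup x∉ z∈ refl }))) eq)
sumℤ-isolate {f = f} {g} {x ∷ xs} (x∉ ∷ u) (there y∈) h eq =
  sumℤ-isolate u y∈ (h ∘ there) (∙-cancelˡ (f x) _ _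
    (trans eq (cong (ℤ._+ sumℤ (map g xs)) (sym (h (here refl) λ { refl → All.lookup x∉ y∈ refl })))))

sumℤ-filter : ∀ {A : Set} {P : Pred A 0ℓ} (P? : Decidable P) (f : A → ℤ) xs →
  sumℤ (map f (filter P? xs)) ≡ sumℤ (map (λ x → if does (P? x) then f x else + 0) xs)
sumℤ-filter P? f [] = refl
sumℤ-filter P? f (x ∷ xs) with does (P? x)
... | true  = cong (ℤ._+_ (f x)) (sumℤ-filter P? f xs)
... | false = trans (sumℤ-filter P? f xs) (sym (ℤₚ.+-identityˡ _))

-- Passes from the size `s` of a strip to the new part `x = s - d`, once `d` cells are spent on the
-- rows of λ̄.
Σ≤-from : ∀ d r (f : ℕ → ℤ) →
  Σ≤ r (λ s → if does (d ℕ.≤? s) then f s else + 0) ≡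
  (if does (d ℕ.≤? r) then Σ≤ (r ∸ d) (λ x → f (d + x)) else + 0)
Σ≤-from zero    r       f = refl
Σ≤-from (suc d) zero    f = refl
Σ≤-from (suc d) (suc r) f = trans (ℤₚ.+-identityˡ _) (trans (Σ≤-cong r (λ s _ → cong (if_then f (suc s) else + 0) (does-suc d s)))
  (trans (Σ≤-from d r (f ∘ suc)) (cong (if_then Σ≤ (r ∸ d) (λ x → f (suc d + x)) else + 0) (sym (does-suc d r)))))
  where
  does-suc : ∀ d s → does (suc d ℕ.≤? suc s) ≡ does (d ℕ.≤? s)
  does-suc zero    s = refl
  does-suc (suc d) s = refl

-- Weakly decreasing lists

Decr-∷ : ∀ {x} xs → part xs 1 ≤ x → Decr xs → Decr (x ∷ xs)
Decr-∷ []       _ _ = tt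
Decr-∷ (y ∷ ys) p d = p , d

Decr-tail : ∀ {x} xs → Decr (x ∷ xs) → Decr xs
Decr-tail []       _ = tt
Decr-tail (y ∷ ys) d = proj₂ d

Decr-head : ∀ {x} xs → Decr (x ∷ xs) → part xs 1 ≤ x
Decr-head []       _ = z≤n
Decr-head (y ∷ ys) d = proj₁ d

Decr-All : ∀ {x} xs → Decr (x ∷ xs) → All (_≤ x) xs
Decr-All []       _ = []
Decr-All (y ∷ ys) d = proj₁ d ∷ All.map (λ p → ≤-trans p (proj₁ d)) (Decr-All ys (proj₂ d))

-- Both heads are the maximum of the common multiset. Unions of partitions can thus be computed up
-- to permutation.
Decr-↭ : ∀ {xs ys} → Decr xs → Decr ys → xs ↭ ys → xs ≡ ys
Decr-↭ {[]} {ys}         d e p = sym (↭-empty-inv (↭-sym p))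
Decr-↭ {x ∷ xs} {[]}     d e p = ↭-empty-inv p
Decr-↭ {x ∷ xs} {y ∷ ys} d e p
  with ≤-antisym (All.lookup (≤-refl ∷ Decr-All ys e) (∈-resp-↭ p (here refl)))
                 (All.lookup (≤-refl ∷ Decr-All xs d) (∈-resp-↭ (↭-sym p) (here refl)))
... | refl = cong (x ∷_) (Decr-↭ (Decr-tail xs d) (Decr-tail ys e) (drop-∷ p))

≤ᵇ-false : ∀ {m n} → (m ≤ᵇ n) ≡ false → n < m
≤ᵇ-false {m} {n} eq = ≰⇒> λ p → subst T eq (≤⇒≤ᵇ p)

≤ᵇ-true : ∀ {m n} → (m ≤ᵇ n) ≡ true → m ≤ n
≤ᵇ-true {m} {n} eq = ≤ᵇ⇒≤ m n (subst T (sym eq) tt)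

insertD-head : ∀ x ys {b} → x ≤ b → part ys 1 ≤ b → part (insertD x ys) 1 ≤ b
insertD-head zero    ys       p q = q
insertD-head (suc x) []       p q = p
insertD-head (suc x) (y ∷ ys) p q with y ≤ᵇ suc x
... | true  = p
... | false = q

insertD-Decr : ∀ x ys → Decr ys → Decr (insertD x ys)
insertD-Decr zero    ys       d = d
insertD-Decr (suc x) []       d = tt
insertD-Decr (suc x) (y ∷ ys) d with y ≤ᵇ suc x in eq
... | true  = ≤ᵇ-true eq , d
... | false = Decr-∷ _ (insertD-head (suc x) ys (<⇒≤ (≤ᵇ-false {y} eq)) (Decr-head ys d)) (insertD-Decr (suc x) ys (Decr-tail ys d))

insertD-↭ : ∀ x ys → 1 ≤ x → insertD x ys ↭ x ∷ ys
insertD-↭ (suc x) []       p = ↭.refl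
insertD-↭ (suc x) (y ∷ ys) p with y ≤ᵇ suc x
... | true  = ↭.refl
... | false = ↭.trans (↭.prep y (insertD-↭ (suc x) ys p)) (↭.swap y (suc x) ↭.refl)

sortD-Decr : ∀ xs → Decr (sortD xs)
sortD-Decr []       = tt
sortD-Decr (x ∷ xs) = insertD-Decr x (sortD xs) (sortD-Decr xs)

sortD-↭ : ∀ {xs} → All (1 ≤_) xs → sortD xs ↭ xs
sortD-↭ []                 = ↭.refl
sortD-↭ {x ∷ xs} (p ∷ ps) = ↭.trans (insertD-↭ x (sortD xs) p) (↭.prep x (sortD-↭ ps))

sortD-unique : ∀ {xs ys} → All (1 ≤_) xs → xs ↭ ys → Decr ys → sortD xs ≡ ys
sortD-unique {xs} pos p d = Decr-↭ (sortD-Decr xs) d (↭.trans (sortD-↭ pos) p)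

-- Cells and hooks

part-All : ∀ {x xs} → All (_≤ x) xs → ∀ i → part xs i ≤ x
part-All []       zero          = z≤n
part-All []       (suc i)       = z≤n
part-All (p ∷ ps) zero          = z≤n
part-All (p ∷ ps) (suc zero)    = p
part-All (p ∷ ps) (suc (suc i)) = part-All ps (suc i)

part-∷-≤ : ∀ {x} xs → Decr (x ∷ xs) → ∀ i → part xs i ≤ x
part-∷-≤ xs d i = part-All (Decr-All xs d) i

part-antitone : ∀ {xs} → Decr xs → ∀ {i j} → i ≤ j → part xs (suc j) ≤ part xs (suc i)
part-antitone {[]}     d {i}     {j}     p       = z≤n
part-antitone {x ∷ xs} d {zero}  {zero}  p       = ≤-refl
part-antitone {x ∷ xs} d {zero}  {suc j} p       = part-∷-≤ xs d (suc j)
part-antitone {x ∷ xs} d {suc i} {suc j} (s≤s p) = part-antitone (Decr-tail xs d) p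

conjPart-accept : ∀ {x j} xs → j ≤ x → conjPart (x ∷ xs) j ≡ suc (conjPart xs j)
conjPart-accept {x} {j} xs p = cong length (filter-accept (j ℕ.≤?_) p)

conjPart-reject : ∀ {x j} xs → ¬ (j ≤ x) → conjPart (x ∷ xs) j ≡ conjPart xs j
conjPart-reject {x} {j} xs p = cong length (filter-reject (j ℕ.≤?_) p)

part⇒conjPart : ∀ {xs} → Decr xs → ∀ i j → suc j ≤ part xs (suc i) → suc i ≤ conjPart xs (suc j)
part⇒conjPart {x ∷ xs} d zero    j p = subst (1 ≤_) (sym (conjPart-accept xs p)) (s≤s z≤n)
part⇒conjPart {x ∷ xs} d (suc i) j p =
  subst (suc (suc i) ≤_) (sym (conjPart-accept xs (≤-trans p (part-∷-≤ xs d (suc i)))))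
    (s≤s (part⇒conjPart (Decr-tail xs d) i j p))

conjPart⇒part : ∀ {xs} → Decr xs → ∀ i j → suc i ≤ conjPart xs (suc j) → suc j ≤ part xs (suc i)
conjPart⇒part {x ∷ xs} d i j p with suc j ℕ.≤? x
conjPart⇒part {x ∷ xs} d zero    j p | yes q = q
conjPart⇒part {x ∷ xs} d (suc i) j p | yes q =
  conjPart⇒part (Decr-tail xs d) i j (≤-pred (subst (suc (suc i) ≤_) (conjPart-accept xs q) p))
conjPart⇒part {x ∷ xs} d i       j p | no ¬q = contradiction
  (≤-trans (conjPart⇒part (Decr-tail xs d) i j (subst (suc i ≤_) (conjPart-reject xs ¬q) p)) (part-∷-≤ xs d (suc i))) ¬q

hook-row₁ : ∀ {x j} xs → suc j ≤ x → hook (x ∷ xs) 1 (suc j) ≡ (x ∸ suc j) + conjPart xs (suc j) + 1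
hook-row₁ {x} {j} xs p rewrite conjPart-accept xs p = refl

hook-tail : ∀ {x j} xs i → suc j ≤ x → hook (x ∷ xs) (suc (suc i)) (suc j) ≡ hook xs (suc i) (suc j)
hook-tail {x} {j} xs i p rewrite conjPart-accept xs p = refl

up : ℕ × ℕ → ℕ × ℕ
up (i , j) = suc i , j

applyUpTo-cong : ∀ {A : Set} {f g : ℕ → A} n → (∀ i → f i ≡ g i) → applyUpTo f n ≡ applyUpTo g n
applyUpTo-cong zero    h = refl
applyUpTo-cong (suc n) h = cong₂ _∷_ (h 0) (applyUpTo-cong n (h ∘ suc))

concat-applyUpTo-map : ∀ {A B : Set} (h : A → B) (G : ℕ → List A) n →
  concat (applyUpTo (λ i → map h (G i)) n) ≡ map h (concat (applyUpTo G n))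
concat-applyUpTo-map h G zero    = refl
concat-applyUpTo-map h G (suc n) =
  trans (cong (map h (G 0) ++_) (concat-applyUpTo-map h (G ∘ suc) n)) (sym (map-++ h (G 0) _))

row₁ : ℕ → List (ℕ × ℕ)
row₁ x = applyUpTo (λ j → (1 , suc j)) x

cells-∷ : ∀ x xs → cells (x ∷ xs) ≡ row₁ x ++ map up (cells xs)
cells-∷ x xs = cong (row₁ x ++_) (trans
  (cong concat (applyUpTo-cong (length xs) λ i → sym (map-applyUpTo (λ j → (suc i , suc j)) up (part xs (suc i)))))
  (concat-applyUpTo-map up (λ i → applyUpTo (λ j → (suc i , suc j)) (part xs (suc i))) (length xs)))

∈-cells⁻ : ∀ κ {c} → c ∈ cells κ → ∃₂ λ i j → c ≡ (suc i , suc j) × j < part κ (suc i)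
∈-cells⁻ (x ∷ κ) c∈ with ∈-++⁻ (row₁ x) (subst (_ ∈_) (cells-∷ x κ) c∈)
... | inj₁ p with ∈-applyUpTo⁻ (λ j → (1 , suc j)) p
...   | j , j<x , eq = 0 , j , eq , j<x
∈-cells⁻ (x ∷ κ) c∈ | inj₂ p with ∈-map⁻ up p
... | c′ , c′∈ , refl with ∈-cells⁻ κ c′∈
...   | i , j , refl , q = suc i , j , refl , q

∈-cells⁺ : ∀ κ {i j} → j < part κ (suc i) → (suc i , suc j) ∈ cells κ
∈-cells⁺ (x ∷ κ) {zero}  {j} p = ∈-++⁺ˡ (∈-applyUpTo⁺ (λ j → (1 , suc j)) p)
∈-cells⁺ (x ∷ κ) {suc i} {j} p =
  subst (_ ∈_) (sym (cells-∷ x κ)) (∈-++⁺ʳ (row₁ x) (∈-map⁺ up (∈-cells⁺ κ p)))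

count-map : ∀ {A B : Set} {P : Pred A 0ℓ} {Q : Pred B 0ℓ} (P? : Decidable P) (Q? : Decidable Q) (f : A → B) xs →
  (∀ {x} → x ∈ xs → P x → Q (f x)) → (∀ {x} → x ∈ xs → Q (f x) → P x) →
  length (filter Q? (map f xs)) ≡ length (filter P? xs)
count-map P? Q? f []       to from = refl
count-map {P = P} {Q} P? Q? f (x ∷ xs) to from with P? x
... | yes p = trans (cong length (filter-accept Q? (to (here refl) p)))
                (cong suc (count-map P? Q? f xs (to ∘ there) (from ∘ there)))
... | no ¬p = trans (cong length (filter-reject Q? (¬p ∘ from (here refl))))
                (count-map P? Q? f xs (to ∘ there) (from ∘ there))

-- Meant for a row of a core: its first `c` columns have hooks longer than k + 1, and the `v`
-- remaining ones are those counted by 𝔭.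
count-threshold : ∀ {A : Set} {P : Pred A 0ℓ} (P? : Decidable P) (f : ℕ → A) c v →
  (∀ j → j < c → ¬ P (f j)) → (∀ j → c ≤ j → j < v + c → P (f j)) →
  length (filter P? (applyUpTo f (v + c))) ≡ v
count-threshold P? f zero    zero    _ _  = refl
count-threshold P? f zero    (suc v) _ hi = trans
  (cong length (filter-accept P? (hi 0 z≤n (s≤s z≤n))))
  (cong suc (count-threshold P? (f ∘ suc) zero v (λ _ ()) λ j _ p → hi (suc j) z≤n (s≤s p)))
count-threshold {P = P} P? f (suc c) v lo hi =
  subst (λ m → length (filter P? (applyUpTo f m)) ≡ v) (sym (+-suc v c))
    (trans (cong length (filter-reject P? (lo 0 (s≤s z≤n))))
      (count-threshold P? (f ∘ suc) c v (λ j p → lo (suc j) (s≤s p))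
        λ j p q → hi (suc j) (s≤s p) (subst (suc (suc j) ≤_) (sym (+-suc v c)) (s≤s q))))

-- (k+1)-cores

-- The part of 𝔭(κ) for a row of length x above which the core κ sits is the v with x = v + κ_{k+1-v}:
-- the columns of height ≥ k+1-v in κ are exactly those giving hooks > k+1.
data CoreOf (k : ℕ) : List ℕ → List ℕ → Set where
  []  : CoreOf k [] []
  row : ∀ {κ ν x} v → 1 ≤ v → v ≤ k → x ≡ v + part κ (suc (k ∸ v)) → part κ 1 ≤ x →
        CoreOf k κ ν → CoreOf k (x ∷ κ) (v ∷ ν)

CoreOf-Decr : ∀ {k κ ν} → CoreOf k κ ν → Decr κ
CoreOf-Decr []                   = tt
CoreOf-Decr (row v _ _ _ p core) = Decr-∷ _ p (CoreOf-Decr core)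

CoreOf-pos : ∀ {k κ ν} → CoreOf k κ ν → All (1 ≤_) κ
CoreOf-pos []                       = []
CoreOf-pos (row v p _ refl _ core) = ≤-trans p (m≤m+n v _) ∷ CoreOf-pos core

-- In the first κ_{k+1-v} columns the arm is at least v and the leg at least k+1-v, so the hook is
-- at least k+2.
row-long : ∀ {k κ ν v} → v ≤ k → CoreOf k κ ν → ∀ j → j < part κ (suc (k ∸ v)) →
  suc k < hook ((v + part κ (suc (k ∸ v))) ∷ κ) 1 (suc j)
row-long {k} {κ} {ν} {v} v≤k core j j<c = subst (suc k <_) (sym (hook-row₁ κ (≤-trans j<c (m≤n+m c v)))) bound
  where
  c = part κ (suc (k ∸ v))
  bound : suc k < (v + c ∸ suc j) + conjPart κ (suc j) + 1
  bound = ≤-trans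
    (≤-reflexive (trans (cong (λ m → suc (suc m)) (sym (m+[n∸m]≡n v≤k))) (trans (cong suc (sym (+-suc v (k ∸ v)))) (+-comm 1 _))))
    (+-monoˡ-≤ 1 (+-mono-≤ (≤-trans (m≤m+n v (c ∸ suc j)) (≤-reflexive (sym (+-∸-assoc v j<c))))
                           (part⇒conjPart (CoreOf-Decr core) (k ∸ v) j j<c)))

-- From that column on the arm is at most v-1 and the leg at most k-v, so the hook is at most k; the
-- value k+1 is jumped over.
row-short : ∀ {k κ ν v} → v ≤ k → CoreOf k κ ν → ∀ j → part κ (suc (k ∸ v)) ≤ j → j < v + part κ (suc (k ∸ v)) →
  hook ((v + part κ (suc (k ∸ v))) ∷ κ) 1 (suc j) ≤ k
row-short {k} {κ} {ν} {zero}  v≤k core j c≤j j<x = contradiction j<x (≤⇒≯ c≤j)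
row-short {k} {κ} {ν} {suc v} v≤k core j c≤j j<x = subst (_≤ k) (sym (hook-row₁ κ j<x)) (≤-trans (≤-reflexive (+-comm _ 1)) bound)
  where
  c = part κ (suc (k ∸ suc v))
  conj≤ : conjPart κ (suc j) ≤ k ∸ suc v
  conj≤ = ≮⇒≥ λ p → <⇒≱ (conjPart⇒part (CoreOf-Decr core) (k ∸ suc v) j p) c≤j
  arm≤ : v + c ∸ j ≤ v
  arm≤ = ≤-trans (∸-monoʳ-≤ (v + c) c≤j) (≤-reflexive (m+n∸n≡m v c))
  bound : suc ((v + c ∸ j) + conjPart κ (suc j)) ≤ k
  bound = ≤-trans (s≤s (+-mono-≤ arm≤ conj≤)) (≤-reflexive (m+[n∸m]≡n v≤k))

CoreOf-hook : ∀ {k κ ν} → CoreOf k κ ν → ∀ i j → j < part κ (suc i) → hook κ (suc i) (suc j) ≢ suc k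
CoreOf-hook {k} (row {κ} {ν} v _ v≤k refl _ core) zero j p eq with j ℕ.<? part κ (suc (k ∸ v))
... | yes q = <-irrefl (sym eq) (row-long v≤k core j q)
... | no ¬q = <-irrefl eq (s≤s (row-short v≤k core j (≮⇒≥ ¬q) p))
CoreOf-hook full@(row {κ} {ν} v _ v≤k _ _ core) (suc i) j p eq =
  CoreOf-hook core i j p (trans (sym (hook-tail κ i (≤-trans p (part-∷-≤ κ (CoreOf-Decr full) (suc i))))) eq)

CoreOf-sizeK : ∀ {k κ ν} → CoreOf k κ ν → sizeK k κ ≡ sum ν
CoreOf-sizeK [] = refl
CoreOf-sizeK {k} full@(row {κ} {ν} v _ v≤k refl _ core) = begin
  length (filter Q? (cells (x ∷ κ)))                                       ≡⟨ cong (length ∘ filter Q?) (cells-∷ x κ) ⟩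
  length (filter Q? (row₁ x ++ map up (cells κ)))                          ≡⟨ cong length (filter-++ Q? (row₁ x) _) ⟩
  length (filter Q? (row₁ x) ++ filter Q? (map up (cells κ)))              ≡⟨ length-++ (filter Q? (row₁ x)) ⟩
  length (filter Q? (row₁ x)) + length (filter Q? (map up (cells κ)))      ≡⟨ cong₂ _+_ fst snd ⟩
  v + sum ν ∎
  where
  c = part κ (suc (k ∸ v))
  x = v + c
  Q? = λ (c : ℕ × ℕ) → hook (x ∷ κ) (proj₁ c) (proj₂ c) ℕ.<? suc k
  P? = λ (c : ℕ × ℕ) → hook κ (proj₁ c) (proj₂ c) ℕ.<? suc k
  fst : length (filter Q? (row₁ x)) ≡ v
  fst = count-threshold Q? (λ j → (1 , suc j)) c v
    (λ j p → <-asym (row-long v≤k core j p))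
    (λ j p q → s≤s (row-short v≤k core j p q))
  tail-hook : ∀ {c} → c ∈ cells κ → hook (x ∷ κ) (proj₁ (up c)) (proj₂ (up c)) ≡ hook κ (proj₁ c) (proj₂ c)
  tail-hook c∈ with ∈-cells⁻ κ c∈
  ... | i , j , refl , p = hook-tail κ i (≤-trans p (part-∷-≤ κ (CoreOf-Decr full) (suc i)))
  snd : length (filter Q? (map up (cells κ))) ≡ sum ν
  snd = trans (count-map P? Q? up (cells κ) (λ c∈ → subst (_< suc k) (sym (tail-hook c∈))) (λ c∈ → subst (_< suc k) (tail-hook c∈)))
    (CoreOf-sizeK core)

CoreOf-pmap : ∀ {k κ ν} → CoreOf k κ ν → pmap k κ ≡ ν
CoreOf-pmap [] = refl
CoreOf-pmap {k} full@(row {κ} {ν} v _ v≤k refl _ core) = cong₂ _∷_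
  (count-threshold (λ j → hook (x ∷ κ) 1 (suc j) ℕ.≤? k) id c v
    (λ j p q → <-asym (row-long v≤k core j p) (s≤s q)) (λ j → row-short v≤k core j))
  (trans (applyUpTo-cong (length κ) tail) (CoreOf-pmap core))
  where
  c = part κ (suc (k ∸ v))
  x = v + c
  tail : ∀ i → length (filter (λ j → hook (x ∷ κ) (suc (suc i)) (suc j) ℕ.≤? k) (upTo (part κ (suc i)))) ≡
               length (filter (λ j → hook κ (suc i) (suc j) ℕ.≤? k) (upTo (part κ (suc i))))
  tail i = trans (cong (length ∘ filter Q?) (sym (map-id (upTo (part κ (suc i))))))
    (count-map P? Q? id (upTo (part κ (suc i))) (λ j∈ → subst (_≤ k) (sym (eq j∈))) (λ j∈ → subst (_≤ k) (eq j∈)))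
    where
    Q? = λ j → hook (x ∷ κ) (suc (suc i)) (suc j) ℕ.≤? k
    P? = λ j → hook κ (suc i) (suc j) ℕ.≤? k
    eq : ∀ {j} → j ∈ upTo (part κ (suc i)) → hook (x ∷ κ) (suc (suc i)) (suc j) ≡ hook κ (suc i) (suc j)
    eq j∈ = hook-tail κ i (≤-trans (∈-upTo⁻ j∈) (part-∷-≤ κ (CoreOf-Decr full) (suc i)))

-- The value v + κ_{k+1-v} increases with v and starts below x at v = 0. If it jumped over x, or
-- stayed below x up to v = k, some cell of the first row would have arm v and leg k-v, hence hook
-- length k+1.
no-hook⇒CoreOf : ∀ {k κ} → Decr κ → All (1 ≤_) κ →
  (∀ i j → j < part κ (suc i) → hook κ (suc i) (suc j) ≢ suc k) → ∃ (CoreOf k κ)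
no-hook⇒CoreOf {k} {[]}     d pos h = [] , []
no-hook⇒CoreOf {k} {x ∷ xs} d (x≥1 ∷ pos) h
  with no-hook⇒CoreOf (Decr-tail xs d) pos
         (λ i j p eq → h (suc i) j p (trans (hook-tail xs i (≤-trans p (part-∷-≤ xs d (suc i)))) eq))
... | ν , core = finish (search k 0 refl (start core))
  where
  f : ℕ → ℕ
  f v = v + part xs (suc (k ∸ v))

  -- A row of a core exceeds the row `k` places above it, because its own part is at least 1 and its
  -- lookup reaches at most that far.
  start : ∀ {ν} → CoreOf k xs ν → part xs (suc k) < x
  start []                                                = x≥1
  start (row {κ = ys} (suc v) _ (s≤s {n = k′} _) refl _ c) = ≤-trans
    (s≤s (≤-trans (part-antitone (CoreOf-Decr c) (m∸n≤m k′ v)) (m≤n+m _ v)))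
    (Decr-head xs d)

  -- Column x - v, counted from 1, has arm exactly v.
  gap : ∀ v → v < x → v ≤ k → conjPart xs (suc (x ∸ suc v)) ≡ k ∸ v → ⊥
  gap v v<x v≤k eq = h 0 (x ∸ suc v) j<x (begin
    hook (x ∷ xs) 1 (suc (x ∸ suc v))                            ≡⟨ hook-row₁ xs j<x ⟩
    (x ∸ suc (x ∸ suc v)) + conjPart xs (suc (x ∸ suc v)) + 1   ≡⟨ cong₂ (λ a b → a + b + 1) arm eq ⟩
    v + (k ∸ v) + 1                                             ≡⟨ cong (_+ 1) (m+[n∸m]≡n v≤k) ⟩
    k + 1                                                       ≡⟨ +-comm k 1 ⟩
    suc k ∎)
    where
    eq′ : suc (x ∸ suc v) ≡ x ∸ v
    eq′ = sym (+-∸-assoc 1 v<x)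
    j<x : x ∸ suc v < x
    j<x = subst (_≤ x) (sym eq′) (m∸n≤m x v)
    arm : x ∸ suc (x ∸ suc v) ≡ v
    arm = trans (cong (x ∸_) eq′) (m∸[m∸n]≡n (<⇒≤ v<x))

  col< : ∀ v → f v < x → part xs (suc (k ∸ v)) < suc (x ∸ suc v)
  col< v p = subst (suc (part xs (suc (k ∸ v))) ≤_)
    (+-∸-assoc 1 (≤-trans (s≤s (m≤m+n v _)) p))
    (≤-trans (≤-reflexive (trans (sym (m+n∸m≡n v _)) (cong (_∸ v) (+-suc v _)))) (∸-monoˡ-≤ v p))

  conj≤ : ∀ v → f v < x → conjPart xs (suc (x ∸ suc v)) ≤ k ∸ v
  conj≤ v p = ≮⇒≥ λ q → <⇒≱ (col< v p) (conjPart⇒part (Decr-tail xs d) (k ∸ v) (x ∸ suc v) q)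

  search : ∀ e v → v + e ≡ k → f v < x → ∃ λ v → 1 ≤ v × v ≤ k × x ≡ f v
  search zero v eq p = contradiction (≤-antisym (conj≤ v p) (≤-trans (≤-reflexive v∸) z≤n))
    (gap v (≤-trans (s≤s (m≤m+n v _)) p) (≤-reflexive v≡k))
    where
    v≡k : v ≡ k
    v≡k = trans (sym (+-identityʳ v)) eq
    v∸ : k ∸ v ≡ 0
    v∸ = trans (cong (k ∸_) v≡k) (n∸n≡0 k)
  search (suc e) v eq p with <-cmp (f (suc v)) x
  ... | tri< q _ _ = search e (suc v) (trans (sym (+-suc v e)) eq) q
  ... | tri≈ _ q _ = suc v , s≤s z≤n , v<k , sym q
    where
    v<k : suc v ≤ k
    v<k = ≤-trans (m≤m+n (suc v) e) (≤-reflexive (trans (sym (+-suc v e)) eq))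
  -- Here x lies strictly between the values at v and v + 1. Column x - v therefore misses row k+1-v
  -- of `xs` but still meets row k-v, so its leg is exactly k-v.
  ... | tri> _ _ q = contradiction (≤-antisym (conj≤ v p) ≤conj) (gap v v<x (<⇒≤ v<k))
    where
    v<k : suc v ≤ k
    v<k = ≤-trans (m≤m+n (suc v) e) (≤-reflexive (trans (sym (+-suc v e)) eq))
    v<x : v < x
    v<x = ≤-trans (s≤s (m≤m+n v _)) p
    ≤conj : k ∸ v ≤ conjPart xs (suc (x ∸ suc v))
    ≤conj = subst (_≤ conjPart xs (suc (x ∸ suc v))) (sym (+-∸-assoc 1 v<k))
      (part⇒conjPart (Decr-tail xs d) (k ∸ suc v) (x ∸ suc v)
        (subst (_≤ part xs (suc (k ∸ suc v))) (+-∸-assoc 1 v<x)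
          (≤-trans (∸-monoˡ-≤ v (≤-pred q)) (≤-reflexive (m+n∸m≡n v _)))))

  finish : (∃ λ v → 1 ≤ v × v ≤ k × x ≡ f v) → ∃ (CoreOf k (x ∷ xs))
  finish (v , v≥1 , v≤k , eq) = v ∷ ν , row v v≥1 v≤k eq (Decr-head xs d) core

CoreOf-functional : ∀ {k κ ν ν′} → CoreOf k κ ν → CoreOf k κ ν′ → ν ≡ ν′
CoreOf-functional core core′ = trans (sym (CoreOf-pmap core)) (CoreOf-pmap core′)

T-∧⁻ : ∀ {x y} → T (x ∧ y) → T x × T y
T-∧⁻ {x} {y} = Equivalence.to (T-∧ {x} {y})

T-∧⁺ : ∀ {x y} → T x → T y → T (x ∧ y)
T-∧⁺ {x} {y} p q = Equivalence.from (T-∧ {x} {y}) (p , q)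

decrᵇ⇒Decr : ∀ xs → T (decrᵇ xs) → Decr xs
decrᵇ⇒Decr []           t = tt
decrᵇ⇒Decr (x ∷ [])     t = tt
decrᵇ⇒Decr (x ∷ y ∷ xs) t = ≤ᵇ⇒≤ y x (proj₁ (T-∧⁻ t)) , decrᵇ⇒Decr (y ∷ xs) (proj₂ (T-∧⁻ {y ≤ᵇ x} t))

Decr⇒decrᵇ : ∀ xs → Decr xs → T (decrᵇ xs)
Decr⇒decrᵇ []           d       = tt
Decr⇒decrᵇ (x ∷ [])     d       = tt
Decr⇒decrᵇ (x ∷ y ∷ xs) (p , d) = T-∧⁺ (≤⇒≤ᵇ p) (Decr⇒decrᵇ (y ∷ xs) d)

T-not⇒≢ : ∀ {m n} → T (not (m ≡ᵇ n)) → m ≢ n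
T-not⇒≢ {m} t refl with m ≡ᵇ m | ≡⇒≡ᵇ m m refl
... | true | _ = t

≢⇒T-not : ∀ {m n} → m ≢ n → T (not (m ≡ᵇ n))
≢⇒T-not {m} {n} p with m ≡ᵇ n in eq
... | true  = p (≡ᵇ⇒≡ m n (subst T (sym eq) tt))
... | false = tt

core⇒CoreOf : ∀ {k κ} → T (isPartitionᵇ κ) → T (isCoreᵇ k κ) → ∃ (CoreOf k κ)
core⇒CoreOf {k} {κ} part? core? = no-hook⇒CoreOf (decrᵇ⇒Decr κ (proj₁ (T-∧⁻ part?)))
  (All.map (λ {x} → ≤ᵇ⇒≤ 1 x) (Allₚ.all⁺ (1 ≤ᵇ_) κ (proj₂ (T-∧⁻ {decrᵇ κ} part?))))
  λ i j p → T-not⇒≢ (All.lookup (Allₚ.all⁺ (λ c → not (hook κ (proj₁ c) (proj₂ c) ≡ᵇ suc k)) (cells κ) core?) (∈-cells⁺ κ p))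

CoreOf⇒isPartition : ∀ {k κ ν} → CoreOf k κ ν → T (isPartitionᵇ κ)
CoreOf⇒isPartition {κ = κ} core = T-∧⁺ (Decr⇒decrᵇ κ (CoreOf-Decr core)) (Allₚ.all⁻ (1 ≤ᵇ_) (All.map ≤⇒≤ᵇ (CoreOf-pos core)))

CoreOf⇒isCore : ∀ {k κ ν} → CoreOf k κ ν → T (isCoreᵇ k κ)
CoreOf⇒isCore {k} {κ} core = Allₚ.all⁻ _ (All.tabulate ok)
  where
  ok : ∀ {c} → c ∈ cells κ → T (not (hook κ (proj₁ c) (proj₂ c) ≡ᵇ suc k))
  ok c∈ with ∈-cells⁻ κ c∈
  ... | i , j , refl , p = ≢⇒T-not (CoreOf-hook core i j p)

-- Horizontal strips and explicit cores

data HS : List ℕ → List ℕ → Set where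
  []   : HS [] []
  top  : ∀ {x} → HS (x ∷ []) []
  cons : ∀ {x t κ τ} → t ≤ x → part κ 1 ≤ t → HS κ τ → HS (x ∷ κ) (t ∷ τ)

HS-≤ : ∀ {κ τ} → HS κ τ → ∀ i → part τ (suc i) ≤ part κ (suc i)
HS-≤ []            i       = z≤n
HS-≤ top           i       = z≤n
HS-≤ (cons p q hs) zero    = p
HS-≤ (cons p q hs) (suc i) = HS-≤ hs i

HS-≥ : ∀ {κ τ} → HS κ τ → ∀ i → part κ (suc (suc i)) ≤ part τ (suc i)
HS-≥ []            i       = z≤n
HS-≥ top           i       = z≤n
HS-≥ (cons p q hs) zero    = q
HS-≥ (cons p q hs) (suc i) = HS-≥ hs i

-- Positive parts exclude the two cases missing from `HS`: fewer rows than the base, and two rows on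
-- top of it.
HS-intro : ∀ {κ τ} → All (1 ≤_) κ → All (1 ≤_) τ →
  (∀ i → i < length κ + length τ → part τ (suc i) ≤ part κ (suc i) × part κ (suc (suc i)) ≤ part τ (suc i)) → HS κ τ
HS-intro {[]}        {[]}    _       _       h = []
HS-intro {[]}        {t ∷ τ} _       (p ∷ _) h = contradiction (proj₁ (h 0 (s≤s z≤n))) (<⇒≱ p)
HS-intro {x ∷ []}    {[]}    _       _       h = top
HS-intro {x ∷ y ∷ κ} {[]}    (_ ∷ p ∷ _) _   h = contradiction (proj₂ (h 0 (s≤s z≤n))) (<⇒≱ p)
HS-intro {x ∷ κ}     {t ∷ τ} (_ ∷ p) (_ ∷ q) h =
  cons (proj₁ (h 0 (s≤s z≤n))) (proj₂ (h 0 (s≤s z≤n)))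
    (HS-intro p q λ i i< → h (suc i) (s≤s (≤-trans i< (+-monoʳ-≤ (length κ) (n≤1+n (length τ))))))

part-replicate : ∀ d {S ys i} → i < d → part (replicate d S ++ ys) (suc i) ≡ S
part-replicate (suc d) {i = zero}  p       = refl
part-replicate (suc d) {i = suc i} (s≤s p) = part-replicate d p

part-replicate-++ : ∀ d {S} ys i → part (replicate d S ++ ys) (d + suc i) ≡ part ys (suc i)
part-replicate-++ zero    ys i = refl
part-replicate-++ (suc d) {S} ys i rewrite +-suc d i = trans (cong (part (replicate d S ++ ys)) (sym (+-suc d i))) (part-replicate-++ d ys i)

part-map-++ : ∀ S μ ys i → part (map (_+_ S) μ ++ ys) (length μ + suc i) ≡ part ys (suc i)
part-map-++ S []      ys i = refl
part-map-++ S (m ∷ μ) ys i rewrite +-suc (length μ) i =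
  trans (cong (part (map (_+_ S) μ ++ ys)) (sym (+-suc (length μ) i))) (part-map-++ S μ ys i)

-- qs lists the widths q of the rectangles R_q in P from the bottom row upwards; b bounds them.
data Rects (k : ℕ) : ℕ → List ℕ → Set where
  []   : ∀ {b} → Rects k b []
  cons : ∀ {b q qs} → 1 ≤ q → q ≤ k → q ≤ b → Rects k q qs → Rects k b (q ∷ qs)

-- shape x qs is the core of the partition P ∪ (x), P = ⋃ R_q, and parts x qs is that partition.
shape : ℕ → ℕ → List ℕ → List ℕ
shape k x []       = single x
shape k x (q ∷ qs) = (sum (q ∷ qs) + x) ∷ replicate (k ∸ q) (sum (q ∷ qs)) ++ shape k (x ⊓ q) qs

parts : ℕ → ℕ → List ℕ → List ℕ
parts k x []       = single x
parts k x (q ∷ qs) = (q ⊔ x) ∷ replicate (k ∸ q) q ++ parts k (x ⊓ q) qs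

part-single : ∀ x → part (single x) 1 ≡ x
part-single zero    = refl
part-single (suc x) = refl

single-pos : ∀ {x} → 1 ≤ x → single x ≡ x ∷ []
single-pos (s≤s _) = refl

shape-head : ∀ k x qs → part (shape k x qs) 1 ≡ sum qs + x
shape-head k x []       = part-single x
shape-head k x (q ∷ qs) = refl

shape-≤-sum : ∀ k qs i → part (shape k 0 qs) i ≤ sum qs
shape-≤-sum k qs i = part-All (all qs) i
  where
  all : ∀ qs → All (_≤ sum qs) (shape k 0 qs)
  all []       = []
  all (q ∷ qs) = ≤-reflexive (+-identityʳ _) ∷
    Allₚ.++⁺ (Allₚ.replicate⁺ (k ∸ q) ≤-refl) (All.map (λ p → ≤-trans p (m≤n+m (sum qs) q)) (all qs))

HS-replicate : ∀ d {S κ τ} → part κ 1 ≤ S → HS κ τ → HS (replicate d S ++ κ) (replicate d S ++ τ)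
HS-replicate zero          p hs = hs
HS-replicate (suc zero)    p hs = cons ≤-refl p hs
HS-replicate (suc (suc d)) p hs = cons ≤-refl ≤-refl (HS-replicate (suc d) p hs)

part-replicate-head : ∀ d {S κ} → part κ 1 ≤ S → part (replicate d S ++ κ) 1 ≤ S
part-replicate-head zero    p = p
part-replicate-head (suc d) p = ≤-refl

shape-cap : ∀ k x q qs → part (shape k (x ⊓ q) qs) 1 ≤ q + sum qs
shape-cap k x q qs = ≤-trans (≤-reflexive (trans (shape-head k (x ⊓ q) qs) (+-comm (sum qs) _)))
  (+-monoˡ-≤ (sum qs) (m⊓n≤n x q))

shape-HS : ∀ k x qs → HS (shape k x qs) (shape k 0 qs)
shape-HS k zero    []       = []
shape-HS k (suc x) []       = top
shape-HS k x       (q ∷ qs) = cons (+-monoʳ-≤ (q + sum qs) z≤n)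
  (≤-trans (part-replicate-head (k ∸ q) (shape-cap k x q qs)) (m≤m+n _ 0))
  (HS-replicate (k ∸ q) (shape-cap k x q qs) (shape-HS k (x ⊓ q) qs))

strip-≤-sum : ∀ {k w} qs → HS w (shape k 0 qs) → ∀ i → part w (suc (suc i)) ≤ sum qs
strip-≤-sum {k} qs hs i = ≤-trans (HS-≥ hs i) (shape-≤-sum k qs (suc i))

-- Rows 2 to k+1-b lie between equal rows of the first block, which leaves a horizontal strip no
-- freedom there. A lookup into the block thus has the same answer for every strip.
strip-interior : ∀ {k b w qs} → Rects k b qs → HS w (shape k 0 qs) → ∀ i → i < k ∸ b → part w (suc (suc i)) ≡ sum qs
strip-interior []                      hs i p = n≤0⇒n≡0 (HS-≥ hs i)
strip-interior {k} {qs = q ∷ qs} (cons _ _ q≤b _) hs i p = ≤-antisym (strip-≤-sum (q ∷ qs) hs i)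
  (≤-trans (≤-reflexive (sym (part-replicate (k ∸ q) (≤-trans p (∸-monoʳ-≤ k q≤b))))) (HS-≤ hs (suc i)))

row-mono : ∀ {k κ v v′} → Decr κ → v < v′ → v + part κ (suc (k ∸ v)) < v′ + part κ (suc (k ∸ v′))
row-mono {k} d p = +-mono-<-≤ p (part-antitone d (∸-monoʳ-≤ k (<⇒≤ p)))

-- The part of a row can be recovered from its length, since v + κ_{k+1-v} is strictly increasing in
-- v.
row-unique : ∀ {k κ} v v′ → Decr κ → v + part κ (suc (k ∸ v)) ≡ v′ + part κ (suc (k ∸ v′)) → v ≡ v′
row-unique v v′ d eq with <-cmp v v′
... | tri< p _ _ = contradiction eq (<⇒≢ (row-mono d p))
... | tri≈ _ p _ = p
... | tri> _ _ p = contradiction (sym eq) (<⇒≢ (row-mono d p))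

-- Index arithmetic for lookups: after d < e leading rows, row e+1 is row i+2 of the remainder and
-- hence lies beyond its first row.
∸-split : ∀ {d e} → suc d ≤ e → ∃ λ i → suc e ≡ d + suc (suc i) × i < e
∸-split {d} {e} p = e ∸ suc d ,
  trans (cong suc (trans (sym (m+[n∸m]≡n p)) (sym (+-suc d (e ∸ suc d))))) (sym (+-suc d (suc (e ∸ suc d)))) ,
  ≤-trans (≤-reflexive (sym (+-∸-assoc 1 p))) (m∸n≤m e d)

block-lookup : ∀ {k q w qs d} → Rects k q qs → HS w (shape k 0 qs) → suc d ≤ k ∸ q →
  part (replicate d (q + sum qs) ++ w) (suc (k ∸ q)) ≡ sum qs
block-lookup {k} {q} {w} {qs} {d} rs hs p with ∸-split p
... | i , eq , i< = trans (cong (part (replicate d (q + sum qs) ++ w)) eq)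
  (trans (part-replicate-++ d w (suc i)) (strip-interior rs hs i i<))

block-CoreOf : ∀ {k q w ν qs} d → 1 ≤ q → q ≤ k → Rects k q qs → d ≤ k ∸ q →
  CoreOf k w ν → HS w (shape k 0 qs) → part w 1 ≤ q + sum qs →
  CoreOf k (replicate d (q + sum qs) ++ w) (replicate d q ++ ν)
block-CoreOf zero    1≤q q≤k rs d≤ core hs p = core
block-CoreOf {q = q} (suc d) 1≤q q≤k rs d≤ core hs p =
  row q 1≤q q≤k (cong (_+_ q) (sym (block-lookup rs hs d≤))) (part-replicate-head d p)
    (block-CoreOf d 1≤q q≤k rs (<⇒≤ d≤) core hs p)

-- For x ≤ q the first row keeps the part q and its lookup reads the first row of the next block,
-- which has grown by x. For x > q the first row takes the part x, the lookup stays inside its own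
-- block, and the displaced q moves on to the next one.
shape-CoreOf : ∀ {k b x qs} → Rects k b qs → x ≤ k → CoreOf k (shape k x qs) (parts k x qs)
shape-CoreOf {x = zero}  []  _   = []
shape-CoreOf {x = suc x} []  x≤k = row (suc x) (s≤s z≤n) x≤k (sym (+-identityʳ (suc x))) z≤n []
shape-CoreOf {k} {b} {x} (cons {q = q} {qs} 1≤q q≤k _ rs) x≤k =
  row (q ⊔ x) (≤-trans 1≤q (m≤m⊔n q x)) (⊔-lub q≤k x≤k) eq
    (≤-trans (part-replicate-head (k ∸ q) (shape-cap k x q qs)) (m≤m+n _ x))
    (block-CoreOf (k ∸ q) 1≤q q≤k rs ≤-refl (shape-CoreOf rs (≤-trans (m⊓n≤n x q) q≤k)) (shape-HS k (x ⊓ q) qs) (shape-cap k x q qs))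
  where
  rest = replicate (k ∸ q) (q + sum qs) ++ shape k (x ⊓ q) qs
  eq : q + sum qs + x ≡ (q ⊔ x) + part rest (suc (k ∸ (q ⊔ x)))
  eq with x ℕ.≤? q
  ... | yes x≤q = begin
    q + sum qs + x                     ≡⟨ +-assoc q (sum qs) x ⟩
    q + (sum qs + x)                   ≡⟨ cong (λ y → q + (sum qs + y)) (sym (m≤n⇒m⊓n≡m x≤q)) ⟩
    q + (sum qs + (x ⊓ q))             ≡⟨ cong (_+_ q) (sym (shape-head k (x ⊓ q) qs)) ⟩
    q + part (shape k (x ⊓ q) qs) 1    ≡⟨ cong (_+_ q) (sym (part-replicate-++ (k ∸ q) _ 0)) ⟩
    q + part rest (k ∸ q + 1)          ≡⟨ cong (λ i → q + part rest i) (+-comm (k ∸ q) 1) ⟩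
    q + part rest (suc (k ∸ q))        ≡⟨ cong (λ m → m + part rest (suc (k ∸ m))) (sym (m≥n⇒m⊔n≡m x≤q)) ⟩
    (q ⊔ x) + part rest (suc (k ∸ (q ⊔ x))) ∎
  ... | no x≰q = begin
    q + sum qs + x                     ≡⟨ +-comm (q + sum qs) x ⟩
    x + (q + sum qs)                   ≡⟨ cong (_+_ x) (sym (part-replicate (k ∸ q) (∸-monoʳ-< (≰⇒> x≰q) x≤k))) ⟩
    x + part rest (suc (k ∸ x))        ≡⟨ cong (λ m → m + part rest (suc (k ∸ m))) (sym (m≤n⇒m⊔n≡n (<⇒≤ (≰⇒> x≰q)))) ⟩
    (q ⊔ x) + part rest (suc (k ∸ (q ⊔ x))) ∎

⊔+⊓ : ∀ q x → (q ⊔ x) + (x ⊓ q) ≡ q + x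
⊔+⊓ q x with x ℕ.≤? q
... | yes p = cong₂ _+_ (m≥n⇒m⊔n≡m p) (m≤n⇒m⊓n≡m p)
... | no ¬p = trans (cong₂ _+_ (m≤n⇒m⊔n≡n (<⇒≤ (≰⇒> ¬p))) (m≥n⇒m⊓n≡n (<⇒≤ (≰⇒> ¬p)))) (+-comm x q)

sum-block : ∀ v d q ν → sum (v ∷ replicate d q ++ ν) ≡ v + (sum (replicate d q) + sum ν)
sum-block v d q ν = cong (_+_ v) (sum-++ (replicate d q) ν)

sum-single : ∀ x → sum (single x) ≡ x
sum-single zero    = refl
sum-single (suc x) = +-identityʳ (suc x)

sum-parts : ∀ k x qs → sum (parts k x qs) ≡ sum (parts k 0 qs) + x
sum-parts k x []       = sum-single x
sum-parts k x (q ∷ qs) = begin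
  sum (parts k x (q ∷ qs))                    ≡⟨ sum-block (q ⊔ x) (k ∸ q) q _ ⟩
  (q ⊔ x) + (c + sum (parts k (x ⊓ q) qs))    ≡⟨ cong (λ z → (q ⊔ x) + (c + z)) (sum-parts k (x ⊓ q) qs) ⟩
  (q ⊔ x) + (c + (p + (x ⊓ q)))               ≡⟨ lem₁ (q ⊔ x) c p (x ⊓ q) ⟩
  (q ⊔ x) + (x ⊓ q) + (c + p)                 ≡⟨ cong (_+ (c + p)) (⊔+⊓ q x) ⟩
  q + x + (c + p)                             ≡⟨ lem₂ q x c p ⟩
  q + (c + p) + x                             ≡⟨ cong (λ z → z + (c + p) + x) (sym (⊔-identityʳ q)) ⟩
  (q ⊔ 0) + (c + p) + x                       ≡⟨ cong (_+ x) (sym (sum-block (q ⊔ 0) (k ∸ q) q (parts k 0 qs))) ⟩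
  sum (parts k 0 (q ∷ qs)) + x                ∎
  where
  c = sum (replicate (k ∸ q) q)
  p = sum (parts k 0 qs)
  lem₁ : ∀ a b c d → a + (b + (c + d)) ≡ a + d + (b + c)
  lem₁ = ℕ-Ring.solve-∀
  lem₂ : ∀ a b c d → a + b + (c + d) ≡ a + (c + d) + b
  lem₂ = ℕ-Ring.solve-∀

-- Weak strips over a union of rectangles

-- No cell can be added to these rows: each is held at `q + sum qs` by the base from below and by
-- interlacing from above, and `row-unique` then returns the part q.
block-peel : ∀ {k q qs w ν} d → Rects k q qs → d ≤ k ∸ q → CoreOf k w ν →
  HS w (replicate d (q + sum qs) ++ shape k 0 qs) → part w 1 ≤ q + sum qs →
  ∃₂ λ w′ ν′ → w ≡ replicate d (q + sum qs) ++ w′ × ν ≡ replicate d q ++ ν′ ×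
    CoreOf k w′ ν′ × HS w′ (shape k 0 qs) × part w′ 1 ≤ q + sum qs
block-peel zero    rs d≤ core hs p = _ , _ , refl , refl , core , hs , p
block-peel {k} {q} {qs} (suc d) rs d≤ (row v _ v≤k eq _ core) (cons S≤x p′ hs) p
  with ≤-antisym p S≤x | block-peel d rs (<⇒≤ d≤) core hs p′
... | refl | w′ , ν′ , refl , refl , core′ , hs′ , p″
  with row-unique v q (CoreOf-Decr core) (trans (sym eq) (cong (_+_ q) (sym (block-lookup rs hs′ d≤))))
... | refl = w′ , ν′ , refl , refl , core′ , hs′ , p″

-- Every block passes on to the next one at most the part of x that fits into it, so 𝔭(w) is larger than P by
-- at most x, and by exactly x only if each block passes on as much as possible.
blocks-forward : ∀ {k b qs w ν} → Rects k b qs → CoreOf k w ν → HS w (shape k 0 qs) →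
  ∃ λ x → part w 1 ≡ sum qs + x × x ≤ k × sum ν ≤ sum (parts k 0 qs) + x ×
    (sum (parts k 0 qs) + x ≤ sum ν → w ≡ shape k x qs)
blocks-forward [] []                    []  = 0 , refl , z≤n , z≤n , λ _ → refl
blocks-forward [] (row (suc v) _ v≤k eq _ []) top = suc v , trans eq (+-identityʳ _) , v≤k , ≤-reflexive (+-identityʳ _) ,
  λ _ → cong (_∷ []) (trans eq (+-identityʳ _))
blocks-forward {k} (cons {q = q} {qs} 1≤q q≤k _ rs) (row {κ = w₁} v _ v≤k eq _ core) (cons {x = a} S≤a p hs)
  with block-peel (k ∸ q) rs ≤-refl core hs (≤-trans p (≤-reflexive (+-identityʳ _)))
... | w′ , ν′ , refl , refl , core′ , hs′ , p′
  with blocks-forward rs core′ hs′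
... | x′ , eq′ , _ , le , exact with x′≤q ← +-cancelʳ-≤ (sum qs) x′ q (≤-trans (≤-reflexive (trans (+-comm x′ _) (sym eq′))) p′) | <-cmp v q
-- A part below q would look past the block and past the first row of the next one, to a row of
-- length at most `sum qs`; the row would be shorter than its base.
... | tri< v<q _ _ = contradiction (≤-trans (≤-trans (m≤m+n _ 0) S≤a) (≤-trans (≤-reflexive eq) (+-monoʳ-≤ v low)))
    (<⇒≱ (+-monoˡ-< (sum qs) v<q))
  where
  low : part w₁ (suc (k ∸ v)) ≤ sum qs
  low with ∸-split (∸-monoʳ-< v<q q≤k)
  ... | i , ieq , _ = ≤-trans (≤-reflexive (trans (cong (part w₁) ieq) (part-replicate-++ (k ∸ q) w′ (suc i)))) (strip-≤-sum qs hs′ i)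
-- With part q the row reads the first row of the next block and grows by the same x′.
... | tri≈ _ refl _ = x′ , a≡ , ≤-trans x′≤q q≤k , size , λ h → cong₂ _∷_ a≡ (cong (replicate (k ∸ q) (q + sum qs) ++_)
    (trans (exact (+-cancelˡ-≤ c _ _ (+-cancelˡ-≤ q _ _ (≤-trans (≤-reflexive (trans (lem q c _ x′) (sym base))) (≤-trans h (≤-reflexive (sum-block q (k ∸ q) q ν′)))))))
      (cong (λ y → shape k y qs) (sym (m≤n⇒m⊓n≡m x′≤q)))))
  where
  c = sum (replicate (k ∸ q) q)
  lem : ∀ q c p x → q + (c + (p + x)) ≡ q + (c + p) + x
  lem = ℕ-Ring.solve-∀
  base : sum (parts k 0 (q ∷ qs)) + x′ ≡ q + (c + sum (parts k 0 qs)) + x′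
  base = cong (_+ x′) (trans (sum-block (q ⊔ 0) (k ∸ q) q (parts k 0 qs)) (cong (_+ (c + sum (parts k 0 qs))) (⊔-identityʳ q)))
  a≡ : a ≡ q + sum qs + x′
  a≡ = trans eq (trans (cong (λ i → q + part w₁ i) (+-comm 1 (k ∸ q)))
    (trans (cong (_+_ q) (trans (part-replicate-++ (k ∸ q) w′ 0) eq′)) (sym (+-assoc q (sum qs) x′))))
  size : sum (q ∷ replicate (k ∸ q) q ++ ν′) ≤ sum (parts k 0 (q ∷ qs)) + x′
  size = ≤-trans (≤-reflexive (sum-block q (k ∸ q) q ν′)) (≤-trans (+-monoʳ-≤ q (+-monoʳ-≤ c le)) (≤-reflexive (trans (lem q c _ x′) (sym base))))
-- A part above q is looked up inside the block, so the row grows by v, whereas the next block can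
-- take only x′ ≤ q. Equality of sizes forces x′ = q.
... | tri> _ _ q<v = v , a≡ , v≤k , size , λ h → cong₂ _∷_ a≡ (cong (replicate (k ∸ q) (q + sum qs) ++_)
    (trans (exact (full h .proj₁)) (cong (λ y → shape k y qs) (trans (full h .proj₂) (sym (m≥n⇒m⊓n≡n (<⇒≤ q<v)))))))
  where
  c = sum (replicate (k ∸ q) q)
  p₀ = sum (parts k 0 qs)
  lem : ∀ q c p v → v + (c + (p + q)) ≡ q + (c + p) + v
  lem = ℕ-Ring.solve-∀
  base : sum (parts k 0 (q ∷ qs)) + v ≡ q + (c + p₀) + v
  base = cong (_+ v) (trans (sum-block (q ⊔ 0) (k ∸ q) q (parts k 0 qs)) (cong (_+ (c + p₀)) (⊔-identityʳ q)))
  a≡ : a ≡ q + sum qs + v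
  a≡ = trans eq (trans (cong (_+_ v) (part-replicate (k ∸ q) (∸-monoʳ-< q<v v≤k))) (+-comm v _))
  size : sum (v ∷ replicate (k ∸ q) q ++ ν′) ≤ sum (parts k 0 (q ∷ qs)) + v
  size = ≤-trans (≤-reflexive (sum-block v (k ∸ q) q ν′))
    (≤-trans (+-monoʳ-≤ v (+-monoʳ-≤ c (≤-trans le (+-monoʳ-≤ p₀ x′≤q)))) (≤-reflexive (trans (lem q c p₀ v) (sym base))))
  full : sum (parts k 0 (q ∷ qs)) + v ≤ sum (v ∷ replicate (k ∸ q) q ++ ν′) → p₀ + x′ ≤ sum ν′ × x′ ≡ q
  full h = ≤-trans (+-monoʳ-≤ p₀ x′≤q) big , ≤-antisym x′≤q (+-cancelˡ-≤ p₀ _ _ (≤-trans big le))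
    where
    big : p₀ + q ≤ sum ν′
    big = +-cancelˡ-≤ c _ _ (+-cancelˡ-≤ v _ _ (≤-trans (≤-reflexive (trans (lem q c p₀ v) (sym base)))
      (≤-trans h (≤-reflexive (sum-block v (k ∸ q) q ν′)))))

-- Weak strips over λ̄ ∪ P

data Strip : ℕ → List ℕ → List ℕ → Set where
  []   : ∀ {B} → Strip B [] []
  cons : ∀ {B l m μ ls} → l ≤ m → m ≤ B → Strip l μ ls → Strip B (m ∷ μ) (l ∷ ls)

Strip-length : ∀ {B μ ls} → Strip B μ ls → length μ ≡ length ls
Strip-length []           = refl
Strip-length (cons _ _ s) = cong suc (Strip-length s)

base : ℕ → List ℕ → List ℕ → List ℕ
base k ls qs = map (_+_ (sum qs)) ls ++ shape k 0 qs

-- The lookup passes the rows of μ and the first row of `w` because m + l(μ) < k, and it stays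
-- within the first block because b ≤ m.
mid-lookup : ∀ {k b qs w m} μ → Rects k b qs → HS w (shape k 0 qs) → b ≤ m → m + suc (length μ) ≤ k →
  part (map (_+_ (sum qs)) μ ++ w) (suc (k ∸ m)) ≡ sum qs
mid-lookup {k} {b} {qs} {w} {m} μ rs hs b≤m p
  with ∸-split (m+n≤o⇒m≤o∸n (suc (length μ)) (≤-trans (≤-reflexive (+-comm _ m)) p))
... | i , eq , i< = trans (cong (part (map (_+_ (sum qs)) μ ++ w)) eq)
  (trans (part-map-++ (sum qs) μ w (suc i)) (strip-interior rs hs i (≤-trans i< (∸-monoʳ-≤ k b≤m))))

mid-lookup-≤ : ∀ {k w m} qs μ → HS w (shape k 0 qs) → m + suc (length μ) ≤ k →
  part (map (_+_ (sum qs)) μ ++ w) (suc (k ∸ m)) ≤ sum qs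
mid-lookup-≤ {k} {w} {m} qs μ hs p
  with ∸-split (m+n≤o⇒m≤o∸n (suc (length μ)) (≤-trans (≤-reflexive (+-comm _ m)) p))
... | i , eq , i< = ≤-trans (≤-reflexive (trans (cong (part (map (_+_ (sum qs)) μ ++ w)) eq) (part-map-++ (sum qs) μ w (suc i))))
  (strip-≤-sum qs hs i)

mid-head : ∀ {B μ ls x} S w → Strip B μ ls → part w 1 ≤ S + x → x ≤ B → part (map (_+_ S) μ ++ w) 1 ≤ S + B
mid-head S w []             p x≤B = ≤-trans p (+-monoʳ-≤ S x≤B)
mid-head S w (cons _ m≤B _) p x≤B = +-monoʳ-≤ S m≤B

-- Treats the rows of λ̄ above its first one. There `B + length ls ≤ k` lets every lookup reach the
-- inside of P, so a row has length S plus its part and is not affected by the new part x.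
mid-forward : ∀ {k b qs B ls κ ν} → Rects k b qs → All (b <_) ls → B + length ls ≤ k →
  part κ 1 ≤ sum qs + B → CoreOf k κ ν → HS κ (base k ls qs) →
  ∃₂ λ μ w → ∃ λ νw → κ ≡ map (_+_ (sum qs)) μ ++ w × ν ≡ μ ++ νw × CoreOf k w νw × HS w (shape k 0 qs) × Strip B μ ls
mid-forward {ls = []} rs _ fit p core hs = [] , _ , _ , refl , refl , core , hs , []
mid-forward {k} {b} {qs} {B} {l ∷ ls} rs (b<l ∷ b<) fit p (row {x = a} v _ _ eq _ core) (cons S+l≤a p′ hs)
  with mid-forward rs b< (≤-trans (+-mono-≤ l≤B (n≤1+n _)) fit) p′ core hs
  where
  l≤B : l ≤ B
  l≤B = +-cancelˡ-≤ (sum qs) _ _ (≤-trans S+l≤a p)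
... | μ , w , νw , refl , refl , core′ , hs′ , strip
  with m≤n⇒∃[o]m+o≡n (≤-trans (m≤m+n (sum qs) l) S+l≤a)
... | m , refl
  with l≤m ← +-cancelˡ-≤ (sum qs) l m S+l≤a | m≤B ← +-cancelˡ-≤ (sum qs) m B p
  with row-unique v m (CoreOf-Decr core) (trans (sym eq) (trans (+-comm (sum qs) m) (cong (_+_ m) (sym
         (mid-lookup μ rs hs′ (≤-trans (<⇒≤ b<l) l≤m)
           (≤-trans (+-mono-≤ m≤B (≤-reflexive (cong suc (Strip-length strip)))) fit))))))
... | refl = m ∷ μ , w , νw , refl , refl , core′ , hs′ , cons l≤m m≤B strip

mid-reverse : ∀ {k b qs B μ ls w νw x} → Rects k b qs → Strip B μ ls → B + length ls ≤ k → All (b <_) ls → All (x ≤_) ls →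
  part w 1 ≤ sum qs + x → CoreOf k w νw → HS w (shape k 0 qs) →
  CoreOf k (map (_+_ (sum qs)) μ ++ w) (μ ++ νw) × HS (map (_+_ (sum qs)) μ ++ w) (base k ls qs)
mid-reverse rs [] fit _ _ p core hs = core , hs
mid-reverse {k} {qs = qs} {B} {m ∷ μ} {l ∷ ls} {w} rs (cons l≤m m≤B strip) fit (b<l ∷ b<) (x≤l ∷ x≤) p core hs
  with mid-reverse rs strip (≤-trans (+-mono-≤ (≤-trans l≤m m≤B) (n≤1+n _)) fit) b< x≤ p core hs
... | core′ , hs′ =
  row m (≤-trans (s≤s z≤n) (≤-trans b<l l≤m)) (≤-trans m≤B (≤-trans (m≤m+n B _) fit))
    (trans (+-comm (sum qs) m) (cong (_+_ m) (sym
         (mid-lookup μ rs hs (≤-trans (<⇒≤ b<l) l≤m)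
           (≤-trans (+-mono-≤ m≤B (≤-reflexive (cong suc (Strip-length strip)))) fit)))))
    (≤-trans head (+-monoʳ-≤ (sum qs) l≤m)) core′ ,
  cons (+-monoʳ-≤ (sum qs) l≤m) head hs′
  where
  head : part (map (_+_ (sum qs)) μ ++ w) 1 ≤ sum qs + l
  head = mid-head (sum qs) w strip p x≤l

-- The containment of λ̄ in R_{k+1-l̄}, expressed by its first row.
Fits : ℕ → List ℕ → Set
Fits k []       = ⊤
Fits k (l ∷ ls) = l + length ls ≤ k

-- When the first row of μ has the maximal width k+1-l(μ), its hooks over the new part x exceed k,
-- which lengthens that row of the core by x.
extension : ℕ → ℕ → List ℕ → ℕ → ℕ
extension k m μ x = if m + length μ ≡ᵇ k then x else 0

core∪ : ℕ → List ℕ → ℕ → List ℕ → List ℕ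
core∪ k []      x qs = shape k x qs
core∪ k (m ∷ μ) x qs = (sum qs + m + extension k m μ x) ∷ map (_+_ (sum qs)) μ ++ shape k x qs

-- What is known of κ before its size is used: the rows of μ are present at least, and the row above
-- them is S + x. This already suffices to bound the number of residues from below.
data Low (S x : ℕ) : List ℕ → List ℕ → Set where
  []   : ∀ {w} → part w 1 ≡ S + x → Low S x [] w
  cons : ∀ {m a μ κ} → S + m ≤ a → Low S x μ κ → Low S x (m ∷ μ) (a ∷ κ)

Low-map : ∀ {S x w} μ → part w 1 ≡ S + x → Low S x μ (map (_+_ S) μ ++ w)
Low-map []      p = [] p
Low-map (m ∷ μ) p = cons ≤-refl (Low-map μ p)

Low-core∪ : ∀ k μ x qs → Low (sum qs) x μ (core∪ k μ x qs)
Low-core∪ k []      x qs = [] (shape-head k x qs)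
Low-core∪ k (m ∷ μ) x qs = cons (m≤m+n _ _) (Low-map μ (shape-head k x qs))

extension-yes : ∀ {k m} μ x → m + length μ ≡ k → extension k m μ x ≡ x
extension-yes {k} {m} μ x eq with m + length μ ≡ᵇ k | ≡⇒≡ᵇ (m + length μ) k eq
... | true | _ = refl

extension-no : ∀ {k m} μ x → m + length μ ≢ k → extension k m μ x ≡ 0
extension-no {k} {m} μ x neq with m + length μ ≡ᵇ k in e
... | true  = contradiction (≡ᵇ⇒≡ (m + length μ) k (subst T (sym e) tt)) neq
... | false = refl

last-lookup : ∀ {k m} S μ w → m + length μ ≡ k → part (map (_+_ S) μ ++ w) (suc (k ∸ m)) ≡ part w 1
last-lookup {k} {m} S μ w refl = trans
  (cong (λ i → part (map (_+_ S) μ ++ w) i) (trans (cong suc (m+n∸m≡n m (length μ))) (+-comm 1 (length μ))))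
  (part-map-++ S μ w 0)

top-≤ : ∀ {k l m} (ls : List ℕ) → l + length ls ≤ k → m ≤ k ∸ length ls → m + length ls ≤ k
top-≤ {k} {l} ls fit p = m≤o∸n⇒m+n≤o _ (≤-trans (m≤n+m (length ls) l) fit) p

core∪-reverse : ∀ {k b qs μ ls x} → Rects k b qs → Strip (suc k ∸ length ls) μ ls → Fits k ls → All (b <_) ls → All (x ≤_) ls →
  x ≤ k → CoreOf k (core∪ k μ x qs) (μ ++ parts k x qs) × HS (core∪ k μ x qs) (base k ls qs)
core∪-reverse {k} {qs = qs} {x = x} rs [] fit _ _ x≤k = shape-CoreOf rs x≤k , shape-HS k x qs
core∪-reverse {k} {qs = qs} {m ∷ μ} {l ∷ ls} {x} rs (cons l≤m m≤ strip) fit (b<l ∷ b<) (x≤l ∷ x≤) x≤k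
  with mid-reverse rs strip fit b< x≤ (≤-reflexive (shape-head k x qs)) (shape-CoreOf rs x≤k) (shape-HS k x qs)
... | core′ , hs′ =
  row m (≤-trans (s≤s z≤n) (≤-trans b<l l≤m)) (≤-trans (m≤m+n m _) m+≤k) eq
    (≤-trans head (≤-trans (+-monoʳ-≤ (sum qs) l≤m) (m≤m+n _ _))) core′ ,
  cons (≤-trans (+-monoʳ-≤ (sum qs) l≤m) (m≤m+n _ _)) head hs′
  where
  m+≤k : m + length ls ≤ k
  m+≤k = top-≤ {l = l} ls fit m≤
  rest = map (_+_ (sum qs)) μ ++ shape k x qs
  head : part rest 1 ≤ sum qs + l
  head = mid-head (sum qs) _ strip (≤-reflexive (shape-head k x qs)) x≤l
  eq : sum qs + m + extension k m μ x ≡ m + part rest (suc (k ∸ m))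
  eq with m + length μ ℕ.≟ k
  ... | yes p = trans (trans (trans (cong (_+_ (sum qs + m)) (extension-yes μ x p)) (cong (_+ x) (+-comm (sum qs) m))) (+-assoc m (sum qs) x))
          (cong (_+_ m) (sym (trans (last-lookup (sum qs) μ _ p) (shape-head k x qs))))
  ... | no ¬p = trans (trans (cong (_+_ (sum qs + m)) (extension-no μ x ¬p)) (+-identityʳ _)) (trans (+-comm (sum qs) m) (cong (_+_ m) (sym
          (mid-lookup μ rs (shape-HS k x qs) (≤-trans (<⇒≤ b<l) l≤m)
            (≤-trans (≤-reflexive (+-suc m _)) (≤∧≢⇒< (≤-trans (≤-reflexive (cong (_+_ m) (Strip-length strip))) m+≤k) ¬p))))))

mid-lookup-≥ : ∀ {B μ ls r i} S w → Strip B μ ls → All (r ≤_) ls → i < length ls → S + r ≤ part (map (_+_ S) μ ++ w) (suc i)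
mid-lookup-≥ {i = zero}  S w (cons l≤m _ _) (r≤l ∷ _) _       = +-monoʳ-≤ S (≤-trans r≤l l≤m)
mid-lookup-≥ {i = suc i} S w (cons _ _ s)   (_ ∷ r≤)  (s≤s p) = mid-lookup-≥ S w s r≤ p

-- Only the first row of λ̄ can be too wide for its lookup to reach the inside of P. If the lookup
-- hits the first row over P, the row also gains x. If it stays inside λ̄, the row would grow by
-- more than r, against `bound`.
core∪-forward : ∀ {k b qs ls r κ ν} → Rects k b qs → Fits k ls → All (b <_) ls → All (r ≤_) ls →
  (∀ {l ls′} → ls ≡ l ∷ ls′ → part κ 1 ≤ sum qs + l + r) → CoreOf k κ ν → HS κ (base k ls qs) →
  ∃₂ λ μ x → ∃ λ νw → Strip (suc k ∸ length ls) μ ls × ν ≡ μ ++ νw × x ≤ k × sum νw ≤ sum (parts k 0 qs) + x ×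
    (sum (parts k 0 qs) + x ≤ sum νw → κ ≡ core∪ k μ x qs) × Low (sum qs) x μ κ
core∪-forward {ls = []} rs _ _ _ _ core hs with blocks-forward rs core hs
... | x , hd , x≤k , le , exact = [] , x , _ , [] , refl , x≤k , le , exact , [] hd
core∪-forward {k} {b} {qs} {l ∷ ls} {r} rs fit (b<l ∷ b<) (r≤l ∷ r≤) bound (row {x = a} v _ v≤k eq _ core) (cons S+l≤a p hs)
  with mid-forward rs b< fit p core hs
... | μ , w , νw , refl , refl , core′ , hs′ , strip with blocks-forward rs core′ hs′
... | x , hd , x≤k , le , exact with len ← Strip-length strip | <-cmp (v + length μ) k
... | tri< v< v≢ _ = v ∷ μ , x , νw , cons l≤v v≤ strip , refl , x≤k , le ,
    (λ h → cong₂ _∷_ (trans a≡ (trans (sym (+-identityʳ _)) (cong (_+_ (sum qs + v)) (sym (extension-no μ x v≢)))))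
      (cong (map (_+_ (sum qs)) μ ++_) (exact h))) ,
    cons (≤-reflexive (sym a≡)) (Low-map μ hd)
  where
  room : v + suc (length μ) ≤ k
  room = ≤-trans (≤-reflexive (+-suc v _)) v<
  v≤ : v ≤ k ∸ length ls
  v≤ = m+n≤o⇒m≤o∸n v (≤-trans (≤-reflexive (cong (_+_ v) (sym len))) (<⇒≤ v<))
  l≤v : l ≤ v
  l≤v = +-cancelˡ-≤ (sum qs) l v (≤-trans S+l≤a (≤-trans (≤-reflexive eq)
    (≤-trans (+-monoʳ-≤ v (mid-lookup-≤ qs μ hs′ room)) (≤-reflexive (+-comm v _)))))
  a≡ : a ≡ sum qs + v
  a≡ = trans eq (trans (cong (_+_ v) (mid-lookup μ rs hs′ (≤-trans (<⇒≤ b<l) l≤v) room)) (+-comm v _))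
... | tri≈ _ v≡ _ = v ∷ μ , x , νw , cons l≤v v≤ strip , refl , x≤k , le ,
    (λ h → cong₂ _∷_ (trans a≡ (cong (_+_ (sum qs + v)) (sym (extension-yes μ x v≡)))) (cong (map (_+_ (sum qs)) μ ++_) (exact h))) ,
    cons (≤-trans (m≤m+n _ x) (≤-reflexive (sym a≡))) (Low-map μ hd)
  where
  v≤ : v ≤ k ∸ length ls
  v≤ = m+n≤o⇒m≤o∸n v (≤-reflexive (trans (cong (_+_ v) (sym len)) v≡))
  l≤v : l ≤ v
  l≤v = +-cancelʳ-≤ (length ls) l v (≤-trans fit (≤-reflexive (trans (sym v≡) (cong (_+_ v) len))))
  a≡ : a ≡ sum qs + v + x
  a≡ = trans eq (trans (cong (_+_ v) (trans (last-lookup (sum qs) μ w v≡) hd))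
    (trans (sym (+-assoc v (sum qs) x)) (cong (_+ x) (+-comm v (sum qs)))))
... | tri> _ _ v> = contradiction (bound refl) (<⇒≱ (≤-trans (≤-reflexive lem) (≤-trans (+-mono-≤ l<v deep) (≤-reflexive (sym eq)))))
  where
  short : k ∸ v < length ls
  short = +-cancelˡ-< v _ _ (≤-trans (≤-reflexive (cong suc (m+[n∸m]≡n v≤k))) (≤-trans v> (≤-reflexive (cong (_+_ v) len))))
  deep : sum qs + r ≤ part (map (_+_ (sum qs)) μ ++ w) (suc (k ∸ v))
  deep = mid-lookup-≥ (sum qs) w strip r≤ short
  l<v : l < v
  l<v = +-cancelʳ-< (length ls) l v (≤-trans (s≤s fit) (≤-trans v> (≤-reflexive (cong (_+_ v) len))))
  lem : suc (sum qs + l + r) ≡ suc l + (sum qs + r)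
  lem = cong suc (trans (cong (_+ r) (+-comm (sum qs) l)) (+-assoc l (sum qs) r))

-- Residues

Cong : ℕ → ℕ → ℕ → Set
Cong k a b = a % suc k ≡ b % suc k

Cong-intro : ∀ {k a b} c d → a + c * suc k ≡ b + d * suc k → Cong k a b
Cong-intro {k} {a} {b} c d eq =
  trans (sym ([m+kn]%n≡m%n a c (suc k))) (trans (cong (_% suc k) eq) ([m+kn]%n≡m%n b d (suc k)))

Cong-+ˡ : ∀ {k a b} c → Cong k a b → Cong k (c + a) (c + b)
Cong-+ˡ {k} {a} {b} c eq = trans (%-distribˡ-+ c a (suc k))
  (trans (cong (λ r → (c % suc k + r) % suc k) eq) (sym (%-distribˡ-+ c b (suc k))))

-- Adding C k cancels the constant, since C + C k is a multiple of k + 1.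
Cong-injective : ∀ {k} C {u v} → u < suc k → v < suc k → Cong k (C + u) (C + v) → u ≡ v
Cong-injective {k} C {u} {v} u< v< eq = begin
  u                         ≡⟨ sym (m<n⇒m%n≡m u<) ⟩
  u % suc k                 ≡⟨ Cong-intro C 0 (lem C u k) ⟩
  (C * k + (C + u)) % suc k ≡⟨ Cong-+ˡ (C * k) eq ⟩
  (C * k + (C + v)) % suc k ≡⟨ sym (Cong-intro C 0 (lem C v k)) ⟩
  v % suc k                 ≡⟨ m<n⇒m%n≡m v< ⟩
  v ∎
  where
  lem : ∀ C u k → u + C * suc k ≡ C * k + (C + u) + 0
  lem = ℕ-Ring.solve-∀

residues : ℕ → ℕ → List ℕ → List ℕ
residues k C vs = map (λ v → (C + v) % suc k) vs

residues-unique : ∀ {k} C {vs} → Unique vs → All (_< suc k) vs → Unique (residues k C vs)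
residues-unique C []        []        = []
residues-unique {k} C (v∉ ∷ u) (v< ∷ vs<) = go v∉ vs< ∷ residues-unique C u vs<
  where
  go : ∀ {vs} → All (_ ≢_) vs → All (_< suc k) vs → All (_ ≢_) (residues k C vs)
  go []       []       = []
  go (p ∷ ps) (q ∷ qs) = (λ eq → p (Cong-injective C v< q eq)) ∷ go ps qs

∈-residues⁺ : ∀ {k C ρ v vs} → v ∈ vs → Cong k ρ (C + v) → ρ % suc k ∈ residues k C vs
∈-residues⁺ {k} {C} {vs = vs} v∈ eq = subst (_∈ residues k C vs) (sym eq) (∈-map⁺ (λ v → (C + v) % suc k) v∈)

-- ρ is the (unreduced) residue of a cell of κ/τ
data Res (k : ℕ) (κ τ : List ℕ) (ρ : ℕ) : Set where
  cell : ∀ i j → part τ (suc i) < j → j ≤ part κ (suc i) → ρ ≡ j + k * suc i → Res k κ τ ρ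

skewResidues : ℕ → List ℕ → List ℕ → List ℕ
skewResidues k κ τ = map (residue k) (skewCells κ τ)

∈-skewResidues⁻ : ∀ {k κ τ z} → z ∈ skewResidues k κ τ → ∃ λ ρ → Res k κ τ ρ × z ≡ ρ % suc k
∈-skewResidues⁻ {k} {κ} {τ} z∈ with ∈-map⁻ (residue k) z∈
... | c , c∈ , refl with ∈-filter⁻ (λ c → part τ (proj₁ c) ℕ.<? proj₂ c) {xs = cells κ} c∈
... | c∈′ , p with ∈-cells⁻ κ c∈′
... | i , j , refl , q = _ , cell i (suc j) p q refl , refl

∈-skewResidues⁺ : ∀ {k κ τ ρ} → Res k κ τ ρ → ρ % suc k ∈ skewResidues k κ τ
∈-skewResidues⁺ {k} {κ} {τ} (cell i (suc j) p q refl) =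
  ∈-map⁺ (residue k) (∈-filter⁺ (λ c → part τ (proj₁ c) ℕ.<? proj₂ c) (∈-cells⁺ κ q) p)

Res-here : ∀ {k κ τ x t} j → t < j → j ≤ x → Res k (x ∷ κ) (t ∷ τ) (j + k * 1)
Res-here j p q = cell 0 j p q refl

Res-there : ∀ {k κ τ x t ρ} → Res k κ τ ρ → Res k (x ∷ κ) (t ∷ τ) (k + ρ)
Res-there {k} (cell i j p q refl) = cell (suc i) j p q (lem k i j)
  where
  lem : ∀ k i j → k + (j + k * suc i) ≡ j + k * suc (suc i)
  lem = ℕ-Ring.solve-∀

Res-uncons : ∀ {k κ τ x t ρ} → Res k (x ∷ κ) (t ∷ τ) ρ →
  (∃ λ j → t < j × j ≤ x × ρ ≡ j + k * 1) ⊎ (∃ λ ρ′ → Res k κ τ ρ′ × ρ ≡ k + ρ′)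
Res-uncons     (cell zero    j p q eq)   = inj₁ (j , p , q , eq)
Res-uncons {k} (cell (suc i) j p q refl) = inj₂ (_ , cell i j p q refl , lem k i j)
  where
  lem : ∀ k i j → j + k * suc (suc i) ≡ k + (j + k * suc i)
  lem = ℕ-Ring.solve-∀

Res-replicate : ∀ {k S κ τ ρ} d → Res k (replicate d S ++ κ) (replicate d S ++ τ) ρ → ∃ λ ρ′ → Res k κ τ ρ′ × ρ ≡ d * k + ρ′
Res-replicate         zero    r = _ , r , refl
Res-replicate {k} {S} (suc d) r with Res-uncons r
... | inj₁ (j , p , q , _)   = contradiction q (<⇒≱ p)
... | inj₂ (ρ′ , r′ , refl) with Res-replicate d r′
... | ρ″ , r″ , refl = ρ″ , r″ , sym (+-assoc k (d * k) ρ″)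

beyond : ∀ {S x j} → S < j → j ≤ S + x → ∃ λ y → y < x × j ≡ S + suc y
beyond {S} {x} {j} p q with m≤n⇒∃[o]m+o≡n p
... | y , refl = y , +-cancelˡ-≤ S _ _ (≤-trans (≤-reflexive (+-suc S y)) q) , sym (+-suc S y)

-- Each of the k+1-q rows contributes k, that is -1, so crossing a copy of R_q adds q.
block-shift : ∀ {k q} S y → q ≤ k → Cong k (suc (k ∸ q) * k + (S + y)) (q + S + y)
block-shift {k} {q} S y q≤k with m≤n⇒∃[o]m+o≡n q≤k
... | d , refl = trans (cong (λ e → (suc e * (q + d) + (S + y)) % suc (q + d)) (m+n∸m≡n q d))
  (Cong-intro {q + d} 0 d (lem q d S y))
  where
  lem : ∀ q d S y → suc d * (q + d) + (S + y) + 0 ≡ q + S + y + d * suc (q + d)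
  lem = ℕ-Ring.solve-∀

first-row : ∀ k S y → Cong k (S + suc y + k * 1) (S + y)
first-row k S y = Cong-intro 0 1 (lem k S y)
  where
  lem : ∀ k S y → S + suc y + k * 1 + 0 ≡ S + y + 1 * suc k
  lem = ℕ-Ring.solve-∀

-- Cells added to later blocks repeat residues of the first row: by `block-shift`, climbing over a
-- block makes up for the difference q of the row lengths.
shape-Res : ∀ {k b x qs ρ} → Rects k b qs → Res k (shape k x qs) (shape k 0 qs) ρ → ∃ λ y → y < x × Cong k ρ (sum qs + y)
shape-Res {k} {x = x} [] (cell zero (suc j) _ q refl) = j , ≤-trans q (≤-reflexive (part-single x)) , first-row k 0 j
shape-Res {x = zero}  [] (cell (suc i) (suc j) _ () _)
shape-Res {x = suc x} [] (cell (suc i) (suc j) _ () _)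
shape-Res {k} {x = x} (cons {q = q} {qs} _ q≤k _ rs) r with Res-uncons r
... | inj₁ (j , p , j≤ , refl) with beyond (≤-trans (s≤s (≤-reflexive (sym (+-identityʳ (q + sum qs))))) p) j≤
...   | y , y<x , refl = y , y<x , first-row k (q + sum qs) y
shape-Res {k} {x = x} (cons {q = q} {qs} _ q≤k _ rs) r | inj₂ (ρ₁ , r₁ , refl) with Res-replicate (k ∸ q) r₁
... | ρ₂ , r₂ , refl with shape-Res rs r₂
... | y , y< , eq = y , ≤-trans y< (m⊓n≤m x q) ,
  trans (cong (_% suc k) (sym (+-assoc k ((k ∸ q) * k) ρ₂)))
    (trans (Cong-+ˡ {a = ρ₂} {b = sum qs + y} (suc (k ∸ q) * k) eq) (block-shift (sum qs) y q≤k))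

-- Residues of the cells in the rows of λ̄, relative to S + k l(λ̄); the part x contributes 0, …, x - 1.
stripRel : List ℕ → List ℕ → List ℕ
stripRel (l ∷ ls) (m ∷ μ) = map (λ y → l + suc y + length ls) (upTo (m ∸ l)) ++ stripRel ls μ
stripRel _        _       = []

excess : List ℕ → List ℕ → ℕ
excess (l ∷ ls) (m ∷ μ) = (m ∸ l) + excess ls μ
excess _        _       = 0

length-stripRel : ∀ ls μ → length (stripRel ls μ) ≡ excess ls μ
length-stripRel []       μ       = refl
length-stripRel (l ∷ ls) []      = refl
length-stripRel (l ∷ ls) (m ∷ μ) = trans (length-++ (map (λ y → l + suc y + length ls) (upTo (m ∸ l))))
  (cong₂ _+_ (trans (length-map _ (upTo (m ∸ l))) (length-upTo (m ∸ l))) (length-stripRel ls μ))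

offset : ℕ → List ℕ → List ℕ → ℕ
offset k ls qs = sum qs + k * length ls

offset-∷ : ∀ k l ls qs v → k + (offset k ls qs + v) ≡ offset k (l ∷ ls) qs + v
offset-∷ k l ls qs v = lem k (sum qs) (length ls) v
  where
  lem : ∀ k S L v → k + (S + k * L + v) ≡ S + k * suc L + v
  lem = ℕ-Ring.solve-∀

-- The offset belongs to the top row of λ̄. The present row is `length ls` rows lower, and each step
-- down adds 1 to a residue.
row-Cong : ∀ k l ls qs → Cong k (sum qs + l + k * 1) (offset k (l ∷ ls) qs + (l + length ls))
row-Cong k l ls qs = Cong-intro (length ls) 0 (lem k (sum qs) l (length ls))
  where
  lem : ∀ k S l L → S + l + k * 1 + L * suc k ≡ S + k * suc L + (l + L) + 0
  lem = ℕ-Ring.solve-∀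

cell-Cong : ∀ k l y ls qs → Cong k (sum qs + l + suc y + k * 1) (offset k (l ∷ ls) qs + (l + suc y + length ls))
cell-Cong k l y ls qs = trans (cong (λ a → (a + k * 1) % suc k) (+-assoc (sum qs) l (suc y)))
  (row-Cong k (l + suc y) ls qs)

Low-Res : ∀ {k qs x B μ ls κ v} → Strip B μ ls → Low (sum qs) x μ κ → v ∈ stripRel ls μ ++ upTo x →
  ∃ λ ρ → Res k κ (base k ls qs) ρ × Cong k ρ (offset k ls qs + v)
Low-Res {k} {qs} {x} {v = v} [] ([] hd) v∈ = _ ,
  cell 0 (sum qs + suc v)
    (≤-trans (s≤s (≤-reflexive (trans (shape-head k 0 qs) (+-identityʳ _)))) (≤-trans (≤-reflexive (+-comm 1 (sum qs))) (+-monoʳ-≤ (sum qs) (s≤s z≤n))))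
    (≤-trans (+-monoʳ-≤ (sum qs) (∈-upTo⁻ v∈)) (≤-reflexive (sym hd))) refl ,
  trans (first-row k (sum qs) v) (cong (λ a → (a + v) % suc k) (sym (trans (cong (_+_ (sum qs)) (*-zeroʳ k)) (+-identityʳ _))))
Low-Res {k} {qs} {x} {μ = m ∷ μ} {l ∷ ls} (cons l≤m _ strip) (cons hd low) v∈
  with ∈-++⁻ (stripRel (l ∷ ls) (m ∷ μ)) v∈
... | inj₂ q with Low-Res {k} {qs} strip low (∈-++⁺ʳ (stripRel ls μ) q)
...   | ρ , r , eq = k + ρ , Res-there r , trans (Cong-+ˡ {a = ρ} k eq) (cong (_% suc k) (offset-∷ k l ls qs _))
Low-Res {k} {qs} {x} {μ = m ∷ μ} {l ∷ ls} (cons l≤m _ strip) (cons hd low) v∈ | inj₁ p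
  with ∈-++⁻ (map (λ y → l + suc y + length ls) (upTo (m ∸ l))) p
... | inj₂ q with Low-Res {k} {qs} strip low (∈-++⁺ˡ q)
...   | ρ , r , eq = k + ρ , Res-there r , trans (Cong-+ˡ {a = ρ} k eq) (cong (_% suc k) (offset-∷ k l ls qs _))
Low-Res {k} {qs} {x} {μ = m ∷ μ} {l ∷ ls} (cons l≤m _ strip) (cons hd low) v∈ | inj₁ p | inj₁ q
  with ∈-map⁻ (λ y → l + suc y + length ls) q
... | y , y∈ , refl = _ , Res-here (sum qs + l + suc y)
    (≤-trans (≤-reflexive (+-comm 1 _)) (+-monoʳ-≤ (sum qs + l) (s≤s z≤n)))
    (≤-trans (≤-reflexive (+-assoc (sum qs) l (suc y))) (≤-trans (+-monoʳ-≤ (sum qs) (≤-trans (+-monoʳ-≤ l (∈-upTo⁻ y∈)) (≤-reflexive (m+[n∸m]≡n l≤m)))) hd)) ,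
  cell-Cong k l y ls qs

row-Res : ∀ {k l m qs j} ls → l ≤ m → sum qs + l < j → j ≤ sum qs + m →
  ∃ λ v → v ∈ map (λ y → l + suc y + length ls) (upTo (m ∸ l)) × Cong k (j + k * 1) (offset k (l ∷ ls) qs + v)
row-Res {k} {l} {m} {qs} ls l≤m p q
  with beyond p (≤-trans q (≤-reflexive (trans (cong (_+_ (sum qs)) (sym (m+[n∸m]≡n l≤m))) (sym (+-assoc (sum qs) l _)))))
... | y , y< , refl = _ , ∈-map⁺ (λ y → l + suc y + length ls) (∈-upTo⁺ y<) , cell-Cong k l y ls qs

mid-Res : ∀ {k b x qs B μ ls ρ} → Rects k b qs → Strip B μ ls → Res k (map (_+_ (sum qs)) μ ++ shape k x qs) (base k ls qs) ρ →
  ∃ λ v → v ∈ stripRel ls μ ++ upTo x × Cong k ρ (offset k ls qs + v)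
mid-Res {k} {qs = qs} rs [] r with shape-Res rs r
... | y , y< , eq = y , ∈-upTo⁺ y< , trans eq (cong (λ a → (a + y) % suc k) (sym (trans (cong (_+_ (sum qs)) (*-zeroʳ k)) (+-identityʳ _))))
mid-Res {k} {qs = qs} {μ = m ∷ μ} {l ∷ ls} rs (cons l≤m _ strip) r with Res-uncons r
... | inj₁ (j , p , q , refl) with row-Res {k} {qs = qs} ls l≤m p q
...   | v , v∈ , eq = v , ∈-++⁺ˡ (∈-++⁺ˡ v∈) , eq
mid-Res {k} {x = x} {qs} {μ = m ∷ μ} {l ∷ ls} rs (cons l≤m _ strip) r | inj₂ (ρ , r′ , refl) with mid-Res rs strip r′
... | v , v∈ , eq = v , subst (v ∈_) (sym (++-assoc (map (λ y → l + suc y + length ls) (upTo (m ∸ l))) (stripRel ls μ) (upTo x)))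
    (∈-++⁺ʳ (map (λ y → l + suc y + length ls) (upTo (m ∸ l))) v∈) ,
  trans (Cong-+ˡ {a = ρ} k eq) (cong (_% suc k) (offset-∷ k l ls qs v))

-- The cells of an extended first row give no further residue: they begin at relative residue m +
-- l(μ̄) = k + 1 and wrap around to 0, ..., x - 1.
core∪-Res : ∀ {k b x qs B μ ls ρ} → Rects k b qs → Strip B μ ls → Res k (core∪ k μ x qs) (base k ls qs) ρ →
  ∃ λ v → v ∈ stripRel ls μ ++ upTo x × Cong k ρ (offset k ls qs + v)
core∪-Res rs [] r = mid-Res {μ = []} rs ([] {B = 0}) r
core∪-Res {k} {x = x} {qs} {μ = m ∷ μ} {l ∷ ls} rs (cons l≤m m≤B strip) r with Res-uncons r
... | inj₂ (ρ , r′ , refl) = mid-Res rs (cons l≤m m≤B strip) (Res-there r′)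
... | inj₁ (j , p , q , refl) with j ℕ.≤? sum qs + m | m + length μ ℕ.≟ k
...   | yes j≤ | _ = mid-Res {x = x} {μ = m ∷ μ} rs (cons l≤m m≤B strip) (Res-here j p j≤)
...   | no j≰  | no ¬e = contradiction (≤-trans q (≤-reflexive (trans (cong (_+_ (sum qs + m)) (extension-no μ x ¬e)) (+-identityʳ _)))) j≰
...   | no j≰  | yes e with beyond (≰⇒> j≰) (≤-trans q (≤-reflexive (cong (_+_ (sum qs + m)) (extension-yes μ x e))))
...     | y , y< , refl = y , ∈-++⁺ʳ (stripRel (l ∷ ls) (m ∷ μ)) (∈-upTo⁺ y<) , wrap e
  where
  lem : ∀ k S m L y → S + m + suc y + k * 1 + L * suc k ≡ S + k * suc L + y + (m + L + 1)
  lem = ℕ-Ring.solve-∀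
  wrap : m + length μ ≡ k → Cong k (sum qs + m + suc y + k * 1) (offset k (l ∷ ls) qs + y)
  wrap e = Cong-intro (length ls) 1 (trans (lem k (sum qs) m (length ls) y)
    (cong (_+_ (sum qs + k * suc (length ls) + y)) (trans (cong (λ L → m + L + 1) (sym (Strip-length strip))) (trans (cong (_+ 1) e) (trans (+-comm k 1) (sym (*-identityˡ (suc k))))))))

stripRel-< : ∀ {B μ ls} → Strip B μ ls → All (_< B + length ls) (stripRel ls μ)
stripRel-< strip = All.tabulate (go strip)
  where
  go : ∀ {B μ ls v} → Strip B μ ls → v ∈ stripRel ls μ → v < B + length ls
  go {B} {m ∷ μ} {l ∷ ls} (cons l≤m m≤B strip) v∈ with ∈-++⁻ (map (λ y → l + suc y + length ls) (upTo (m ∸ l))) v∈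
  ... | inj₂ q = ≤-trans (go strip q) (+-mono-≤ (≤-trans l≤m m≤B) (n≤1+n _))
  ... | inj₁ q with ∈-map⁻ (λ y → l + suc y + length ls) q
  ... | y , y∈ , refl = ≤-trans (≤-reflexive (sym (+-suc (l + suc y) (length ls))))
    (+-monoˡ-≤ (suc (length ls)) (≤-trans (≤-trans (+-monoʳ-≤ l (∈-upTo⁻ y∈)) (≤-reflexive (m+[n∸m]≡n l≤m))) m≤B))

stripRel-> : ∀ {B μ ls x} → Strip B μ ls → All (x ≤_) ls → All (x <_) (stripRel ls μ)
stripRel-> strip x≤ = All.tabulate (go strip x≤)
  where
  go : ∀ {B μ ls x v} → Strip B μ ls → All (x ≤_) ls → v ∈ stripRel ls μ → x < v
  go {B} {m ∷ μ} {l ∷ ls} (cons l≤m m≤B strip) (x≤l ∷ x≤) v∈ with ∈-++⁻ (map (λ y → l + suc y + length ls) (upTo (m ∸ l))) v∈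
  ... | inj₂ q = go strip x≤ q
  ... | inj₁ q with ∈-map⁻ (λ y → l + suc y + length ls) q
  ... | y , y∈ , refl = ≤-trans (≤-trans (≤-reflexive (+-comm 1 _)) (+-mono-≤ x≤l (s≤s z≤n))) (m≤m+n (l + suc y) (length ls))

-- With L rows of λ̄ above it, a row yields the interval from l + L + 1 to m + L. By interlacing,
-- the rows above stay below l + L.
stripRel-unique : ∀ {B μ ls} → Strip B μ ls → Unique (stripRel ls μ)
stripRel-unique [] = []
stripRel-unique {μ = m ∷ μ} {l ∷ ls} (cons l≤m m≤B strip) = Uniqueₚ.++⁺
  (Uniqueₚ.map⁺ (λ {y} {z} eq → suc-injective (+-cancelˡ-≡ l _ _ (+-cancelʳ-≡ (length ls) (l + suc y) (l + suc z) eq))) (Uniqueₚ.upTo⁺ (m ∸ l)))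
  (stripRel-unique strip)
  λ { (p , q) → disjoint p q }
  where
  disjoint : ∀ {v} → v ∈ map (λ y → l + suc y + length ls) (upTo (m ∸ l)) → v ∈ stripRel ls μ → ⊥
  disjoint p q with ∈-map⁻ (λ y → l + suc y + length ls) p
  ... | y , _ , refl = contradiction (All.lookup (stripRel-< strip) q) (≤⇒≯ (+-monoˡ-≤ (length ls) (m≤m+n l (suc y))))

rel : List ℕ → List ℕ → ℕ → List ℕ
rel ls μ x = stripRel ls μ ++ upTo x

length-rel : ∀ ls μ x → length (rel ls μ x) ≡ excess ls μ + x
length-rel ls μ x = trans (length-++ (stripRel ls μ)) (cong₂ _+_ (length-stripRel ls μ) (length-upTo x))

rel-unique : ∀ {B μ ls x} → Strip B μ ls → All (x ≤_) ls → Unique (rel ls μ x)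
rel-unique {x = x} strip x≤ = Uniqueₚ.++⁺ (stripRel-unique strip) (Uniqueₚ.upTo⁺ x)
  λ { (p , q) → contradiction (∈-upTo⁻ q) (<-asym (All.lookup (stripRel-> strip x≤) p)) }

rel-< : ∀ {k B μ ls x} → Strip B μ ls → B + length ls ≤ suc k → x ≤ suc k → All (_< suc k) (rel ls μ x)
rel-< {μ = μ} {ls} {x} strip B≤ x≤ = All.tabulate go
  where
  go : ∀ {v} → v ∈ rel ls μ x → v < suc _
  go v∈ with ∈-++⁻ (stripRel ls μ) v∈
  ... | inj₁ p = ≤-trans (All.lookup (stripRel-< strip) p) B≤
  ... | inj₂ p = ≤-trans (∈-upTo⁻ p) x≤

-- Applies to a strip whose core is not yet identified. The relative residues of `rel` are distinct
-- numbers below k + 1, so none of them merge modulo k + 1.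
Low⇒≤-distinct : ∀ {k qs B μ ls x κ} → Strip B μ ls → B + length ls ≤ suc k → All (x ≤_) ls → x ≤ suc k → Low (sum qs) x μ κ →
  excess ls μ + x ≤ distinctCount (skewResidues k κ (base k ls qs))
Low⇒≤-distinct {k} {qs} {B} {μ} {ls} {x} {κ} strip B≤ x≤ x≤k low =
  subst (_≤ distinctCount (skewResidues k κ (base k ls qs)))
    (trans (length-map _ (rel ls μ x)) (length-rel ls μ x))
    (≤-distinctCount (residues-unique (offset k ls qs) (rel-unique strip x≤) (rel-< strip B≤ x≤k)) sub)
  where
  sub : ∀ {z} → z ∈ residues k (offset k ls qs) (rel ls μ x) → z ∈ skewResidues k κ (base k ls qs)
  sub z∈ with ∈-map⁻ (λ v → (offset k ls qs + v) % suc k) z∈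
  ... | v , v∈ , refl with Low-Res {k} {qs} strip low v∈
  ... | ρ , r , eq = subst (_∈ skewResidues k κ (base k ls qs)) eq (∈-skewResidues⁺ {k} {κ} {base k ls qs} r)

core∪-distinct : ∀ {k b qs B μ ls x} → Rects k b qs → Strip B μ ls → B + length ls ≤ suc k → All (x ≤_) ls → x ≤ suc k →
  distinctCount (skewResidues k (core∪ k μ x qs) (base k ls qs)) ≡ excess ls μ + x
core∪-distinct {k} {b} {qs} {B} {μ} {ls} {x} rs strip B≤ x≤ x≤k = ≤-antisym
  (subst (distinctCount (skewResidues k (core∪ k μ x qs) (base k ls qs)) ≤_)
    (trans (length-map _ (rel ls μ x)) (length-rel ls μ x))
    (distinctCount-≤ (skewResidues k (core∪ k μ x qs) (base k ls qs)) sub))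
  (Low⇒≤-distinct {qs = qs} strip B≤ x≤ x≤k (Low-core∪ k μ x qs))
  where
  sub : ∀ {z} → z ∈ skewResidues k (core∪ k μ x qs) (base k ls qs) → z ∈ residues k (offset k ls qs) (rel ls μ x)
  sub z∈ with ∈-skewResidues⁻ {k} {core∪ k μ x qs} {base k ls qs} z∈
  ... | ρ , r , refl with core∪-Res {x = x} rs strip r
  ... | v , v∈ , eq = ∈-residues⁺ {k} {offset k ls qs} {ρ} v∈ eq

-- The first r + 1 new cells of the row have consecutive residues, which differ because r + 1 ≤ k +
-- 1.
long-row-distinct : ∀ {k κ τ r} → r ≤ k → part τ 1 + r < part κ 1 → r < distinctCount (skewResidues k κ τ)
long-row-distinct {k} {κ} {τ} {r} r≤k p = subst (_≤ distinctCount (skewResidues k κ τ))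
    (trans (length-map _ (upTo (suc r))) (length-upTo (suc r)))
    (≤-distinctCount (residues-unique C (Uniqueₚ.upTo⁺ (suc r)) (All.tabulate λ v∈ → ≤-trans (∈-upTo⁻ v∈) (s≤s r≤k))) sub)
  where
  C = suc (part τ 1) + k * 1
  sub : ∀ {z} → z ∈ residues k C (upTo (suc r)) → z ∈ skewResidues k κ τ
  sub z∈ with ∈-map⁻ (λ v → (C + v) % suc k) z∈
  ... | v , v∈ , refl = ∈-skewResidues⁺ {k} {κ} {τ} (cell 0 (suc (part τ 1) + v) (s≤s (m≤m+n _ v))
    (≤-trans (s≤s (+-monoʳ-≤ (part τ 1) (≤-pred (∈-upTo⁻ v∈)))) p) (lem k (part τ 1) v))
    where
    lem : ∀ k t v → suc t + k * 1 + v ≡ suc t + v + k * 1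
    lem = ℕ-Ring.solve-∀

-- Removable corners

-- ρ is the (unreduced) residue of a corner of τ which κ does not block; for a horizontal strip κ/τ
-- an unblocked end of a row of τ is automatically removable.
data Cor (k : ℕ) (κ τ : List ℕ) (ρ : ℕ) : Set where
  corner : ∀ i → part κ (suc (suc i)) < part τ (suc i) → ρ ≡ part τ (suc i) + k * suc i → Cor k κ τ ρ

cornerResidues : ℕ → List ℕ → List ℕ → List ℕ
cornerResidues k κ τ = map (residue k) (filter (λ c → part κ (suc (proj₁ c)) ℕ.<? proj₂ c) (removableCorners τ))

part>0⇒<length : ∀ xs i → 0 < part xs (suc i) → i < length xs
part>0⇒<length (x ∷ xs) zero    p = s≤s z≤n
part>0⇒<length (x ∷ xs) (suc i) p = s≤s (part>0⇒<length xs i p)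

∈-cornerResidues⁻ : ∀ {k κ τ z} → z ∈ cornerResidues k κ τ → ∃ λ ρ → Cor k κ τ ρ × z ≡ ρ % suc k
∈-cornerResidues⁻ {k} {κ} {τ} z∈ with ∈-map⁻ (residue k) z∈
... | c , c∈ , refl with ∈-filter⁻ (λ c → part κ (suc (proj₁ c)) ℕ.<? proj₂ c) {xs = removableCorners τ} c∈
... | c∈′ , p with ∈-applyUpTo⁻ (λ i → (suc i , part τ (suc i)))
       (∈-filter⁻ (λ c → part τ (suc (proj₁ c)) ℕ.<? proj₂ c) {xs = applyUpTo (λ i → (suc i , part τ (suc i))) (length τ)} c∈′ .proj₁)
... | i , _ , refl = _ , corner i p refl , refl

∈-cornerResidues⁺ : ∀ {k κ τ ρ} → HS κ τ → Cor k κ τ ρ → ρ % suc k ∈ cornerResidues k κ τ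
∈-cornerResidues⁺ {k} {κ} {τ} hs (corner i p refl) = ∈-map⁺ (residue k)
  (∈-filter⁺ (λ c → part κ (suc (proj₁ c)) ℕ.<? proj₂ c)
    (∈-filter⁺ (λ c → part τ (suc (proj₁ c)) ℕ.<? proj₂ c)
      (∈-applyUpTo⁺ (λ i → (suc i , part τ (suc i))) (part>0⇒<length τ i (≤-trans (s≤s z≤n) p)))
      (≤-trans (s≤s (HS-≤ hs (suc i))) p)) p)

Cor-here : ∀ {k κ τ x t} → part κ 1 < t → Cor k (x ∷ κ) (t ∷ τ) (t + k * 1)
Cor-here p = corner 0 p refl

Cor-there : ∀ {k κ τ x t ρ} → Cor k κ τ ρ → Cor k (x ∷ κ) (t ∷ τ) (k + ρ)
Cor-there {k} {τ = τ} (corner i p refl) = corner (suc i) p (lem k i (part τ (suc i)))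
  where
  lem : ∀ k i j → k + (j + k * suc i) ≡ j + k * suc (suc i)
  lem = ℕ-Ring.solve-∀

Cor-uncons : ∀ {k κ τ x t ρ} → Cor k (x ∷ κ) (t ∷ τ) ρ →
  (part κ 1 < t × ρ ≡ t + k * 1) ⊎ (∃ λ ρ′ → Cor k κ τ ρ′ × ρ ≡ k + ρ′)
Cor-uncons             (corner zero    p eq)   = inj₁ (p , eq)
Cor-uncons {k} {τ = τ} (corner (suc i) p refl) = inj₂ (_ , corner i p refl , lem k i (part τ (suc i)))
  where
  lem : ∀ k i j → j + k * suc (suc i) ≡ k + (j + k * suc i)
  lem = ℕ-Ring.solve-∀

-- Within a block every row is blocked by the equally long row above it; only the topmost one can
-- end in an unblocked corner.
Cor-block⁻ : ∀ {k S κ τ a ρ} d → Cor k (a ∷ replicate d S ++ κ) (S ∷ replicate d S ++ τ) ρ →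
  (part κ 1 < S × ρ ≡ suc d * k + S) ⊎ (∃ λ ρ′ → Cor k κ τ ρ′ × ρ ≡ suc d * k + ρ′)
Cor-block⁻ {k} {S} zero c with Cor-uncons c
... | inj₁ (p , refl)      = inj₁ (p , lem S k)
  where
  lem : ∀ S k → S + k * 1 ≡ k + 0 + S
  lem = ℕ-Ring.solve-∀
... | inj₂ (ρ′ , c′ , refl) = inj₂ (ρ′ , c′ , cong (_+ ρ′) (sym (+-identityʳ k)))
Cor-block⁻ {k} {S} (suc d) c with Cor-uncons c
... | inj₁ (p , _)          = contradiction p (<-irrefl refl)
... | inj₂ (ρ′ , c′ , refl) with Cor-block⁻ d c′
...   | inj₁ (p , refl)       = inj₁ (p , sym (+-assoc k (suc d * k) S))
...   | inj₂ (ρ″ , c″ , refl) = inj₂ (ρ″ , c″ , sym (+-assoc k (suc d * k) ρ″))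

Cor-block-here : ∀ {k S κ τ a} d → part κ 1 < S → Cor k (a ∷ replicate d S ++ κ) (S ∷ replicate d S ++ τ) (suc d * k + S)
Cor-block-here {k} {S} {κ} {τ} {a} zero p = subst (Cor k (a ∷ κ) (S ∷ τ)) (lem S k) (Cor-here p)
  where
  lem : ∀ S k → S + k * 1 ≡ k + 0 + S
  lem = ℕ-Ring.solve-∀
Cor-block-here {k} {S} {κ} {τ} {a} (suc d) p =
  subst (Cor k (a ∷ replicate (suc d) S ++ κ) (S ∷ replicate (suc d) S ++ τ)) (sym (+-assoc k (suc d * k) S))
    (Cor-there (Cor-block-here d p))

Cor-block-there : ∀ {k S κ τ a ρ} d → Cor k κ τ ρ → Cor k (a ∷ replicate d S ++ κ) (S ∷ replicate d S ++ τ) (suc d * k + ρ)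
Cor-block-there {k} {S} {κ} {τ} {a} {ρ} zero c =
  subst (Cor k (a ∷ κ) (S ∷ τ)) (cong (_+ ρ) (sym (+-identityʳ k))) (Cor-there c)
Cor-block-there {k} {S} {κ} {τ} {a} {ρ} (suc d) c =
  subst (Cor k (a ∷ replicate (suc d) S ++ κ) (S ∷ replicate (suc d) S ++ τ)) (sym (+-assoc k (suc d * k) ρ))
    (Cor-there (Cor-block-there d c))

Rects-All : ∀ {k b qs} → Rects k b qs → All (_≤ b) qs
Rects-All []                 = []
Rects-All (cons _ _ q≤b rs) = q≤b ∷ All.map (λ p → ≤-trans p q≤b) (Rects-All rs)



-- By `block-shift` the top corner of a copy of R_q has relative residue q wherever the copy sits.
-- It is unblocked if the next block has grown by less than q; this growth is the minimum of x and
-- the widths so far, hence the condition x < q.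
shape-Cor⁻ : ∀ {k b x qs ρ} → Rects k b qs → Cor k (shape k x qs) (shape k 0 qs) ρ → ∃ λ q → q ∈ qs × x < q × Cong k ρ (sum qs + q)
shape-Cor⁻ [] (corner zero () _)
shape-Cor⁻ [] (corner (suc i) () _)
shape-Cor⁻ {k} {x = x} {ρ = ρ} (cons {q = q} {qs} _ q≤k _ rs) c with Cor-block⁻ (k ∸ q)
  (subst (λ z → Cor k (q + sum qs + x ∷ replicate (k ∸ q) (q + sum qs) ++ shape k (x ⊓ q) qs) (z ∷ replicate (k ∸ q) (q + sum qs) ++ shape k 0 qs) ρ)
    (+-identityʳ (q + sum qs)) c)
... | inj₁ (p , refl) = q , here refl , x<q ,
    trans (cong (λ z → (suc (k ∸ q) * k + z) % suc k) (+-comm q (sum qs)))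
          (block-shift (sum qs) q q≤k)
  where
  x⊓q<q : x ⊓ q < q
  x⊓q<q = +-cancelˡ-< (sum qs) _ _ (≤-trans (≤-reflexive (cong suc (sym (shape-head k (x ⊓ q) qs)))) (≤-trans p (≤-reflexive (+-comm q _))))
  x<q : x < q
  x<q = ≰⇒> λ q≤x → <-irrefl (m≥n⇒m⊓n≡n q≤x) x⊓q<q
... | inj₂ (ρ′ , c′ , refl) with shape-Cor⁻ rs c′
...   | q′ , q′∈ , lt , eq = q′ , there q′∈ , x<q′ ,
    trans (Cong-+ˡ {a = ρ′} (suc (k ∸ q) * k) eq) (block-shift (sum qs) q′ q≤k)
  where
  x<q′ : x < q′
  x<q′ = ≰⇒> λ q′≤x → <⇒≱ lt (⊓-glb q′≤x (All.lookup (Rects-All rs) q′∈))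

shape-Cor⁺ : ∀ {k b x qs q} → Rects k b qs → q ∈ qs → x < q → ∃ λ ρ → Cor k (shape k x qs) (shape k 0 qs) ρ × Cong k ρ (sum qs + q)
shape-Cor⁺ {k} {x = x} {q = q₁} (cons {q = q} {qs} _ q≤k _ rs) q∈ x<q = lift (go q∈ x<q)
  where
  Target : List ℕ → Set
  Target t = ∃ λ ρ → Cor k (q + sum qs + x ∷ replicate (k ∸ q) (q + sum qs) ++ shape k (x ⊓ q) qs) t ρ × Cong k ρ (q + sum qs + q₁)
  lift : Target (q + sum qs ∷ replicate (k ∸ q) (q + sum qs) ++ shape k 0 qs) →
         Target (q + sum qs + 0 ∷ replicate (k ∸ q) (q + sum qs) ++ shape k 0 qs)
  lift = subst (λ z → Target (z ∷ replicate (k ∸ q) (q + sum qs) ++ shape k 0 qs)) (sym (+-identityʳ (q + sum qs)))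
  go : ∀ {q′} → q′ ∈ q ∷ qs → x < q′ →
    ∃ λ ρ → Cor k (q + sum qs + x ∷ replicate (k ∸ q) (q + sum qs) ++ shape k (x ⊓ q) qs)
                  (q + sum qs ∷ replicate (k ∸ q) (q + sum qs) ++ shape k 0 qs) ρ × Cong k ρ (q + sum qs + q′)
  go (here refl) x<q = _ , Cor-block-here (k ∸ q)
      (≤-trans (s≤s (≤-reflexive (trans (shape-head k (x ⊓ q) qs) (trans (cong (_+_ (sum qs)) (m≤n⇒m⊓n≡m (<⇒≤ x<q))) (+-comm (sum qs) x)))))
        (+-monoˡ-≤ (sum qs) x<q)) ,
    trans (cong (λ z → (suc (k ∸ q) * k + z) % suc k) (+-comm q (sum qs))) (block-shift (sum qs) q q≤k)
  go {q′} (there q′∈) x<q′ with shape-Cor⁺ {k} {x = x ⊓ q} rs q′∈ (≤-trans (s≤s (m⊓n≤m x q)) x<q′)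
  ... | ρ , c , eq = _ , Cor-block-there (k ∸ q) c , trans (Cong-+ˡ {a = ρ} (suc (k ∸ q) * k) eq) (block-shift (sum qs) q′ q≤k)

cornerRel : List ℕ → List ℕ → List ℕ
cornerRel (l ∷ ls) (m ∷ μ) with part μ 1 ℕ.<? l
... | yes _ = l + length ls ∷ cornerRel ls μ
... | no  _ = cornerRel ls μ
cornerRel _        _       = []

∈-cornerRel-here : ∀ {l ls} m μ → part μ 1 < l → l + length ls ∈ cornerRel (l ∷ ls) (m ∷ μ)
∈-cornerRel-here {l} m μ p with part μ 1 ℕ.<? l
... | yes _ = here refl
... | no ¬p = contradiction p ¬p

∈-cornerRel-there : ∀ {l ls v} m μ → v ∈ cornerRel ls μ → v ∈ cornerRel (l ∷ ls) (m ∷ μ)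
∈-cornerRel-there {l} m μ v∈ with part μ 1 ℕ.<? l
... | yes _ = there v∈
... | no _  = v∈

∈-cornerRel⁻ : ∀ {l ls v} m μ → v ∈ cornerRel (l ∷ ls) (m ∷ μ) → (part μ 1 < l × v ≡ l + length ls) ⊎ v ∈ cornerRel ls μ
∈-cornerRel⁻ {l} m μ v∈ with part μ 1 ℕ.<? l
∈-cornerRel⁻ m μ (here eq)  | yes p = inj₁ (p , eq)
∈-cornerRel⁻ m μ (there v∈) | yes _ = inj₂ v∈
∈-cornerRel⁻ m μ v∈         | no _  = inj₂ v∈

next-row⁻ : ∀ {k x l} μ qs → x < l → part (map (_+_ (sum qs)) μ ++ shape k x qs) 1 < sum qs + l → part μ 1 < l
next-row⁻ []      qs x<l p = ≤-trans (s≤s z≤n) x<l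
next-row⁻ (m ∷ μ) qs x<l p = +-cancelˡ-< (sum qs) _ _ p

next-row⁺ : ∀ {k x l} μ qs → x < l → part μ 1 < l → part (map (_+_ (sum qs)) μ ++ shape k x qs) 1 < sum qs + l
next-row⁺ {k} {x} []      qs x<l p = ≤-trans (s≤s (≤-reflexive (shape-head k x qs))) (+-monoʳ-< (sum qs) x<l)
next-row⁺         (m ∷ μ) qs x<l p = +-monoʳ-< (sum qs) p

-- Equal rectangles share the residue of their corners, hence the deduplication of the widths.
corners : List ℕ → List ℕ → ℕ → List ℕ → List ℕ
corners ls μ x qs = cornerRel ls μ ++ deduplicate ℕ._≟_ (filter (x ℕ.<?_) qs)

∈-corners-there : ∀ {l ls m μ x qs v} → v ∈ corners ls μ x qs → v ∈ corners (l ∷ ls) (m ∷ μ) x qs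
∈-corners-there {l} {ls} {m} {μ} v∈ with ∈-++⁻ (cornerRel ls μ) v∈
... | inj₁ p = ∈-++⁺ˡ (∈-cornerRel-there {l} m μ p)
... | inj₂ p = ∈-++⁺ʳ (cornerRel (l ∷ ls) (m ∷ μ)) p

offset-[] : ∀ k qs → offset k [] qs ≡ sum qs
offset-[] k qs = trans (cong (_+_ (sum qs)) (*-zeroʳ k)) (+-identityʳ _)

mid-Cor⁻ : ∀ {k b x qs B μ ls ρ} → Rects k b qs → Strip B μ ls → All (x <_) ls →
  Cor k (map (_+_ (sum qs)) μ ++ shape k x qs) (base k ls qs) ρ → ∃ λ v → v ∈ corners ls μ x qs × Cong k ρ (offset k ls qs + v)
mid-Cor⁻ {k} {x = x} {qs} rs [] _ c with shape-Cor⁻ rs c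
... | q , q∈ , x<q , eq = q , ∈-deduplicate⁺ ℕ._≟_ (∈-filter⁺ (x ℕ.<?_) q∈ x<q) ,
  trans eq (cong (λ a → (a + q) % suc k) (sym (offset-[] k qs)))
mid-Cor⁻ {k} {x = x} {qs} {μ = m ∷ μ} {l ∷ ls} rs (cons _ _ strip) (x<l ∷ x<) c with Cor-uncons c
... | inj₁ (p , refl) = l + length ls , ∈-++⁺ˡ (∈-cornerRel-here m μ (next-row⁻ μ qs x<l p)) , row-Cong k l ls qs
... | inj₂ (ρ , c′ , refl) with mid-Cor⁻ rs strip x< c′
...   | v , v∈ , eq = v , ∈-corners-there {l} {ls} {m} {μ} {x} {qs} v∈ , trans (Cong-+ˡ {a = ρ} k eq) (cong (_% suc k) (offset-∷ k l ls qs v))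

mid-Cor⁺ : ∀ {k b x qs B μ ls v} → Rects k b qs → Strip B μ ls → All (x <_) ls → v ∈ corners ls μ x qs →
  ∃ λ ρ → Cor k (map (_+_ (sum qs)) μ ++ shape k x qs) (base k ls qs) ρ × Cong k ρ (offset k ls qs + v)
mid-Cor⁺ {k} {x = x} {qs} {v = v} rs [] _ v∈ with ∈-filter⁻ (x ℕ.<?_) {xs = qs} (∈-deduplicate⁻ ℕ._≟_ (filter (x ℕ.<?_) qs) v∈)
... | q∈ , x<q with shape-Cor⁺ rs q∈ x<q
... | ρ , c , eq = ρ , c , trans eq (cong (λ a → (a + v) % suc k) (sym (offset-[] k qs)))
mid-Cor⁺ {k} {x = x} {qs} {μ = m ∷ μ} {l ∷ ls} {v} rs (cons _ _ strip) (x<l ∷ x<) v∈ = split (∈-++⁻ (cornerRel (l ∷ ls) (m ∷ μ)) v∈)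
  where
  Goal = ∃ λ ρ → Cor k (map (_+_ (sum qs)) (m ∷ μ) ++ shape k x qs) (base k (l ∷ ls) qs) ρ × Cong k ρ (offset k (l ∷ ls) qs + v)
  rec : v ∈ corners ls μ x qs → Goal
  rec w with mid-Cor⁺ rs strip x< w
  ... | ρ , c , eq = k + ρ , Cor-there c , trans (Cong-+ˡ {a = ρ} k eq) (cong (_% suc k) (offset-∷ k l ls qs v))
  split : v ∈ cornerRel (l ∷ ls) (m ∷ μ) ⊎ v ∈ deduplicate ℕ._≟_ (filter (x ℕ.<?_) qs) → Goal
  split (inj₂ p) = rec (∈-++⁺ʳ (cornerRel ls μ) p)
  split (inj₁ p) with ∈-cornerRel⁻ {l} {ls} m μ p
  ... | inj₂ q          = rec (∈-++⁺ˡ q)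
  ... | inj₁ (q , refl) = _ , Cor-here (next-row⁺ μ qs x<l q) , row-Cong k l ls qs

-- Blocking is tested against the row above, and the first row, the only one that `extension`
-- changes, is above no other.
core∪-tail : ∀ {k μ x} qs {B l ls ρ} → Strip B μ (l ∷ ls) →
  (Cor k (core∪ k μ x qs) (base k (l ∷ ls) qs) ρ → Cor k (map (_+_ (sum qs)) μ ++ shape k x qs) (base k (l ∷ ls) qs) ρ) ×
  (Cor k (map (_+_ (sum qs)) μ ++ shape k x qs) (base k (l ∷ ls) qs) ρ → Cor k (core∪ k μ x qs) (base k (l ∷ ls) qs) ρ)
core∪-tail qs (cons _ _ _) = (λ { (corner i p eq) → corner i p eq }) , (λ { (corner i p eq) → corner i p eq })

core∪-Cor⁻ : ∀ {k b x qs B μ ls ρ} → Rects k b qs → Strip B μ ls → All (x <_) ls →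
  Cor k (core∪ k μ x qs) (base k ls qs) ρ → ∃ λ v → v ∈ corners ls μ x qs × Cong k ρ (offset k ls qs + v)
core∪-Cor⁻ rs []                  x< c = mid-Cor⁻ {μ = []} {ls = []} rs ([] {B = 0}) [] c
core∪-Cor⁻ {qs = qs} rs s@(cons _ _ _) x< c = mid-Cor⁻ rs s x< (proj₁ (core∪-tail qs s) c)

core∪-Cor⁺ : ∀ {k b x qs B μ ls v} → Rects k b qs → Strip B μ ls → All (x <_) ls → v ∈ corners ls μ x qs →
  ∃ λ ρ → Cor k (core∪ k μ x qs) (base k ls qs) ρ × Cong k ρ (offset k ls qs + v)
core∪-Cor⁺ rs []                  x< v∈ = mid-Cor⁺ {μ = []} {ls = []} rs ([] {B = 0}) [] v∈
core∪-Cor⁺ {qs = qs} {μ = m ∷ μ} {l ∷ ls} rs s@(cons _ _ _) x< v∈ with mid-Cor⁺ {μ = m ∷ μ} {l ∷ ls} rs s x< v∈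
... | ρ , c , eq = ρ , proj₂ (core∪-tail qs s) c , eq

cornerRel-< : ∀ {B ls} μ → All (_≤ B) ls → Decr ls → All (_< B + length ls) (cornerRel ls μ)
cornerRel-< μ ls≤ d = All.tabulate (go μ ls≤ d)
  where
  go : ∀ {B ls v} μ → All (_≤ B) ls → Decr ls → v ∈ cornerRel ls μ → v < B + length ls
  go {B} {l ∷ ls} (m ∷ μ) (l≤B ∷ _) d v∈ with ∈-cornerRel⁻ {l} {ls} m μ v∈
  ... | inj₁ (_ , refl) = ≤-trans (≤-reflexive (sym (+-suc l _))) (+-monoˡ-≤ (suc (length ls)) l≤B)
  ... | inj₂ q = ≤-trans (go μ (Decr-All ls d) (Decr-tail ls d) q) (+-mono-≤ l≤B (n≤1+n _))

cornerRel-> : ∀ {b ls} μ → All (b <_) ls → All (b <_) (cornerRel ls μ)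
cornerRel-> μ b< = All.tabulate (go μ b<)
  where
  go : ∀ {b ls v} μ → All (b <_) ls → v ∈ cornerRel ls μ → b < v
  go {b} {l ∷ ls} (m ∷ μ) (b<l ∷ b<) v∈ with ∈-cornerRel⁻ {l} {ls} m μ v∈
  ... | inj₁ (_ , refl) = ≤-trans b<l (m≤m+n l _)
  ... | inj₂ q = go μ b< q

cornerRel-unique : ∀ ls μ → Decr ls → Unique (cornerRel ls μ)
cornerRel-unique []       μ       d = []
cornerRel-unique (l ∷ ls) []      d = []
cornerRel-unique (l ∷ ls) (m ∷ μ) d with part μ 1 ℕ.<? l
... | yes _ = All.map (λ p eq → <-irrefl (sym eq) p) (cornerRel-< μ (Decr-All ls d) (Decr-tail ls d)) ∷
  cornerRel-unique ls μ (Decr-tail ls d)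
... | no _  = cornerRel-unique ls μ (Decr-tail ls d)

-- The bound `b` separates the two lists: corners of λ̄ have relative residues above b, while the
-- widths are at most b. Here the t_i must be smaller than the parts of λ̄.
corners-unique : ∀ {k b x qs} ls μ → Rects k b qs → Decr ls → All (b <_) ls → Unique (corners ls μ x qs)
corners-unique {b = b} {x} {qs} ls μ rs d b< = Uniqueₚ.++⁺ (cornerRel-unique ls μ d) (deduplicate-! ℕ._≟_ _)
  λ { (p , q) → contradiction (All.lookup (Rects-All rs) (∈-filter⁻ (x ℕ.<?_) {xs = qs} (∈-deduplicate⁻ ℕ._≟_ _ q) .proj₁))
        (<⇒≱ (All.lookup (cornerRel-> μ b<) p)) }

Rects-≤k : ∀ {k b qs} → Rects k b qs → All (_≤ k) qs
Rects-≤k []                = []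
Rects-≤k (cons _ q≤k _ rs) = q≤k ∷ Rects-≤k rs

Fits-corner : ∀ {k} ls μ → Fits k ls → Decr ls → All (_< suc k) (cornerRel ls μ)
Fits-corner []       μ fit d = []
Fits-corner (l ∷ ls) μ fit d = All.map (λ p → ≤-trans p (≤-trans (≤-reflexive (+-suc l _)) (s≤s fit)))
  (cornerRel-< μ (≤-refl ∷ Decr-All ls d) d)

corners-< : ∀ {k b x qs} ls μ → Rects k b qs → Fits k ls → Decr ls → All (_< suc k) (corners ls μ x qs)
corners-< {k} {x = x} {qs} ls μ rs fit d = All.tabulate go
  where
  go : ∀ {v} → v ∈ corners ls μ x qs → v < suc k
  go v∈ with ∈-++⁻ (cornerRel ls μ) v∈
  ... | inj₁ p = All.lookup (Fits-corner ls μ fit d) p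
  ... | inj₂ q = s≤s (All.lookup (Rects-≤k rs) (∈-filter⁻ (x ℕ.<?_) {xs = qs} (∈-deduplicate⁻ ℕ._≟_ _ q) .proj₁))

core∪-rLM : ∀ {k b x qs B μ ls} → Rects k b qs → Strip B μ ls → Fits k ls → Decr ls → All (b <_) ls → All (x <_) ls →
  HS (core∪ k μ x qs) (base k ls qs) →
  rLM k (core∪ k μ x qs) (base k ls qs) ≡ length (cornerRel ls μ) + distinctCount (filter (x ℕ.<?_) qs)
core∪-rLM {k} {b} {x} {qs} {B} {μ} {ls} rs strip fit d b< x< hs = trans (≤-antisym upper lower)
  (trans (length-map _ (corners ls μ x qs)) (length-++ (cornerRel ls μ)))
  where
  κ = core∪ k μ x qs
  τ = base k ls qs
  upper : distinctCount (cornerResidues k κ τ) ≤ length (residues k (offset k ls qs) (corners ls μ x qs))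
  upper = distinctCount-≤ (cornerResidues k κ τ) sub
    where
    sub : ∀ {z} → z ∈ cornerResidues k κ τ → z ∈ residues k (offset k ls qs) (corners ls μ x qs)
    sub z∈ with ∈-cornerResidues⁻ {k} {κ} {τ} z∈
    ... | ρ , c , refl with core∪-Cor⁻ rs strip x< c
    ... | v , v∈ , eq = ∈-residues⁺ {k} {offset k ls qs} {ρ} v∈ eq
  lower : length (residues k (offset k ls qs) (corners ls μ x qs)) ≤ distinctCount (cornerResidues k κ τ)
  lower = ≤-distinctCount (residues-unique (offset k ls qs) (corners-unique ls μ rs d b<) (corners-< ls μ rs fit d)) sub
    where
    sub : ∀ {z} → z ∈ residues k (offset k ls qs) (corners ls μ x qs) → z ∈ cornerResidues k κ τ
    sub z∈ with ∈-map⁻ (λ v → (offset k ls qs + v) % suc k) z∈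
    ... | v , v∈ , refl with core∪-Cor⁺ {μ = μ} {ls} rs strip x< v∈
    ... | ρ , c , eq = subst (_∈ cornerResidues k κ τ) eq (∈-cornerResidues⁺ {k} {κ} {τ} hs c)

-- Enumeration of weak strips

prefixes : List ℕ → List (List ℕ) → List (List ℕ)
prefixes xs F = concatMap (λ x → map (x ∷_) F) xs

∈-prefixes⁺ : ∀ {xs F x v} → x ∈ xs → v ∈ F → x ∷ v ∈ prefixes xs F
∈-prefixes⁺ {x ∷ xs} {F} (here refl) v∈ = ∈-++⁺ˡ (∈-map⁺ (x ∷_) v∈)
∈-prefixes⁺ {y ∷ xs} {F} (there x∈)  v∈ = ∈-++⁺ʳ (map (y ∷_) F) (∈-prefixes⁺ x∈ v∈)

∈-prefixes⁻ : ∀ xs F {w} → w ∈ prefixes xs F → ∃₂ λ x v → w ≡ x ∷ v × x ∈ xs × v ∈ F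
∈-prefixes⁻ (x ∷ xs) F w∈ with ∈-++⁻ (map (x ∷_) F) w∈
... | inj₁ p with ∈-map⁻ (x ∷_) p
...   | v , v∈ , eq = x , v , eq , here refl , v∈
∈-prefixes⁻ (x ∷ xs) F w∈ | inj₂ p with ∈-prefixes⁻ xs F p
... | y , v , eq , y∈ , v∈ = y , v , eq , there y∈ , v∈

prefixes-unique : ∀ {xs F} → Unique xs → Unique F → Unique (prefixes xs F)
prefixes-unique {[]}     {F} u        v = []
prefixes-unique {x ∷ xs} {F} (x∉ ∷ u) v = Uniqueₚ.++⁺ (Uniqueₚ.map⁺ ∷-injectiveʳ v) (prefixes-unique u v) λ { (p , q) → disjoint p q }
  where
  disjoint : ∀ {w} → w ∈ map (x ∷_) F → w ∈ prefixes xs F → ⊥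
  disjoint p q with ∈-map⁻ (x ∷_) p | ∈-prefixes⁻ xs F q
  ... | _ , _ , refl | y , _ , eq , y∈ , _ = All.lookup x∉ y∈ (∷-injectiveˡ eq)

interval : ℕ → ℕ → List ℕ
interval lo hi = map (λ y → lo + y) (upTo (suc hi ∸ lo))

interval-unique : ∀ lo hi → Unique (interval lo hi)
interval-unique lo hi = Uniqueₚ.map⁺ (λ {y} {z} → +-cancelˡ-≡ lo y z) (Uniqueₚ.upTo⁺ (suc hi ∸ lo))

∈-interval⁺ : ∀ {lo hi x} → lo ≤ x → x ≤ hi → x ∈ interval lo hi
∈-interval⁺ {lo} {hi} p q with m≤n⇒∃[o]m+o≡n p
... | y , refl = ∈-map⁺ (λ y → lo + y) (∈-upTo⁺ (m+n≤o⇒m≤o∸n (suc y) (s≤s (≤-trans (≤-reflexive (+-comm y lo)) q))))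

∈-interval⁻ : ∀ {lo hi x} → x ∈ interval lo hi → lo ≤ x × x ≤ hi
∈-interval⁻ {lo} {hi} x∈ with ∈-map⁻ (λ y → lo + y) x∈
... | y , y∈ , refl = m≤m+n lo y , ≤-pred (≤-trans (≤-reflexive (cong suc (+-comm lo y)))
  (≤-trans (+-monoˡ-≤ lo (∈-upTo⁻ y∈)) (≤-reflexive (m∸n+n≡m (<⇒≤ (m<n∸m′ (∈-upTo⁻ y∈)))))))
  where
  m<n∸m′ : y < suc hi ∸ lo → lo < suc hi
  m<n∸m′ p = m∸n≢0⇒n<m λ e → contradiction (≤-trans p (≤-reflexive e)) λ ()

strips : ℕ → List ℕ → List (List ℕ)
strips B []       = [] ∷ []
strips B (l ∷ ls) = prefixes (interval l B) (strips l ls)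

strips-unique : ∀ B ls → Unique (strips B ls)
strips-unique B []       = [] ∷ []
strips-unique B (l ∷ ls) = prefixes-unique (interval-unique l B) (strips-unique l ls)

∈-strips⁺ : ∀ {B μ ls} → Strip B μ ls → μ ∈ strips B ls
∈-strips⁺ []           = here refl
∈-strips⁺ (cons p q s) = ∈-prefixes⁺ (∈-interval⁺ p q) (∈-strips⁺ s)

∈-strips⁻ : ∀ {B μ} ls → μ ∈ strips B ls → Strip B μ ls
∈-strips⁻ []       (here refl) = []
∈-strips⁻ {B} (l ∷ ls) μ∈ with ∈-prefixes⁻ (interval l B) (strips l ls) μ∈
... | m , v , refl , m∈ , v∈ = cons (proj₁ (∈-interval⁻ m∈)) (proj₂ (∈-interval⁻ {l} m∈)) (∈-strips⁻ ls v∈)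

candList-unique : ∀ los U → Unique (candList los U)
candList-unique []         U = [] ∷ []
candList-unique (lo ∷ los) U = prefixes-unique (interval-unique lo U) (candList-unique los U)

nonzero : List ℕ → List ℕ
nonzero = filter (λ x → 1 ℕ.≤? x)

nonzero-∷ : ∀ {x xs} → 1 ≤ x → nonzero (x ∷ xs) ≡ x ∷ nonzero xs
nonzero-∷ {x} p = filter-accept (λ x → 1 ℕ.≤? x) p

-- Only the last entry of a candidate can be 0, since the others are bounded below by parts of τ;
-- dropping zeros thus merges no two candidates.
nonzero-injective : ∀ {τ U v w} → All (1 ≤_) τ → v ∈ candList (τ ++ 0 ∷ []) U → w ∈ candList (τ ++ 0 ∷ []) U →
  nonzero v ≡ nonzero w → v ≡ w
nonzero-injective {[]} {U} [] v∈ w∈ eq with ∈-prefixes⁻ (interval 0 U) ([] ∷ []) v∈ | ∈-prefixes⁻ (interval 0 U) ([] ∷ []) w∈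
... | zero  , _ , refl , _ , here refl | zero  , _ , refl , _ , here refl = refl
... | suc x , _ , refl , _ , here refl | suc y , _ , refl , _ , here refl = eq
... | zero  , _ , refl , _ , here refl | suc y , _ , refl , _ , here refl = contradiction eq λ ()
... | suc x , _ , refl , _ , here refl | zero  , _ , refl , _ , here refl = contradiction eq λ ()
nonzero-injective {t ∷ τ} {U} (1≤t ∷ pos) v∈ w∈ eq
  with ∈-prefixes⁻ (interval t U) (candList (τ ++ 0 ∷ []) U) v∈ | ∈-prefixes⁻ (interval t U) (candList (τ ++ 0 ∷ []) U) w∈
... | x , v′ , refl , x∈ , v′∈ | y , w′ , refl , y∈ , w′∈ = cong₂ _∷_ (∷-injectiveˡ eq′) (nonzero-injective pos v′∈ w′∈ (∷-injectiveʳ eq′))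
  where
  eq′ : x ∷ nonzero v′ ≡ y ∷ nonzero w′
  eq′ = trans (sym (nonzero-∷ (≤-trans 1≤t (proj₁ (∈-interval⁻ x∈))))) (trans eq (nonzero-∷ (≤-trans 1≤t (proj₁ (∈-interval⁻ y∈)))))

∈-candidates : ∀ {κ τ U} → HS κ τ → All (1 ≤_) κ → All (_≤ U) κ → κ ∈ map nonzero (candList (τ ++ 0 ∷ []) U)
∈-candidates {κ} {τ} {U} hs pos ≤U with go hs pos ≤U
  where
  go : ∀ {κ τ} → HS κ τ → All (1 ≤_) κ → All (_≤ U) κ → ∃ λ w → w ∈ candList (τ ++ 0 ∷ []) U × nonzero w ≡ κ
  go []            _         _         = 0 ∷ [] , ∈-prefixes⁺ {interval 0 U} {[] ∷ []} (∈-interval⁺ z≤n z≤n) (here refl) , refl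
  go (top {x})     (p ∷ _)   (q ∷ _)   = x ∷ [] , ∈-prefixes⁺ {interval 0 U} {[] ∷ []} (∈-interval⁺ z≤n q) (here refl) , nonzero-∷ p
  go (cons {x} t≤x _ hs) (p ∷ ps) (q ∷ qs) with go hs ps qs
  ... | w , w∈ , eq = x ∷ w , ∈-prefixes⁺ (∈-interval⁺ t≤x q) w∈ , trans (nonzero-∷ p) (cong (x ∷_) eq)
... | w , w∈ , refl = ∈-map⁺ nonzero w∈

map-unique : ∀ {A B : Set} {f : A → B} {xs} → (∀ {x y} → x ∈ xs → y ∈ xs → f x ≡ f y → x ≡ y) → Unique xs → Unique (map f xs)
map-unique inj [] = []
map-unique {f = f} {x ∷ xs} inj (x∉ ∷ u) =
  All.tabulate (λ y∈ eq → clash y∈ eq) ∷ map-unique (λ p q → inj (there p) (there q)) u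
  where
  clash : ∀ {y} → y ∈ map f xs → f x ≡ y → ⊥
  clash y∈ eq with ∈-map⁻ f y∈
  ... | z , z∈ , refl = All.lookup x∉ z∈ (inj (here refl) (there z∈) eq)

isStrip : ℕ → List ℕ → ℕ → List ℕ → Bool
isStrip k τ s κ = isPartitionᵇ κ ∧ isCoreᵇ k κ ∧ weakStripᵇ k κ τ s

weakStrips-unique : ∀ k {τ} s → All (1 ≤_) τ → Unique (weakStrips k τ s)
weakStrips-unique k {τ} s pos = Uniqueₚ.filter⁺ (λ κ → T? (isStrip k τ s κ))
  (map-unique (nonzero-injective pos) (candList-unique (τ ++ 0 ∷ []) (part τ 1 + k)))

isHStrip⇒HS : ∀ {κ τ} → All (1 ≤_) κ → All (1 ≤_) τ → T (isHStripᵇ κ τ) → HS κ τ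
isHStrip⇒HS {κ} {τ} p q h = HS-intro p q λ i i< →
  let t = All.lookup (Allₚ.all⁺ (λ i → (part τ i ≤ᵇ part κ i) ∧ (part κ (suc i) ≤ᵇ part τ i)) (applyUpTo suc (length κ + length τ)) h) (∈-applyUpTo⁺ suc i<)
  in ≤ᵇ⇒≤ _ _ (proj₁ (T-∧⁻ t)) , ≤ᵇ⇒≤ _ _ (proj₂ (T-∧⁻ {part τ (suc i) ≤ᵇ part κ (suc i)} t))

HS⇒isHStrip : ∀ {κ τ} → HS κ τ → T (isHStripᵇ κ τ)
HS⇒isHStrip {κ} {τ} hs = Allₚ.all⁻ _ (All.tabulate go)
  where
  go : ∀ {i} → i ∈ applyUpTo suc (length κ + length τ) → T ((part τ i ≤ᵇ part κ i) ∧ (part κ (suc i) ≤ᵇ part τ i))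
  go i∈ with ∈-applyUpTo⁻ suc i∈
  ... | i , _ , refl = T-∧⁺ (≤⇒≤ᵇ (HS-≤ hs i)) (≤⇒≤ᵇ (HS-≥ hs i))

sum-strip : ∀ {B μ ls} → Strip B μ ls → sum μ ≡ sum ls + excess ls μ
sum-strip [] = refl
sum-strip {μ = m ∷ μ} {l ∷ ls} (cons l≤m _ s) = trans (cong₂ _+_ (sym (m+[n∸m]≡n l≤m)) (sum-strip s)) (lem l (m ∸ l) (sum ls) _)
  where
  lem : ∀ a b c d → a + b + (c + d) ≡ a + c + (b + d)
  lem = ℕ-Ring.solve-∀

-- In a horizontal strip the row of length S + x above λ̄ cannot exceed the last row S + l of λ̄ in
-- the base.
Low-≥ : ∀ {k qs x B μ ls κ} → Strip B μ ls → Low (sum qs) x μ κ → HS κ (base k ls qs) → All (x ≤_) ls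
Low-≥ [] _ _ = []
Low-≥ {qs = qs} (cons _ _ []) (cons _ ([] hd)) (cons _ p hs) = +-cancelˡ-≤ (sum qs) _ _ (≤-trans (≤-reflexive (sym hd)) p) ∷ []
Low-≥ {k} {qs} (cons _ _ s@(cons l≤m _ _)) (cons _ low@(cons hd _)) (cons _ p hs) with Low-≥ {k} {qs} s low hs
... | x≤l ∷ x≤ = ≤-trans x≤l (≤-trans l≤m (+-cancelˡ-≤ (sum qs) _ _ (≤-trans hd p))) ∷ x≤l ∷ x≤

width : ℕ → List ℕ → ℕ
width k ls = suc k ∸ length ls

Fits-length : ∀ {k} ls → Fits k ls → length ls ≤ suc k
Fits-length []       fit = z≤n
Fits-length (l ∷ ls) fit = s≤s (≤-trans (m≤n+m (length ls) l) fit)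

width+length : ∀ {k} ls → Fits k ls → width k ls + length ls ≡ suc k
width+length ls fit = m∸n+n≡m (Fits-length ls fit)

Strip-refl : ∀ {B} ls → Decr ls → part ls 1 ≤ B → Strip B ls ls
Strip-refl []       d p = []
Strip-refl (l ∷ ls) d p = cons ≤-refl p (Strip-refl ls (Decr-tail ls d) (Decr-head ls d))

Strip-self : ∀ {k} ls → Decr ls → Fits k ls → Strip (width k ls) ls ls
Strip-self []       d fit = []
Strip-self (l ∷ ls) d fit = Strip-refl (l ∷ ls) d (m+n≤o⇒m≤o∸n l fit)

core∪-base : ∀ k ls qs → core∪ k ls 0 qs ≡ base k ls qs
core∪-base k []       qs = refl
core∪-base k (l ∷ ls) qs = cong (_∷ map (_+_ (sum qs)) ls ++ shape k 0 qs) (trans (cong (_+_ (sum qs + l)) ext) (+-identityʳ _))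
  where
  ext : extension k l ls 0 ≡ 0
  ext with l + length ls ≡ᵇ k
  ... | true  = refl
  ... | false = refl

base-CoreOf : ∀ {k b qs ls} → Rects k b qs → Fits k ls → Decr ls → All (b <_) ls → CoreOf k (base k ls qs) (ls ++ parts k 0 qs)
base-CoreOf {k} {b} {qs} {ls} rs fit d b< = subst (λ τ → CoreOf k τ (ls ++ parts k 0 qs)) (core∪-base k ls qs)
  (proj₁ (core∪-reverse rs (Strip-self ls d fit) fit b< (All.map (λ _ → z≤n) b<) z≤n))

++-cancel-length : ∀ {A : Set} (xs : List A) {ys as bs} → length xs ≡ length ys → xs ++ as ≡ ys ++ bs → xs ≡ ys
++-cancel-length []       {[]}     p eq = refl
++-cancel-length (x ∷ xs) {y ∷ ys} p eq = cong₂ _∷_ (∷-injectiveˡ eq) (++-cancel-length xs (suc-injective p) (∷-injectiveʳ eq))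

core∪-row≤ : ∀ {k qs B μ ls x} → Strip B μ ls → B ≤ k → All (x ≤_) ls → x ≤ k → part (core∪ k μ x qs) 1 ≤ part (base k ls qs) 1 + k
core∪-row≤ {k} {qs} {x = x} [] B≤k _ x≤k = ≤-trans (≤-reflexive (shape-head k x qs))
  (+-mono-≤ (≤-reflexive (sym (trans (shape-head k 0 qs) (+-identityʳ _)))) x≤k)
core∪-row≤ {k} {qs} {B} {m ∷ μ} {l ∷ ls} {x} (cons l≤m m≤B s) B≤k (x≤l ∷ _) x≤k = ≤-trans
  (≤-reflexive (+-assoc (sum qs) m _))
  (≤-trans (+-monoʳ-≤ (sum qs) (≤-trans (+-mono-≤ (≤-trans m≤B B≤k) (≤-trans ext≤ x≤l)) (≤-reflexive (+-comm k l)))) (≤-reflexive (sym (+-assoc (sum qs) l k))))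
  where
  ext≤ : extension k m μ x ≤ x
  ext≤ with m + length μ ≡ᵇ k
  ... | true  = ≤-refl
  ... | false = z≤n

stripsUpTo : ℕ → ℕ → List ℕ → List (List ℕ)
stripsUpTo k s ls = filter (λ μ → excess ls μ ℕ.≤? s) (strips (width k ls) ls)

stripCore : ℕ → List ℕ → List ℕ → ℕ → List ℕ → List ℕ
stripCore k ls qs s μ = core∪ k μ (s ∸ excess ls μ) qs

-- With e = |μ/λ̄|, counting residues gives e + x ≤ s and comparing sizes gives s ≤ e + x. So the
-- size estimate is sharp, and its equality case `exact` determines κ.
weakStrips-forward : ∀ {k b qs ls r s κ} → Rects k b qs → Fits k ls → Decr ls → All (b <_) ls → r ≤ k → All (r ≤_) ls → s ≤ r →
  κ ∈ weakStrips k (base k ls qs) s → κ ∈ map (stripCore k ls qs s) (stripsUpTo k s ls)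
weakStrips-forward {k} {b} {qs} {ls} {r} {s} {κ} rs fit d b< r≤k r≤ s≤r κ∈
  with proj₂ (∈-filter⁻ (λ κ → T? (isStrip k (base k ls qs) s κ)) {xs = candidates k (base k ls qs)} κ∈)
... | t with T-∧⁻ {isPartitionᵇ κ} t
... | tp , t′ with T-∧⁻ {isCoreᵇ k κ} t′
... | tc , t″ with T-∧⁻ {isHStripᵇ κ (base k ls qs)} t″
... | th , t‴ with T-∧⁻ {sizeK k κ ≡ᵇ sizeK k (base k ls qs) + s} t‴
... | tsz , td with core⇒CoreOf {k} {κ} tp tc
... | ν , core = result (core∪-forward rs fit b< r≤ row≤ core hs)
  where
  τ = base k ls qs
  τcore = base-CoreOf rs fit d b<
  hs : HS κ τ
  hs = isHStrip⇒HS (CoreOf-pos core) (CoreOf-pos τcore) th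
  dist : distinctCount (skewResidues k κ τ) ≡ s
  dist = ≡ᵇ⇒≡ _ _ td
  size : sum ν ≡ sum (ls ++ parts k 0 qs) + s
  size = trans (sym (CoreOf-sizeK core)) (trans (≡ᵇ⇒≡ _ _ tsz) (cong (_+ s) (CoreOf-sizeK τcore)))
  row≤ : ∀ {l ls′} → ls ≡ l ∷ ls′ → part κ 1 ≤ sum qs + l + r
  row≤ {l} {ls′} refl = ≮⇒≥ λ p → <⇒≱ (long-row-distinct {k} {κ} {τ} r≤k p) (≤-trans (≤-reflexive dist) s≤r)
  result : (∃₂ λ μ x → ∃ λ νw → Strip (width k ls) μ ls × ν ≡ μ ++ νw × x ≤ k × sum νw ≤ sum (parts k 0 qs) + x ×
    (sum (parts k 0 qs) + x ≤ sum νw → κ ≡ core∪ k μ x qs) × Low (sum qs) x μ κ) → κ ∈ map (stripCore k ls qs s) (stripsUpTo k s ls)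
  result (μ , x , νw , strip , refl , x≤k , le , exact , low) =
    subst (_∈ map (stripCore k ls qs s) (stripsUpTo k s ls)) κ≡
      (∈-map⁺ (stripCore k ls qs s) (∈-filter⁺ (λ μ → excess ls μ ℕ.≤? s) (∈-strips⁺ strip) (≤-trans (m≤m+n e x) e+x≤s)))
    where
    e = excess ls μ
    p = sum (parts k 0 qs)
    e+x≤s : e + x ≤ s
    e+x≤s = ≤-trans (Low⇒≤-distinct {k} {qs} strip (≤-reflexive (width+length ls fit)) (Low-≥ {k} {qs} strip low hs) (m≤n⇒m≤1+n x≤k) low) (≤-reflexive dist)
    lem₁ : ∀ a e w → a + e + w ≡ a + (e + w)
    lem₁ = ℕ-Ring.solve-∀
    lem₂ : ∀ e p x → e + (p + x) ≡ p + (e + x)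
    lem₂ = ℕ-Ring.solve-∀
    balance : e + sum νw ≡ p + s
    balance = +-cancelˡ-≡ (sum ls) _ _ (begin
      sum ls + (e + sum νw)        ≡⟨ sym (lem₁ (sum ls) e (sum νw)) ⟩
      sum ls + e + sum νw          ≡⟨ cong (_+ sum νw) (sym (sum-strip strip)) ⟩
      sum μ + sum νw               ≡⟨ sym (sum-++ μ νw) ⟩
      sum (μ ++ νw)                ≡⟨ size ⟩
      sum (ls ++ parts k 0 qs) + s ≡⟨ cong (_+ s) (sum-++ ls (parts k 0 qs)) ⟩
      sum ls + p + s               ≡⟨ lem₁ (sum ls) p s ⟩
      sum ls + (p + s)             ∎)
    s≤e+x : s ≤ e + x
    s≤e+x = +-cancelˡ-≤ p _ _ (≤-trans (≤-reflexive (sym balance)) (≤-trans (+-monoʳ-≤ e le) (≤-reflexive (lem₂ e p x))))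
    κ≡ : stripCore k ls qs s μ ≡ κ
    κ≡ = trans (cong (λ y → core∪ k μ y qs) (trans (cong (_∸ e) (≤-antisym s≤e+x e+x≤s)) (m+n∸m≡n e x)))
      (sym (exact (+-cancelˡ-≤ e _ _ (≤-trans (≤-reflexive (lem₂ e p x)) (≤-trans (+-monoʳ-≤ p e+x≤s) (≤-reflexive (sym balance)))))))

strip-x≤ : ∀ {ls μ r s} → s ≤ r → All (r ≤_) ls → All (s ∸ excess ls μ ≤_) ls
strip-x≤ {ls} {μ} {s = s} s≤r = All.map (λ p → ≤-trans (m∸n≤m s (excess ls μ)) (≤-trans s≤r p))

stripCore-CoreOf : ∀ {k b qs ls r s μ} → Rects k b qs → Fits k ls → All (b <_) ls → r ≤ k → All (r ≤_) ls → s ≤ r → Strip (width k ls) μ ls →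
  CoreOf k (stripCore k ls qs s μ) (μ ++ parts k (s ∸ excess ls μ) qs) × HS (stripCore k ls qs s μ) (base k ls qs)
stripCore-CoreOf {ls = ls} {s = s} {μ} rs fit b< r≤k r≤ s≤r strip =
  core∪-reverse rs strip fit b< (strip-x≤ {ls} {μ} s≤r r≤) (≤-trans (m∸n≤m s (excess ls μ)) (≤-trans s≤r r≤k))

-- For empty λ̄ the width is k + 1, one more than `core∪-row≤` admits; there the bound 0 serves as
-- well.
width≤k : ∀ {k μ ls} → Strip (width k ls) μ ls → (∃ λ B → B ≤ k × Strip B μ ls)
width≤k []                                    = 0 , z≤n , []
width≤k {k} {ls = l ∷ ls} (cons l≤m m≤B s) = k ∸ length ls , m∸n≤m k (length ls) , cons l≤m m≤B s

weakStrips-reverse : ∀ {k b qs ls r s κ} → Rects k b qs → Fits k ls → Decr ls → All (b <_) ls → r ≤ k → All (r ≤_) ls → s ≤ r →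
  κ ∈ map (stripCore k ls qs s) (stripsUpTo k s ls) → κ ∈ weakStrips k (base k ls qs) s
weakStrips-reverse {k} {b} {qs} {ls} {r} {s} rs fit d b< r≤k r≤ s≤r κ∈ with ∈-map⁻ (stripCore k ls qs s) κ∈
... | μ , μ∈ , refl with ∈-filter⁻ (λ μ → excess ls μ ℕ.≤? s) {xs = strips (width k ls) ls} μ∈
... | μ∈′ , e≤s = ∈-filter⁺ (λ κ → T? (isStrip k τ s κ))
      (∈-candidates hs (CoreOf-pos core) (All-≤ (CoreOf-Decr core) (core∪-row≤ {qs = qs} (proj₂ (proj₂ (width≤k strip))) (proj₁ (proj₂ (width≤k strip))) x≤ x≤k)))
      (T-∧⁺ (CoreOf⇒isPartition core) (T-∧⁺ (CoreOf⇒isCore core) (T-∧⁺ (HS⇒isHStrip hs) (T-∧⁺ (≡⇒≡ᵇ _ _ size) (≡⇒≡ᵇ _ _ dist)))))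
  where
  τ = base k ls qs
  τcore = base-CoreOf rs fit d b<
  strip = ∈-strips⁻ ls μ∈′
  e = excess ls μ
  x = s ∸ e
  p = sum (parts k 0 qs)
  κ = core∪ k μ x qs
  both = stripCore-CoreOf rs fit b< r≤k r≤ s≤r strip
  core = proj₁ both
  hs = proj₂ both
  x≤ = strip-x≤ {ls} {μ} s≤r r≤
  x≤k : x ≤ k
  x≤k = ≤-trans (m∸n≤m s e) (≤-trans s≤r r≤k)
  All-≤ : ∀ {κ U} → Decr κ → part κ 1 ≤ U → All (_≤ U) κ
  All-≤ {[]}     d p = []
  All-≤ {y ∷ ys} d p = p ∷ All.map (λ q → ≤-trans q p) (Decr-All ys d)
  dist : distinctCount (skewResidues k κ τ) ≡ s
  dist = trans (core∪-distinct rs strip (≤-reflexive (width+length ls fit)) x≤ (m≤n⇒m≤1+n x≤k)) (m+[n∸m]≡n e≤s)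
  lem : ∀ a e p x → a + e + (p + x) ≡ a + p + (e + x)
  lem = ℕ-Ring.solve-∀
  size : sizeK k κ ≡ sizeK k τ + s
  size = begin
    sizeK k κ                        ≡⟨ CoreOf-sizeK core ⟩
    sum (μ ++ parts k x qs)          ≡⟨ sum-++ μ (parts k x qs) ⟩
    sum μ + sum (parts k x qs)       ≡⟨ cong₂ _+_ (sum-strip strip) (sum-parts k x qs) ⟩
    sum ls + e + (p + x)             ≡⟨ lem (sum ls) e p x ⟩
    sum ls + p + (e + x)             ≡⟨ cong₂ _+_ (sym (sum-++ ls (parts k 0 qs))) (m+[n∸m]≡n e≤s) ⟩
    sum (ls ++ parts k 0 qs) + s     ≡⟨ cong (_+ s) (sym (CoreOf-sizeK τcore)) ⟩
    sizeK k τ + s                    ∎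

weakStrips-sum : ∀ {k b qs ls r s} → Rects k b qs → Fits k ls → Decr ls → All (b <_) ls → r ≤ k → All (r ≤_) ls → s ≤ r →
  (f : List ℕ → ℤ) →
  sumℤ (map f (weakStrips k (base k ls qs) s)) ≡ sumℤ (map (λ μ → f (stripCore k ls qs s μ)) (stripsUpTo k s ls))
weakStrips-sum {k} {b} {qs} {ls} {r} {s} rs fit d b< r≤k r≤ s≤r f = trans
  (sumℤ-unique f (weakStrips-unique k s (CoreOf-pos (base-CoreOf rs fit d b<)))
    (map-unique inj (Uniqueₚ.filter⁺ (λ μ → excess ls μ ℕ.≤? s) (strips-unique (width k ls) ls)))
    (weakStrips-forward rs fit d b< r≤k r≤ s≤r) (weakStrips-reverse rs fit d b< r≤k r≤ s≤r))
  (cong sumℤ (sym (map-∘ (stripsUpTo k s ls))))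
  where
  strip∈ : ∀ {μ} → μ ∈ stripsUpTo k s ls → Strip (width k ls) μ ls
  strip∈ μ∈ = ∈-strips⁻ ls (proj₁ (∈-filter⁻ (λ μ → excess ls μ ℕ.≤? s) {xs = strips (width k ls) ls} μ∈))
  -- μ is the initial segment of 𝔭 of the core, and its length is that of λ̄.
  inj : ∀ {μ μ′} → μ ∈ stripsUpTo k s ls → μ′ ∈ stripsUpTo k s ls → stripCore k ls qs s μ ≡ stripCore k ls qs s μ′ → μ ≡ μ′
  inj {μ} {μ′} p q eq = ++-cancel-length μ (trans (Strip-length (strip∈ p)) (sym (Strip-length (strip∈ q))))
    (CoreOf-functional (proj₁ (stripCore-CoreOf rs fit b< r≤k r≤ s≤r (strip∈ p)))
      (subst (λ κ → CoreOf k κ (μ′ ++ parts k (s ∸ excess ls μ′) qs)) (sym eq) (proj₁ (stripCore-CoreOf rs fit b< r≤k r≤ s≤r (strip∈ q)))))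

-- The Pieri rule over λ̄ ∪ P

above : List ℕ → ℕ → ℕ
above qs x = distinctCount (filter (x ℕ.<?_) qs)

Good : ℕ → ℕ → List ℕ → Set
Good k b ls = Fits k ls × Decr ls × All (b <_) ls

-- For s < r the new part is smaller than every part of λ̄, as the corner count requires. For s = r
-- it may equal the last part, but then the lower index is 0 and the coefficient is 1 for any count.
strip-coefficient : ∀ {k b qs ls μ r s} → Rects k b qs → Good k b ls → r ≤ k → All (r ≤_) ls → s ≤ r →
  Strip (width k ls) μ ls →
  sgn (r ∸ s) ℤ.* binom (+ rLM k (stripCore k ls qs s μ) (base k ls qs)) (r ∸ s) ≡
  sbin (length (cornerRel ls μ) + above qs (s ∸ excess ls μ)) (r ∸ s)
strip-coefficient {k} {b} {qs} {ls} {μ} {r} {s} rs (fit , d , b<) r≤k r≤ s≤r strip with m≤n⇒m<n∨m≡n s≤r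
... | inj₁ s<r = trans (sgn-binom _ (r ∸ s)) (cong (λ a → sbin a (r ∸ s))
    (core∪-rLM rs strip fit d b< (All.map (λ p → ≤-trans (s≤s (m∸n≤m s (excess ls μ))) (≤-trans s<r p)) r≤)
      (proj₂ (stripCore-CoreOf rs fit b< r≤k r≤ s≤r strip))))
... | inj₂ refl = trans (sgn-binom _ (r ∸ r))
    (trans (constant (rLM k (stripCore k ls qs r μ) (base k ls qs)))
           (sym (constant (length (cornerRel ls μ) + above qs (r ∸ excess ls μ)))))
  where
  constant : ∀ a → sbin a (r ∸ r) ≡ + 1
  constant a = trans (cong (sbin a) (n∸n≡0 r)) (sbin-zero a)

-- The contribution of one μ after the sums over s and μ are exchanged: e cells lie in the rows of
-- λ̄, and the new part x ranges up to r - e.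
guard : ℕ → ℕ → (ℕ → ℤ) → ℤ
guard e r h = if does (e ℕ.≤? r) then Σ≤ (r ∸ e) h else + 0

guard-cong : ∀ e r {h h′ : ℕ → ℤ} → (e ≤ r → ∀ x → x ≤ r ∸ e → h x ≡ h′ x) → guard e r h ≡ guard e r h′
guard-cong e r eq with e ≤ᵇ r in p
... | true  = Σ≤-cong (r ∸ e) (eq (≤ᵇ-true p))
... | false = refl

pieri : ∀ {k g b qs ls r} → IsKkSchur k g → Rects k b qs → Good k b ls → r ≤ k → All (r ≤_) ls → ∀ e →
  (hS k r *S g (ls ++ parts k 0 qs)) e ≡
  sumℤ (map (λ μ → guard (excess ls μ) r (λ x →
    sbin (length (cornerRel ls μ) + above qs x) (r ∸ excess ls μ ∸ x) ℤ.* g (μ ++ parts k x qs) e)) (strips (width k ls) ls))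
pieri {k} {g} {b} {qs} {ls} {r} isg rs good@(fit , d , b<) r≤k r≤ e = begin
  (hS k r *S g (ls ++ parts k 0 qs)) e
    ≡⟨ cong (λ ν → (hS k r *S g ν) e) (sym (CoreOf-pmap τcore)) ⟩
  (hS k r *S g (pmap k τ)) e
    ≡⟨ proj₂ (proj₂ isg) τ (T-∧⁺ (CoreOf⇒isPartition τcore) (CoreOf⇒isCore τcore)) r r≤k e ⟩
  sumS (map (λ s → sumS (map (term s) (weakStrips k τ s))) (upTo (suc r))) e
    ≡⟨ sumS-eval (λ s → sumS (map (term s) (weakStrips k τ s))) (upTo (suc r)) e ⟩
  sumℤ (map (λ s → sumS (map (term s) (weakStrips k τ s)) e) (upTo (suc r)))
    ≡⟨ sumℤ-upTo r (λ s → sumS (map (term s) (weakStrips k τ s)) e) ⟩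
  Σ≤ r (λ s → sumS (map (term s) (weakStrips k τ s)) e)
    ≡⟨ Σ≤-cong r inner ⟩
  Σ≤ r (λ s → sumℤ (map (λ μ → if does (excess ls μ ℕ.≤? s) then F μ s else + 0) (strips (width k ls) ls)))
    ≡⟨ sym (sumℤ-Σ≤-swap r (λ μ s → if does (excess ls μ ℕ.≤? s) then F μ s else + 0) (strips (width k ls) ls)) ⟩
  sumℤ (map (λ μ → Σ≤ r (λ s → if does (excess ls μ ℕ.≤? s) then F μ s else + 0)) (strips (width k ls) ls))
    ≡⟨ cong sumℤ (map-cong (λ μ → trans (Σ≤-from (excess ls μ) r (F μ))
         (guard-cong (excess ls μ) r λ _ x _ → reindex μ x)) (strips (width k ls) ls)) ⟩
  sumℤ (map (λ μ → guard (excess ls μ) r (λ x →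
    sbin (length (cornerRel ls μ) + above qs x) (r ∸ excess ls μ ∸ x) ℤ.* g (μ ++ parts k x qs) e)) (strips (width k ls) ls)) ∎
  where
  τ = base k ls qs
  τcore = base-CoreOf rs fit d b<
  term : ℕ → List ℕ → Ser k
  term s κ = (sgn (r ∸ s) ℤ.* binom (+ rLM k κ τ) (r ∸ s)) •S g (pmap k κ)
  F : List ℕ → ℕ → ℤ
  F μ s = sbin (length (cornerRel ls μ) + above qs (s ∸ excess ls μ)) (r ∸ s) ℤ.* g (μ ++ parts k (s ∸ excess ls μ) qs) e
  reindex : ∀ μ x → F μ (excess ls μ + x) ≡
    sbin (length (cornerRel ls μ) + above qs x) (r ∸ excess ls μ ∸ x) ℤ.* g (μ ++ parts k x qs) e
  reindex μ x rewrite m+n∸m≡n (excess ls μ) x | ∸-+-assoc r (excess ls μ) x = refl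
  inner : ∀ s → s ≤ r → sumS (map (term s) (weakStrips k τ s)) e ≡
    sumℤ (map (λ μ → if does (excess ls μ ℕ.≤? s) then F μ s else + 0) (strips (width k ls) ls))
  inner s s≤r = begin
    sumS (map (term s) (weakStrips k τ s)) e
      ≡⟨ sumS-eval (term s) (weakStrips k τ s) e ⟩
    sumℤ (map (λ κ → term s κ e) (weakStrips k τ s))
      ≡⟨ weakStrips-sum rs fit d b< r≤k r≤ s≤r (λ κ → term s κ e) ⟩
    sumℤ (map (λ μ → term s (stripCore k ls qs s μ) e) (stripsUpTo k s ls))
      ≡⟨ sumℤ-cong (stripsUpTo k s ls) (λ {μ} μ∈ → let strip = strip∈ μ∈ in cong₂ ℤ._*_
           (strip-coefficient {qs = qs} {μ = μ} rs good r≤k r≤ s≤r strip)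
           (cong (λ ν → g ν e) (CoreOf-pmap (proj₁ (stripCore-CoreOf rs fit b< r≤k r≤ s≤r strip))))) ⟩
    sumℤ (map (λ μ → F μ s) (stripsUpTo k s ls))
      ≡⟨ sumℤ-filter (λ μ → excess ls μ ℕ.≤? s) (λ μ → F μ s) (strips (width k ls) ls) ⟩
    sumℤ (map (λ μ → if does (excess ls μ ℕ.≤? s) then F μ s else + 0) (strips (width k ls) ls)) ∎
    where
    strip∈ : ∀ {μ} → μ ∈ stripsUpTo k s ls → Strip (width k ls) μ ls
    strip∈ μ∈ = ∈-strips⁻ ls (proj₁ (∈-filter⁻ (λ μ → excess ls μ ℕ.≤? s) {xs = strips (width k ls) ls} μ∈))

-- The multiplication formula

-- Only the value x + 1 can be lost, and repeated widths count once. All estimates for differences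
-- of the α_u come from this unit step.
distinct-tail : ∀ qs x → above qs x ≤ suc (above qs (suc x))
distinct-tail qs x = distinctCount-≤ (filter (x ℕ.<?_) qs) {suc x ∷ deduplicate ℕ._≟_ (filter (suc x ℕ.<?_) qs)} sub
  where
  sub : ∀ {q} → q ∈ filter (x ℕ.<?_) qs → q ∈ suc x ∷ deduplicate ℕ._≟_ (filter (suc x ℕ.<?_) qs)
  sub q∈ with ∈-filter⁻ (x ℕ.<?_) {xs = qs} q∈
  ... | q∈qs , p with m≤n⇒m<n∨m≡n p
  ...   | inj₁ q< = there (∈-deduplicate⁺ ℕ._≟_ (∈-filter⁺ (suc x ℕ.<?_) q∈qs q<))
  ...   | inj₂ eq = here (sym eq)

above-antitone : ∀ qs {x y} → x ≤ y → above qs y ≤ above qs x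
above-antitone qs {x} {y} x≤y = distinctCount-≤ (filter (y ℕ.<?_) qs) λ q∈ →
  let q∈qs , p = ∈-filter⁻ (y ℕ.<?_) {xs = qs} q∈
  in ∈-deduplicate⁺ ℕ._≟_ (∈-filter⁺ (x ℕ.<?_) q∈qs (≤-trans (s≤s x≤y) p))

above-step : ∀ qs r n → suc n ≤ r → above qs (r ∸ suc n) ≤ n + above qs (r ∸ 1)
above-step qs r zero    p = ≤-refl
above-step qs r (suc n) p = ≤-trans (distinct-tail qs (r ∸ suc (suc n)))
  (s≤s (≤-trans (≤-reflexive (cong (above qs) (sym (+-∸-assoc 1 p)))) (above-step qs r n (<⇒≤ p))))

above-none : ∀ {qs x} → All (_≤ x) qs → above qs x ≡ 0
above-none {qs} {x} q≤ = n≤0⇒n≡0 (distinctCount-≤ (filter (x ℕ.<?_) qs) {[]} λ q∈ →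
  let q∈qs , p = ∈-filter⁻ (x ℕ.<?_) {xs = qs} q∈ in contradiction (All.lookup q≤ q∈qs) (<⇒≱ p))

-- No width exceeds y - 1, and below that `above` gains at most 1 per step, so it stays one behind
-- u.
below-all : ∀ qs y → All (_< y) qs → ∀ u → 1 ≤ u → u ≤ y → above qs (y ∸ u) < u
below-all qs (suc y) q< (suc n) _ u≤y = s≤s (≤-trans (above-step qs (suc y) n u≤y)
  (≤-reflexive (trans (cong (_+_ n) (above-none (All.map ≤-pred q<))) (+-identityʳ n))))

-- The right-hand side of (1), with `above qs (r ∸ u)` standing for α_{r+1-u}.
expansion : ∀ {k} → (List ℕ → Ser k) → List ℕ → List ℕ → ℕ → Ser k
expansion {k} g qs ls r e = Σ≤ r (λ u → sbin (above qs (r ∸ u)) u ℤ.* g (ls ++ parts k (r ∸ u) qs) e)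

leading-term : ∀ {k g} qs ls r e → All (_< r) qs → expansion {k} g qs ls r e ≡ g (ls ++ parts k r qs) e
leading-term {k} {g} qs ls r e q< = trans
  (Σ≤-first r λ u u≤r → trans (cong (ℤ._* g (ls ++ parts k (r ∸ suc u) qs) e)
    (sbin-vanish (above qs (r ∸ suc u)) (suc u) (below-all qs r q< (suc u) (s≤s z≤n) u≤r))) (ℤₚ.*-zeroˡ (g (ls ++ parts k (r ∸ suc u) qs) e)))
  (trans (cong (ℤ._* g (ls ++ parts k r qs) e) (sbin-zero (above qs r))) (ℤₚ.*-identityˡ _))

expansion-reverse : ∀ {k} (g : List ℕ → Ser k) qs ls r e →
  expansion g qs ls r e ≡ Σ≤ r (λ y → sbin (above qs y) (r ∸ y) ℤ.* g (ls ++ parts k y qs) e)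
expansion-reverse {k} g qs ls r e = trans (Σ≤-reverse r _) (Σ≤-cong r λ y y≤r →
  cong (λ z → sbin (above qs z) (r ∸ y) ℤ.* g (ls ++ parts k z qs) e) (m∸[m∸n]≡n y≤r))

-- Collects the coefficient of each g_{λ̄ ∪ P ∪ (y)} as a convolution. With f a `sbin` it leads to
-- Vandermonde and the Pieri coefficients, with f a `multichoose` to the inversion of (1).
expansion-conv : ∀ {k} (g : List ℕ → Ser k) qs ls n e (f : ℕ → ℤ) →
  Σ≤ n (λ x → f (n ∸ x) ℤ.* expansion g qs ls x e) ≡
  Σ≤ n (λ y → conv (sbin (above qs y)) f (n ∸ y) ℤ.* g (ls ++ parts k y qs) e)
expansion-conv {k} g qs ls n e f = begin
  Σ≤ n (λ x → f (n ∸ x) ℤ.* expansion g qs ls x e)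
    ≡⟨ Σ≤-cong n (λ x _ → trans (cong (f (n ∸ x) ℤ.*_) (expansion-reverse g qs ls x e))
         (Σ≤-*ˡ x (f (n ∸ x)) (λ y → sbin (above qs y) (x ∸ y) ℤ.* p y))) ⟩
  Σ≤ n (λ x → Σ≤ x (λ y → f (n ∸ x) ℤ.* (sbin (above qs y) (x ∸ y) ℤ.* p y)))
    ≡⟨ Σ≤-triangle n (λ y c d → f d ℤ.* (sbin (above qs y) c ℤ.* p y)) ⟩
  Σ≤ n (λ y → Σ≤ (n ∸ y) (λ c → f (n ∸ y ∸ c) ℤ.* (sbin (above qs y) c ℤ.* p y)))
    ≡⟨ Σ≤-cong n (λ y _ → trans (Σ≤-cong (n ∸ y) λ c _ → lem (f (n ∸ y ∸ c)) (sbin (above qs y) c) (p y))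
         (trans (sym (Σ≤-*ˡ (n ∸ y) (p y) (λ c → sbin (above qs y) c ℤ.* f (n ∸ y ∸ c)))) (ℤₚ.*-comm (p y) _))) ⟩
  Σ≤ n (λ y → conv (sbin (above qs y)) f (n ∸ y) ℤ.* p y) ∎
  where
  p : ℕ → ℤ
  p y = g (ls ++ parts k y qs) e
  lem : ∀ a b c → a ℤ.* (b ℤ.* c) ≡ c ℤ.* (b ℤ.* a)
  lem = ℤ-Ring.solve-∀

excess-zero : ∀ {B μ ls} → Strip B μ ls → excess ls μ ≡ 0 → μ ≡ ls
excess-zero [] eq = refl
excess-zero {μ = m ∷ μ} {l ∷ ls} (cons l≤m _ s) eq = cong₂ _∷_
  (≤-antisym (m∸n≡0⇒m≤n (m+n≡0⇒m≡0 (m ∸ l) eq)) l≤m) (excess-zero s (m+n≡0⇒n≡0 (m ∸ l) eq))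

excess-self : ∀ ls → excess ls ls ≡ 0
excess-self []       = refl
excess-self (l ∷ ls) = cong₂ _+_ (n∸n≡0 l) (excess-self ls)

Strip-All : ∀ {c B μ ls} → Strip B μ ls → All (c ≤_) ls → All (c ≤_) μ
Strip-All []             []       = []
Strip-All (cons l≤m _ s) (p ∷ ps) = ≤-trans p l≤m ∷ Strip-All s ps

Strip-Decr : ∀ {B μ ls} → Strip B μ ls → Decr μ
Strip-Decr []                                = tt
Strip-Decr (cons _ _ [])                     = tt
Strip-Decr (cons l≤m _ s@(cons _ m′≤l _)) = ≤-trans m′≤l l≤m , Strip-Decr s

Strip-Good : ∀ {k b μ ls} → Good k b ls → Strip (width k ls) μ ls → Good k b μ
Strip-Good             (fit , d , b<) []                                 = tt , tt , []
Strip-Good {ls = l ∷ ls} (fit , d , b<) s@(cons {m = m} _ m≤ t) =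
  subst (λ n → m + n ≤ _) (sym (Strip-length t)) (top-≤ {l = l} ls fit m≤) , Strip-Decr s , Strip-All s b<

Decr-init : ∀ ls {y} → Decr (ls ++ y ∷ []) → Decr ls × All (y ≤_) ls
Decr-init []            d       = tt , []
Decr-init (l ∷ [])      (p , d) = tt , p ∷ []
Decr-init (l ∷ l′ ∷ ls) (p , d) with Decr-init (l′ ∷ ls) d
... | d′ , q ∷ qs = (p , d′) , ≤-trans q p ∷ q ∷ qs

init-Good : ∀ {k b} ls y → Good k b (ls ++ y ∷ []) → Good k b ls × All (y ≤_) ls
init-Good ls y (fit , d , b<) = (fit′ ls fit , proj₁ (Decr-init ls d) , Allₚ.++⁻ˡ ls b<) , proj₂ (Decr-init ls d)
  where
  fit′ : ∀ {k} ls → Fits k (ls ++ y ∷ []) → Fits k ls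
  fit′ []       fit = tt
  fit′ (l ∷ ls) fit = ≤-trans (+-monoʳ-≤ l (≤-trans (m≤m+n (length ls) 1) (≤-reflexive (sym (length-++ ls))))) fit

parts-large : ∀ {k b qs} → Rects k b qs → ∀ {y} → 1 ≤ y → b ≤ y → parts k y qs ≡ y ∷ parts k 0 qs
parts-large [] {suc y} _ _ = refl
parts-large {k} (cons {q = q} {qs} 1≤q _ q≤b rs) {y} 1≤y b≤y = cong₂ _∷_ (m≤n⇒m⊔n≡n q≤y) (begin
  replicate (k ∸ q) q ++ parts k (y ⊓ q) qs      ≡⟨ cong (λ z → replicate (k ∸ q) q ++ parts k z qs) (m≥n⇒m⊓n≡n q≤y) ⟩
  replicate (k ∸ q) q ++ parts k q qs            ≡⟨ cong (replicate (k ∸ q) q ++_) (parts-large rs 1≤q ≤-refl) ⟩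
  replicate (k ∸ q) q ++ q ∷ parts k 0 qs        ≡⟨ commute (k ∸ q) ⟩
  q ∷ replicate (k ∸ q) q ++ parts k 0 qs        ≡⟨ cong (_∷ replicate (k ∸ q) q ++ parts k 0 qs) (sym (⊔-identityʳ q)) ⟩
  (q ⊔ 0) ∷ replicate (k ∸ q) q ++ parts k 0 qs  ∎)
  where
  q≤y = ≤-trans q≤b b≤y
  commute : ∀ d {ys} → replicate d q ++ q ∷ ys ≡ q ∷ replicate d q ++ ys
  commute zero    = refl
  commute (suc d) = cong (q ∷_) (commute d)

-- Products with g_P

module Factorization {k : ℕ} {g : List ℕ → Ser k} {b : ℕ} {qs : List ℕ} (isg : IsKkSchur k g) (rs : Rects k b qs) where

  P : List ℕ
  P = parts k 0 qs

  Factors : List ℕ → Set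
  Factors ls = (g P *S g ls) ≈S g (ls ++ P)

  Expands : List ℕ → ℕ → Set
  Expands ls r = (g P *S g (ls ++ single r)) ≈S expansion g qs ls r

  -- Both sides are h_r g_P g_λ̄, with the Pieri rule applied to g_λ̄ alone and to g_{λ̄ ∪ P}.
  -- Vandermonde splits the corner count of the latter into that of λ̄ and that of P, and the share
  -- of P assembles the expansions.
  two-ways : ∀ {ls r} → Good k b ls → r ≤ k → All (r ≤_) ls → Factors ls → ∀ e →
    sumℤ (map (λ μ → guard (excess ls μ) r (λ x → sbin (length (cornerRel ls μ)) (r ∸ excess ls μ ∸ x) ℤ.* (g P *S g (μ ++ single x)) e)) (strips (width k ls) ls)) ≡
    sumℤ (map (λ μ → guard (excess ls μ) r (λ x → sbin (length (cornerRel ls μ)) (r ∸ excess ls μ ∸ x) ℤ.* expansion g qs μ x e)) (strips (width k ls) ls))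
  two-ways {ls} {r} good@(fit , d , b<) r≤k r≤ factors e = begin
    sumℤ (map (λ μ → guard (excess ls μ) r (λ x → sbin (B μ) (r ∸ excess ls μ ∸ x) ℤ.* (g P *S g (μ ++ single x)) e)) (strips (width k ls) ls))
      ≡⟨ cong sumℤ (map-cong (λ μ → sym (into-guard (excess ls μ) (λ x → sbin (B μ) (r ∸ excess ls μ ∸ x)) (λ x → g (μ ++ single x)))) (strips (width k ls) ls)) ⟩
    sumℤ (map (λ μ → (g P *S term μ) e) (strips (width k ls) ls))
      ≡⟨ sym (*S-sumʳ (g P) term (strips (width k ls) ls) e) ⟩
    (g P *S (λ w → sumℤ (map (λ μ → term μ w) (strips (width k ls) ls)))) e
      ≡⟨ *S-cong {p = g P} (λ _ → refl) (λ w → sym (small w)) e ⟩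
    (g P *S (hS k r *S g ls)) e
      ≡⟨ *S-leftComm (g P) (hS k r) (g ls) e ⟩
    (hS k r *S (g P *S g ls)) e
      ≡⟨ *S-cong {p = hS k r} (λ _ → refl) factors e ⟩
    (hS k r *S g (ls ++ P)) e
      ≡⟨ pieri isg rs good r≤k r≤ e ⟩
    sumℤ (map (λ μ → guard (excess ls μ) r (λ x → sbin (B μ + above qs x) (r ∸ excess ls μ ∸ x) ℤ.* g (μ ++ parts k x qs) e)) (strips (width k ls) ls))
      ≡⟨ cong sumℤ (map-cong (λ μ → if-cong (excess ls μ) (sym (trans
           (expansion-conv g qs μ (r ∸ excess ls μ) e (sbin (B μ)))
           (Σ≤-cong (r ∸ excess ls μ) λ y _ → cong (ℤ._* g (μ ++ parts k y qs) e)
             (trans (sbin-Vandermonde (above qs y) (B μ) _) (cong (λ a → sbin a (r ∸ excess ls μ ∸ y)) (+-comm (above qs y) (B μ)))))))) (strips (width k ls) ls)) ⟩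
    sumℤ (map (λ μ → guard (excess ls μ) r (λ x → sbin (B μ) (r ∸ excess ls μ ∸ x) ℤ.* expansion g qs μ x e)) (strips (width k ls) ls)) ∎
    where
    B : List ℕ → ℕ
    B μ = length (cornerRel ls μ)
    term : List ℕ → Ser k
    term μ w = guard (excess ls μ) r (λ x → sbin (B μ) (r ∸ excess ls μ ∸ x) ℤ.* g (μ ++ single x) w)
    if-cong : ∀ c {x y : ℤ} → x ≡ y → (if does (c ℕ.≤? r) then x else + 0) ≡ (if does (c ℕ.≤? r) then y else + 0)
    if-cong c eq = cong (λ z → if does (c ℕ.≤? r) then z else + 0) eq
    small : ∀ w → (hS k r *S g ls) w ≡ sumℤ (map (λ μ → term μ w) (strips (width k ls) ls))
    small w = begin
      (hS k r *S g ls) w         ≡⟨ cong (λ ν → (hS k r *S g ν) w) (sym (++-identityʳ ls)) ⟩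
      (hS k r *S g (ls ++ [])) w ≡⟨ pieri {qs = []} isg ([] {b = b}) good r≤k r≤ w ⟩
      sumℤ (map (λ μ → guard (excess ls μ) r (λ x → sbin (B μ + 0) (r ∸ excess ls μ ∸ x) ℤ.* g (μ ++ single x) w)) (strips (width k ls) ls))
        ≡⟨ cong sumℤ (map-cong (λ μ → cong (λ a → guard (excess ls μ) r (λ x → sbin a (r ∸ excess ls μ ∸ x) ℤ.* g (μ ++ single x) w)) (+-identityʳ (B μ))) (strips (width k ls) ls)) ⟩
      sumℤ (map (λ μ → term μ w) (strips (width k ls) ls)) ∎
    into-guard : ∀ c (f : ℕ → ℤ) (G : ℕ → Ser k) →
      (g P *S (λ w → guard c r (λ x → f x ℤ.* G x w))) e ≡ guard c r (λ x → f x ℤ.* (g P *S G x) e)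
    into-guard c f G with does (c ℕ.≤? r)
    ... | true  = trans (*S-Σ≤ʳ (r ∸ c) (g P) (λ x w → f x ℤ.* G x w) e) (Σ≤-cong (r ∸ c) λ x _ → *S-scaleʳ (g P) (f x) (G x) e)
    ... | false = trans (*S-comm (g P) zeroS e) (*S-zeroˡ (g P) e)

  -- Any μ other than λ̄ uses up a cell, so its terms have x ≤ r and agree by induction. What
  -- remains is x = r + 1 over λ̄ itself, with the coefficient of z^0 in (1 - z)^B, which is 1.
  expand-step : ∀ {ls r} → Good k b ls → suc r ≤ k → All (suc r ≤_) ls → Factors ls →
    (∀ {μ x} → Strip (width k ls) μ ls → x ≤ r → Expands μ x) → Expands ls (suc r)
  expand-step {ls} {r} good@(fit , d , b<) r≤k r≤ factors ih e = begin
    X ls (suc r)                    ≡⟨ sym (ℤₚ.*-identityˡ _) ⟩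
    + 1 ℤ.* X ls (suc r)            ≡⟨ cong (ℤ._* X ls (suc r)) (sym lead) ⟩
    h (X ls) (suc r)                ≡⟨ ∙-cancelˡ (Σ≤ r (h (X ls))) _ _ sums ⟩
    h (Y ls) (suc r)                ≡⟨ cong (ℤ._* Y ls (suc r)) lead ⟩
    + 1 ℤ.* Y ls (suc r)            ≡⟨ ℤₚ.*-identityˡ _ ⟩
    Y ls (suc r)                    ∎
    where
    X Y : List ℕ → ℕ → ℤ
    X μ x = (g P *S g (μ ++ single x)) e
    Y μ x = expansion g qs μ x e
    B = length (cornerRel ls ls)
    h : (ℕ → ℤ) → ℕ → ℤ
    h Z x = sbin B (suc r ∸ x) ℤ.* Z x
    lead : sbin B (suc r ∸ suc r) ≡ + 1
    lead = trans (cong (sbin B) (n∸n≡0 r)) (sbin-zero B)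
    S : (List ℕ → ℕ → ℤ) → List ℕ → ℤ
    S Z μ = guard (excess ls μ) (suc r) (λ x → sbin (length (cornerRel ls μ)) (suc r ∸ excess ls μ ∸ x) ℤ.* Z μ x)
    others : ∀ {μ} → μ ∈ strips (width k ls) ls → μ ≢ ls → S X μ ≡ S Y μ
    others {μ} μ∈ μ≢ = guard-cong (excess ls μ) (suc r) λ _ x x≤ →
      cong (sbin (length (cornerRel ls μ)) (suc r ∸ excess ls μ ∸ x) ℤ.*_) (ih strip (≤-trans x≤ (∸-monoʳ-≤ (suc r) pos)) e)
      where
      strip = ∈-strips⁻ ls μ∈
      pos : 1 ≤ excess ls μ
      pos = n≢0⇒n>0 (μ≢ ∘ excess-zero strip)
    self : ∀ Z → S Z ls ≡ Σ≤ (suc r) (h (Z ls))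
    self Z rewrite excess-self ls = refl
    at-self : S X ls ≡ S Y ls
    at-self = sumℤ-isolate {f = S X} {S Y} (strips-unique (width k ls) ls) (∈-strips⁺ (Strip-self ls d fit)) others
      (two-ways good r≤k r≤ factors e)
    sums : Σ≤ r (h (X ls)) ℤ.+ h (X ls) (suc r) ≡ Σ≤ r (h (X ls)) ℤ.+ h (Y ls) (suc r)
    sums = begin
      Σ≤ r (h (X ls)) ℤ.+ h (X ls) (suc r) ≡⟨ sym (Σ≤-last r (h (X ls))) ⟩
      Σ≤ (suc r) (h (X ls))                ≡⟨ sym (self X) ⟩
      S X ls                               ≡⟨ at-self ⟩
      S Y ls                               ≡⟨ self Y ⟩
      Σ≤ (suc r) (h (Y ls))                ≡⟨ Σ≤-last r (h (Y ls)) ⟩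
      Σ≤ r (h (Y ls)) ℤ.+ h (Y ls) (suc r) ≡⟨ cong (ℤ._+ h (Y ls) (suc r)) (Σ≤-cong r λ x x≤r →
                                               cong (sbin B (suc r ∸ x) ℤ.*_) (sym (ih (Strip-self ls d fit) x≤r e))) ⟩
      Σ≤ r (h (X ls)) ℤ.+ h (Y ls) (suc r) ∎

  -- `R` bounds r and carries the recursion, because the step calls for every x ≤ r and every strip
  -- μ of the same length L.
  expand-all : ∀ {L} → (∀ {ls} → length ls ≡ L → Good k b ls → Factors ls) →
    ∀ R {ls r} → r ≤ R → length ls ≡ L → Good k b ls → r ≤ k → All (r ≤_) ls → Expands ls r
  expand-all factors R {ls} {zero} _ len good _ _ e = begin
    (g P *S g (ls ++ [])) e                      ≡⟨ cong (λ ν → (g P *S g ν) e) (++-identityʳ ls) ⟩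
    (g P *S g ls) e                              ≡⟨ factors len good e ⟩
    g (ls ++ P) e                                ≡⟨ sym (ℤₚ.*-identityˡ _) ⟩
    + 1 ℤ.* g (ls ++ P) e                        ≡⟨ cong (ℤ._* g (ls ++ P) e) (sym (sbin-zero (above qs 0))) ⟩
    sbin (above qs 0) 0 ℤ.* g (ls ++ P) e        ∎
  expand-all factors (suc R) {ls} {suc r} (s≤s r≤R) len good r≤k r≤ =
    expand-step good r≤k r≤ (factors len good) λ {μ} {x} strip x≤r →
      expand-all factors R (≤-trans x≤r r≤R) (trans (Strip-length strip) len) (Strip-Good good strip)
        (≤-trans x≤r (<⇒≤ r≤k)) (Strip-All strip (All.map (λ p → ≤-trans x≤r (<⇒≤ p)) r≤))

  -- The last part y of λ̄ exceeds every width. Formula (1) for the shorter partition with r = y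
  -- thus has a single term, and P ∪ (y) begins with y.
  factors : ∀ L {ls} → length ls ≡ L → Good k b ls → Factors ls
  factors zero {[]} _ _ e = trans (*S-cong {p = g P} (λ _ → refl) (proj₁ (proj₂ isg)) e) (*S-identityʳ (g P) e)
  factors (suc L) {ls} len good e with initLast ls
  ... | ls₀ ∷ʳ′ y = begin
    (g P *S g (ls₀ ++ y ∷ [])) e                    ≡⟨ cong (λ ν → (g P *S g (ls₀ ++ ν)) e) (sym (single-pos y≥1)) ⟩
    (g P *S g (ls₀ ++ single y)) e                  ≡⟨ expand-all (factors L) y ≤-refl len₀ (proj₁ good₀) y≤k (proj₂ good₀) e ⟩
    expansion g qs ls₀ y e                          ≡⟨ leading-term {g = g} qs ls₀ y e (All.map (λ p → ≤-trans (s≤s p) b<y) (Rects-All rs)) ⟩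
    g (ls₀ ++ parts k y qs) e                       ≡⟨ cong (λ ν → g (ls₀ ++ ν) e) (parts-large rs y≥1 (<⇒≤ b<y)) ⟩
    g (ls₀ ++ y ∷ P) e                              ≡⟨ cong (λ ν → g ν e) (sym (++-assoc ls₀ (y ∷ []) P)) ⟩
    g ((ls₀ ++ y ∷ []) ++ P) e                      ∎
    where
    good₀ = init-Good ls₀ y good
    b<y : b < y
    b<y with Allₚ.++⁻ʳ ls₀ (proj₂ (proj₂ good))
    ... | p ∷ [] = p
    y≥1 : 1 ≤ y
    y≥1 = ≤-trans (s≤s z≤n) b<y
    len₀ : length ls₀ ≡ L
    len₀ = suc-injective (trans (sym (trans (length-++ ls₀) (+-comm (length ls₀) 1))) len)
    y≤k : y ≤ k
    y≤k = bound ls₀ (proj₁ good) (proj₂ good₀)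
      where
      bound : ∀ ls → Fits k (ls ++ y ∷ []) → All (y ≤_) ls → y ≤ k
      bound []       fit []      = ≤-trans (m≤m+n y 0) fit
      bound (l ∷ ls) fit (p ∷ _) = ≤-trans p (≤-trans (m≤m+n l _) fit)

  expand : ∀ {ls r} → Good k b ls → r ≤ k → All (r ≤_) ls → Expands ls r
  expand {ls} {r} = expand-all (factors (length ls)) r ≤-refl refl

  invert : ∀ {ls r} → Good k b ls → 1 ≤ r → r ≤ k → All (r ≤_) ls → ∀ e →
    Σ≤ r (λ s → multichoose (above qs (r ∸ 1)) s ℤ.* (g P *S g (ls ++ single (r ∸ s))) e) ≡ g (ls ++ parts k r qs) e
  invert {ls} {r@(suc r′)} good _ r≤k r≤ e = begin
    Σ≤ r (λ s → mc s ℤ.* (g P *S g (ls ++ single (r ∸ s))) e)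
      ≡⟨ Σ≤-cong r (λ s s≤r → cong (mc s ℤ.*_) (expand good (≤-trans (m∸n≤m r s) r≤k) (All.map (≤-trans (m∸n≤m r s)) r≤) e)) ⟩
    Σ≤ r (λ s → mc s ℤ.* expansion g qs ls (r ∸ s) e)
      ≡⟨ Σ≤-reverse r (λ s → mc s ℤ.* expansion g qs ls (r ∸ s) e) ⟩
    Σ≤ r (λ x → mc (r ∸ x) ℤ.* expansion g qs ls (r ∸ (r ∸ x)) e)
      ≡⟨ Σ≤-cong r (λ x x≤r → cong (λ z → mc (r ∸ x) ℤ.* expansion g qs ls z e) (m∸[m∸n]≡n x≤r)) ⟩
    Σ≤ r (λ x → mc (r ∸ x) ℤ.* expansion g qs ls x e)
      ≡⟨ expansion-conv g qs ls r e mc ⟩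
    Σ≤ r (λ y → conv (sbin (above qs y)) mc (r ∸ y) ℤ.* p y)
      ≡⟨ Σ≤-last r′ _ ⟩
    Σ≤ r′ (λ y → conv (sbin (above qs y)) mc (r ∸ y) ℤ.* p y) ℤ.+ conv (sbin (above qs r)) mc (r ∸ r) ℤ.* p r
      ≡⟨ cong₂ ℤ._+_ (Σ≤-zero r′ λ y y≤ → trans (cong (ℤ._* p y) (cancel y y≤)) (ℤₚ.*-zeroˡ (p y)))
           (trans (cong (ℤ._* p r) unit) (ℤₚ.*-identityˡ (p r))) ⟩
    + 0 ℤ.+ p r
      ≡⟨ ℤₚ.+-identityˡ (p r) ⟩
    p r ∎
    where
    a = above qs r′
    mc = multichoose a
    p : ℕ → ℤ
    p y = g (ls ++ parts k y qs) e
    mc-zero : ∀ a → multichoose a 0 ≡ + 1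
    mc-zero zero    = refl
    mc-zero (suc a) = refl
    unit : conv (sbin (above qs r)) mc (r ∸ r) ≡ + 1
    unit = trans (cong (conv (sbin (above qs r)) mc) (n∸n≡0 r)) (cong₂ ℤ._*_ (sbin-zero (above qs r)) (mc-zero a))
    cancel : ∀ y → y ≤ r′ → conv (sbin (above qs y)) mc (r ∸ y) ≡ + 0
    cancel y y≤ with m≤n⇒∃[o]m+o≡n (above-antitone qs y≤)
    ... | j , eq = begin
      conv (sbin (above qs y)) mc (r ∸ y)  ≡⟨ conv-comm (sbin (above qs y)) mc (r ∸ y) ⟩
      conv mc (sbin (above qs y)) (r ∸ y)  ≡⟨ cong (λ c → conv mc (sbin c) (r ∸ y)) (sym eq) ⟩
      conv mc (sbin (a + j)) (r ∸ y)       ≡⟨ multichoose-sbin a j (r ∸ y) ⟩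
      sbin j (r ∸ y)                       ≡⟨ sbin-vanish j (r ∸ y) small ⟩
      + 0                                  ∎
      where
      -- From r′ down to y there are r′ - y unit steps of `above`, so j ≤ r′ - y.
      small : j < r ∸ y
      small = subst (suc j ≤_) (sym (+-∸-assoc 1 y≤)) (s≤s (+-cancelˡ-≤ a _ _ (≤-trans (≤-reflexive eq)
        (≤-trans (≤-reflexive (cong (above qs) (sym (m∸[m∸n]≡n y≤))))
          (≤-trans (above-step qs (suc r′) (r′ ∸ y) (s≤s (m∸n≤m r′ y))) (≤-reflexive (+-comm (r′ ∸ y) a)))))))

-- Unions of rectangles as sorted lists

R-rows : ∀ {k q} → 1 ≤ q → q ≤ k → R k q ≡ q ∷ replicate (k ∸ q) q
R-rows {k} {suc q} _ q≤k with suc q ≤ᵇ k | ≤⇒≤ᵇ q≤k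
... | true | _ = trans (cong (λ n → replicate (n ∸ suc q) (suc q)) (+-comm k 1))
  (cong (λ n → replicate n (suc q)) (+-∸-assoc 1 q≤k))

-- Covers the empty R_t outside 1 ≤ t ≤ k; for empty λ̄ the theorem has t = k + 1.
R-width : ∀ k t → part (R k t) 1 ≤ t
R-width k t with (1 ≤ᵇ t) ∧ (t ≤ᵇ k)
... | false = z≤n
... | true  = part-All (Allₚ.replicate⁺ (k + 1 ∸ t) ≤-refl) 1

concatMap-↭ : ∀ {A B : Set} (f : A → List B) {xs ys} → xs ↭ ys → concatMap f xs ↭ concatMap f ys
concatMap-↭ f ↭.refl         = ↭.refl
concatMap-↭ f (↭.prep x p)   = ↭ₚ.++⁺ˡ (f x) (concatMap-↭ f p)
concatMap-↭ f (↭.swap x y p) = ↭.trans (↭ₚ.shifts (f x) (f y)) (↭ₚ.++⁺ˡ (f y) (↭ₚ.++⁺ˡ (f x) (concatMap-↭ f p)))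
concatMap-↭ f (↭.trans p q)  = ↭.trans (concatMap-↭ f p) (concatMap-↭ f q)

parts-↭ : ∀ {k b qs} x → Rects k b qs → parts k x qs ↭ single x ++ concatMap (R k) qs
parts-↭ x [] = ↭-reflexive (sym (++-identityʳ (single x)))
parts-↭ {k} x (cons {q = q} {qs} 1≤q q≤k _ rs) with ≤-total x q
... | inj₁ x≤q rewrite R-rows 1≤q q≤k | m≥n⇒m⊔n≡m x≤q | m≤n⇒m⊓n≡m x≤q =
  ↭.trans (↭.prep q (↭ₚ.++⁺ˡ (replicate (k ∸ q) q) (parts-↭ x rs))) (↭ₚ.shifts (q ∷ replicate (k ∸ q) q) (single x))
... | inj₂ q≤x rewrite R-rows 1≤q q≤k | m≤n⇒m⊔n≡n q≤x | m≥n⇒m⊓n≡n q≤x = large 1≤q q≤x (parts-↭ q rs)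
  where
  large : ∀ {q x ys C d} → 1 ≤ q → q ≤ x → ys ↭ single q ++ C → x ∷ replicate d q ++ ys ↭ single x ++ q ∷ replicate d q ++ C
  large {suc q} {suc x} {C = C} {d} _ _ p = ↭.prep (suc x) (↭.trans (↭ₚ.++⁺ˡ (replicate d (suc q)) p) (↭ₚ.shift (suc q) (replicate d (suc q)) C))

single-All : ∀ {p} x → (1 ≤ x → p ≤ x) → All (p ≤_) (single x)
single-All zero    h = []
single-All (suc x) h = h (s≤s z≤n) ∷ []

parts-pos : ∀ {k b qs} x → Rects k b qs → All (1 ≤_) (parts k x qs)
parts-pos x [] = single-All x id
parts-pos {k} x (cons {q = q} 1≤q _ _ rs) =
  ≤-trans 1≤q (m≤m⊔n q x) ∷ Allₚ.++⁺ (Allₚ.replicate⁺ (k ∸ q) 1≤q) (parts-pos (x ⊓ q) rs)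

parts-head : ∀ {k b qs} x → Rects k b qs → part (parts k x qs) 1 ≤ b ⊔ x
parts-head {b = b} x []              = ≤-trans (≤-reflexive (part-single x)) (m≤n⊔m b x)
parts-head         x (cons _ _ q≤b _) = ⊔-monoˡ-≤ x q≤b

Decr-++ : ∀ {xs ys} → Decr xs → All (part ys 1 ≤_) xs → Decr ys → Decr (xs ++ ys)
Decr-++ {[]}         d []       e = e
Decr-++ {x ∷ []}     d (p ∷ []) e = Decr-∷ _ p e
Decr-++ {x ∷ y ∷ xs} (q , d) (_ ∷ p) e = q , Decr-++ d p e

Decr-replicate : ∀ n q → Decr (replicate n q)
Decr-replicate zero          q = tt
Decr-replicate (suc zero)    q = tt
Decr-replicate (suc (suc n)) q = ≤-refl , Decr-replicate (suc n) q

Decr-single : ∀ x → Decr (single x)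
Decr-single zero    = tt
Decr-single (suc x) = tt

parts-Decr : ∀ {k b qs} x → Rects k b qs → Decr (parts k x qs)
parts-Decr x [] = Decr-single x
parts-Decr {k} x (cons {q = q} {qs} _ _ _ rs) = Decr-∷ (replicate (k ∸ q) q ++ parts k (x ⊓ q) qs)
  (≤-trans (part-replicate-head (k ∸ q) head) (m≤m⊔n q x))
  (Decr-++ (Decr-replicate (k ∸ q) q) (Allₚ.replicate⁺ (k ∸ q) head) (parts-Decr (x ⊓ q) rs))
  where
  head : part (parts k (x ⊓ q) qs) 1 ≤ q
  head = ≤-trans (parts-head (x ⊓ q) rs) (⊔-lub ≤-refl (m⊓n≤n x q))

Rects-intro : ∀ {k b} qs → Decr qs → All (λ q → 1 ≤ q × q ≤ k) qs → part qs 1 ≤ b → Rects k b qs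
Rects-intro []       d []             p = []
Rects-intro (q ∷ qs) d ((l , u) ∷ ps) p = cons l u p (Rects-intro qs (Decr-tail qs d) ps (Decr-head qs d))

∪-single : ∀ {ls x} → Decr ls → All (1 ≤_) ls → All (x ≤_) ls → ls ∪P single x ≡ ls ++ single x
∪-single {ls} {x} d pos x≤ = sortD-unique (Allₚ.++⁺ pos (single-All x id)) ↭.refl
  (Decr-++ d (All.map (≤-trans (≤-reflexive (part-single x))) x≤) (Decr-single x))

-- The multisets agree by `parts-↭`, and the right-hand list is sorted because the parts of λ̄
-- exceed b and are at least x.
parts-∪ : ∀ {k b qs ls x} → Rects k b qs → Decr ls → All (b <_) ls → All (x ≤_) ls →
  parts k 0 qs ∪P (ls ++ single x) ≡ ls ++ parts k x qs
parts-∪ {k} {b} {qs} {ls} {x} rs d b< x≤ = sortD-unique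
  (Allₚ.++⁺ (parts-pos 0 rs) (Allₚ.++⁺ (All.map (≤-trans (s≤s z≤n)) b<) (single-All x id)))
  (↭.trans (↭ₚ.shifts (parts k 0 qs) ls) (↭ₚ.++⁺ˡ ls (↭.trans (↭ₚ.++-comm (parts k 0 qs) (single x))
    (↭.trans (↭ₚ.++⁺ˡ (single x) (parts-↭ 0 rs)) (↭-sym (parts-↭ x rs))))))
  (Decr-++ d (All.zipWith (λ { (p , q) → ≤-trans (parts-head x rs) (⊔-lub (<⇒≤ p) q) }) (b< , x≤)) (parts-Decr x rs))

-- Splitting off the last part, and the partition P of the theorem

init-last : ∀ x xs → x ∷ xs ≡ initP (x ∷ xs) ++ lastP (x ∷ xs) ∷ []
init-last x []       = refl
init-last x (y ∷ xs) = cong (x ∷_) (init-last y xs)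

All-last : ∀ {q y} ls → Decr ls → (1 ≤ length ls → q < part (ls ++ y ∷ []) (length ls)) → All (q <_) ls
All-last []            d       h = []
All-last (l ∷ [])      d       h = h (s≤s z≤n) ∷ []
All-last (l ∷ l′ ∷ ls) (p , d) h with All-last (l′ ∷ ls) d (λ _ → h (s≤s z≤n))
... | q ∷ qs = ≤-trans q p ∷ q ∷ qs

module Rectangles (k m : ℕ) (t a : Fin m → ℕ) (t-range : ∀ v → 1 ≤ t v × t v ≤ k)
  (t-inj : ∀ v w → t v ≡ t w → v ≡ w) (a-pos : ∀ v → 1 ≤ a v) where

  widths : List (Fin m) → List ℕ
  widths vs = concat (map (λ v → replicate (a v) (t v)) vs)

  ∈-widths⁻ : ∀ vs {q} → q ∈ widths vs → ∃ λ v → q ≡ t v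
  ∈-widths⁻ (v ∷ vs) q∈ with ∈-++⁻ (replicate (a v) (t v)) q∈
  ... | inj₁ p = v , All.lookup {P = _≡ t v} (Allₚ.replicate⁺ (a v) refl) p
  ... | inj₂ p = ∈-widths⁻ vs p

  ∈-widths⁺ : ∀ {vs v} → v ∈ vs → t v ∈ widths vs
  ∈-widths⁺ {v ∷ vs} (here refl) = ∈-++⁺ˡ (go (a-pos v))
    where
    go : ∀ {n q} → 1 ≤ n → q ∈ replicate n q
    go (s≤s _) = here refl
  ∈-widths⁺ {w ∷ vs} (there v∈)  = ∈-++⁺ʳ (replicate (a w) (t w)) (∈-widths⁺ v∈)

  widths-range : ∀ vs → All (λ q → 1 ≤ q × q ≤ k) (widths vs)
  widths-range vs = All.tabulate λ q∈ → let v , eq = ∈-widths⁻ vs q∈ in subst (λ q → 1 ≤ q × q ≤ k) (sym eq) (t-range v)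

  widths-R : ∀ vs → concat (map (λ v → concat (replicate (a v) (R k (t v)))) vs) ≡ concatMap (R k) (widths vs)
  widths-R []       = refl
  widths-R (v ∷ vs) = trans (cong₂ _++_ (cong concat (sym (map-replicate (R k) (a v) (t v)))) (widths-R vs))
    (sym (concatMap-++ (R k) (replicate (a v) (t v)) (widths vs)))

  qs : List ℕ
  qs = sortD (widths (allFin m))

  qs-↭ : qs ↭ widths (allFin m)
  qs-↭ = sortD-↭ (All.map proj₁ (widths-range (allFin m)))

  ∈-qs⁻ : ∀ {q} → q ∈ qs → ∃ λ v → q ≡ t v
  ∈-qs⁻ q∈ = ∈-widths⁻ (allFin m) (↭ₚ.∈-resp-↭ qs-↭ q∈)

  rects : Rects k (part qs 1) qs
  rects = Rects-intro qs (sortD-Decr (widths (allFin m))) (↭ₚ.All-resp-↭ (↭-sym qs-↭) (widths-range (allFin m))) ≤-refl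

  bigP≡parts : bigP k m t a ≡ parts k 0 qs
  bigP≡parts = sortD-unique (↭ₚ.All-resp-↭ (↭-sym perm) (parts-pos 0 rects)) perm (parts-Decr 0 rects)
    where
    perm : concat (map (λ v → concat (replicate (a v) (R k (t v)))) (allFin m)) ↭ parts k 0 qs
    perm = ↭.trans (↭-reflexive (widths-R (allFin m)))
      (↭.trans (concatMap-↭ (R k) (↭-sym qs-↭)) (↭-sym (parts-↭ 0 rects)))

  -- As the t_v are distinct, the indices v with t_v > x correspond to the distinct widths above x,
  -- however often each rectangle is repeated.
  α≡above : ∀ x → α m t (suc x) ≡ above qs x
  α≡above x = trans (sym (length-map t vs)) (≤-antisym
    (≤-distinctCount (Uniqueₚ.map⁺ (t-inj _ _) (Uniqueₚ.filter⁺ (λ v → suc x ℕ.≤? t v) (Uniqueₚ.allFin⁺ m))) to)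
    (distinctCount-≤ (filter (x ℕ.<?_) qs) from))
    where
    vs = filter (λ v → suc x ℕ.≤? t v) (allFin m)
    to : ∀ {q} → q ∈ map t vs → q ∈ filter (x ℕ.<?_) qs
    to q∈ with ∈-map⁻ t q∈
    ... | v , v∈ , refl = ∈-filter⁺ (x ℕ.<?_) (↭ₚ.∈-resp-↭ (↭-sym qs-↭) (∈-widths⁺ (∈-allFin v)))
      (∈-filter⁻ (λ v → suc x ℕ.≤? t v) {xs = allFin m} v∈ .proj₂)
    from : ∀ {q} → q ∈ filter (x ℕ.<?_) qs → q ∈ map t vs
    from q∈ with ∈-filter⁻ (x ℕ.<?_) {xs = qs} q∈
    ... | q∈qs , p with ∈-qs⁻ q∈qs
    ... | v , refl = ∈-map⁺ t (∈-filter⁺ (λ v → suc x ℕ.≤? t v) (∈-allFin v) p)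

  module Product {g : List ℕ → Ser k} (isg : IsKkSchur k g) (ls : List ℕ) (r : ℕ) (1≤r : 1 ≤ r) (r≤k : r ≤ k)
    (good : Good k (part qs 1) ls) (r≤ : All (r ≤_) ls) where

    open Factorization isg rects

    big = bigP k m t a

    union : ∀ x → x ≤ r → big ∪P (ls ++ single x) ≡ ls ++ parts k x qs
    union x x≤r = trans (cong (_∪P (ls ++ single x)) bigP≡parts)
      (parts-∪ rects (proj₁ (proj₂ good)) (proj₂ (proj₂ good)) (All.map (≤-trans x≤r) r≤))

    small-union : ∀ x → x ≤ r → ls ∪P single x ≡ ls ++ single x
    small-union x x≤r = ∪-single (proj₁ (proj₂ good)) (All.map (≤-trans (s≤s z≤n)) (proj₂ (proj₂ good))) (All.map (≤-trans x≤r) r≤)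

    product : g big *S g (ls ++ single r) ≈S
      sumS (map (λ s → (sgn s ℤ.* binom (+ α m t (r + 1 ∸ s)) s) •S g (big ∪P ls ∪P single (r ∸ s))) (upTo (suc r)))
    product e = begin
      (g big *S g (ls ++ single r)) e
        ≡⟨ cong (λ ν → (g ν *S g (ls ++ single r)) e) bigP≡parts ⟩
      (g P *S g (ls ++ single r)) e
        ≡⟨ expand good r≤k r≤ e ⟩
      Σ≤ r (λ s → sbin (above qs (r ∸ s)) s ℤ.* g (ls ++ parts k (r ∸ s) qs) e)
        ≡⟨ Σ≤-cong r (λ s s≤r → sym (cong₂ ℤ._*_
             (trans (sgn-binom (α m t (r + 1 ∸ s)) s) (cong (λ c → sbin c s)
               (trans (cong (α m t) (trans (cong (_∸ s) (+-comm r 1)) (+-∸-assoc 1 s≤r))) (α≡above (r ∸ s)))))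
             (cong (λ ν → g ν e) (trans (cong (big ∪P_) (small-union (r ∸ s) (m∸n≤m r s))) (union (r ∸ s) (m∸n≤m r s)))))) ⟩
      Σ≤ r (λ s → term s e)
        ≡⟨ sym (sumℤ-upTo r (λ s → term s e)) ⟩
      sumℤ (map (λ s → term s e) (upTo (suc r)))
        ≡⟨ sym (sumS-eval term (upTo (suc r)) e) ⟩
      sumS (map term (upTo (suc r))) e ∎
      where
      term : ℕ → Ser k
      term s = (sgn s ℤ.* binom (+ α m t (r + 1 ∸ s)) s) •S g (big ∪P ls ∪P single (r ∸ s))

    factorization : g (big ∪P (ls ++ single r)) ≈S
      g big *S sumS (map (λ s → binom ((+ α m t r ℤ.+ + s) ℤ.- + 1) s •S g (ls ∪P single (r ∸ s))) (upTo (suc r)))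
    factorization e = begin
      g (big ∪P (ls ++ single r)) e
        ≡⟨ cong (λ ν → g ν e) (union r ≤-refl) ⟩
      g (ls ++ parts k r qs) e
        ≡⟨ sym (invert good 1≤r r≤k r≤ e) ⟩
      Σ≤ r (λ s → multichoose (above qs (r ∸ 1)) s ℤ.* (g P *S g (ls ++ single (r ∸ s))) e)
        ≡⟨ Σ≤-cong r (λ s _ → sym (trans (*S-scaleʳ (g big) (c s) (g (ls ∪P single (r ∸ s))) e) (cong₂ ℤ._*_
             (trans (binom-multichoose (α m t r) s) (cong (λ c → multichoose c s) (α-pred 1≤r)))
             (trans (cong (λ ν → (g ν *S g (ls ∪P single (r ∸ s))) e) bigP≡parts)
                    (cong (λ ν → (g P *S g ν) e) (small-union (r ∸ s) (m∸n≤m r s))))))) ⟩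
      Σ≤ r (λ s → (g big *S term s) e)
        ≡⟨ sym (sumℤ-upTo r (λ s → (g big *S term s) e)) ⟩
      sumℤ (map (λ s → (g big *S term s) e) (upTo (suc r)))
        ≡⟨ sym (*S-sumʳ (g big) term (upTo (suc r)) e) ⟩
      (g big *S (λ w → sumℤ (map (λ s → term s w) (upTo (suc r))))) e
        ≡⟨ *S-cong {p = g big} (λ _ → refl) (λ w → sym (sumS-eval term (upTo (suc r)) w)) e ⟩
      (g big *S sumS (map term (upTo (suc r)))) e ∎
      where
      c : ℕ → ℤ
      c s = binom ((+ α m t r ℤ.+ + s) ℤ.- + 1) s
      term : ℕ → Ser k
      term s = c s •S g (ls ∪P single (r ∸ s))
      α-pred : ∀ {r} → 1 ≤ r → α m t r ≡ above qs (r ∸ 1)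
      α-pred (s≤s {n = r′} _) = α≡above r′

    splitting : (∀ v → t v < r) → g (big ∪P (ls ++ single r)) ≈S g big *S g (ls ++ single r)
    splitting t< e = begin
      g (big ∪P (ls ++ single r)) e    ≡⟨ cong (λ ν → g ν e) (union r ≤-refl) ⟩
      g (ls ++ parts k r qs) e         ≡⟨ sym (leading-term {g = g} qs ls r e (All.tabulate λ q∈ →
                                            let v , eq = ∈-qs⁻ q∈ in subst (_< r) (sym eq) (t< v))) ⟩
      expansion g qs ls r e            ≡⟨ sym (expand good r≤k r≤ e) ⟩
      (g P *S g (ls ++ single r)) e    ≡⟨ cong (λ ν → (g ν *S g (ls ++ single r)) e) (sym bigP≡parts) ⟩
      (g big *S g (ls ++ single r)) e  ∎

theorem5p7 : (k : ℕ) → 1 ≤ k →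
    (g : List ℕ → Ser k) → IsKkSchur k g →
    (m : ℕ) → 1 ≤ m → (t a : Fin m → ℕ) →
    (∀ v → 1 ≤ t v × t v ≤ k) → (∀ v w → t v ≡ t w → v ≡ w) → (∀ v → 1 ≤ a v) →
    (λ' : List ℕ) → InPk k λ' → 1 ≤ length λ' →
    initP λ' ⊆P R k (k + 1 ∸ (length λ' ∸ 1)) →
    (∀ v → 1 ≤ length λ' ∸ 1 → t v < part λ' (length λ' ∸ 1)) →
    (g (bigP k m t a) *S g λ'
    ≈S sumS (map (λ s → (sgn s ℤ.* binom (+ α m t (lastP λ' + 1 ∸ s)) s)
    •S g (bigP k m t a ∪P initP λ' ∪P single (lastP λ' ∸ s)))
    (upTo (suc (lastP λ')))))
    × (g (bigP k m t a ∪P λ')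
    ≈S g (bigP k m t a) *S sumS (map (λ s → binom ((+ α m t (lastP λ') ℤ.+ + s) ℤ.- + 1) s
    •S g (initP λ' ∪P single (lastP λ' ∸ s)))
    (upTo (suc (lastP λ')))))
    × ((∀ v → t v < lastP λ') → g (bigP k m t a ∪P λ') ≈S g (bigP k m t a) *S g λ')
theorem5p7 k _ g isg m _ t a t-range t-inj a-pos (x ∷ xs) ((decr , pos) , ≤k) _ inR t< =
  subst (λ ν → g big *S g ν ≈S sumS (map (λ s → (sgn s ℤ.* binom (+ α m t (r + 1 ∸ s)) s) •S g (big ∪P ls ∪P single (r ∸ s))) (upTo (suc r)))) whole product ,
  subst (λ ν → g (big ∪P ν) ≈S g big *S sumS (map (λ s → binom ((+ α m t r ℤ.+ + s) ℤ.- + 1) s •S g (ls ∪P single (r ∸ s))) (upTo (suc r)))) whole factorization ,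
  λ t<r → subst (λ ν → g (big ∪P ν) ≈S g big *S g ν) whole (splitting t<r)
  where
  ls = initP (x ∷ xs)
  r = lastP (x ∷ xs)
  split : x ∷ xs ≡ ls ++ r ∷ []
  split = init-last x xs
  parts-of : ∀ {P : ℕ → Set} → All P (x ∷ xs) → All P ls × P r
  parts-of ps with subst (All _) split ps
  ... | qs with Allₚ.++⁻ ls qs
  ... | us , p ∷ [] = us , p
  1≤r = proj₂ (parts-of pos)
  whole : ls ++ single r ≡ x ∷ xs
  whole = trans (cong (ls ++_) (single-pos 1≤r)) (sym split)
  sorted = Decr-init ls (subst Decr split decr)
  len : length xs ≡ length ls
  len = suc-injective (trans (cong length split) (trans (length-++ ls) (+-comm (length ls) 1)))
  open Rectangles k m t a t-range t-inj a-pos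
  -- The containment in row 1 gives λ̄_1 ≤ k + 1 - l̄; since λ̄_1 is positive, the truncated
  -- subtraction is a true one.
  fits : Fits k ls
  fits = go ls (proj₁ (parts-of pos)) (≤-trans (inR 1) (≤-trans (R-width k (k + 1 ∸ length xs)) (≤-reflexive (cong₂ _∸_ (+-comm k 1) len))))
    where
    go : ∀ ls → All (1 ≤_) ls → part ls 1 ≤ suc k ∸ length ls → Fits k ls
    go []       _       _ = tt
    go (l ∷ ls) (p ∷ _) q = m≤o∸n⇒m+n≤o l (<⇒≤ (m∸n≢0⇒n<m λ eq → contradiction (≤-trans p q) (<⇒≱ (s≤s (≤-reflexive eq))))) q
  -- The first width is the largest t_v, and it suffices to compare it with the last part of λ̄.
  narrow : All (part qs 1 <_) ls
  narrow = head qs (λ q∈ → ∈-qs⁻ q∈)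
    where
    head : ∀ qs → (∀ {q} → q ∈ qs → ∃ λ v → q ≡ t v) → All (part qs 1 <_) ls
    head []       h = proj₁ (parts-of pos)
    head (q ∷ qs) h with h (here refl)
    ... | v , refl = All-last ls (proj₁ sorted) λ p → subst (t v <_) (trans (cong (part (x ∷ xs)) len) (cong (λ ν → part ν (length ls)) split))
      (t< v (≤-trans p (≤-reflexive (sym len))))
  open Product isg ls r 1≤r (proj₂ (parts-of ≤k)) (fits , proj₁ sorted , narrow) (proj₂ sorted) hiding (big)
  big = bigP k m t a
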